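{- Let $d$ be a positive integer and $\nu\in\mathbb{Q}$. The natural map $$\Psi:\ \mathrm{Max}^d_{S_\nu}\longrightarrow \mathrm{Free}^d_{S_{\nu,\pi}}\times \mathrm{Free}^d_{S_{\nu,u}},\qquad \mathcal{M}\mapsto(\mathcal{M}_\pi,\mathcal{M}_u)$$ is injective, and its image consists of the pairs $(A,B)$ such that $A$ and $B$ generate the same $\mathcal{E}$-vector space in $\mathcal{E}^d$. If a pair $(A,B)$ satisfies this condition, its unique preimage under $\Psi$ is given by $A\cap B$. Furthermore, for all $\mathcal{M},\mathcal{M}'\in\mathrm{Max}^d_{S_\nu}$, $$\Psi(\mathcal{M}\cap\mathcal{M}')=(\mathcal{M}_\pi\cap\mathcal{M}'_\pi,\ \mathcal{M}_u\cap\mathcal{M}'_u),\qquad \Psi(\mathcal{M}+_{\max}\mathcal{M}')=(\mathcal{M}_\pi+\mathcal{M}'_\pi,\ \mathcal{M}_u+\mathcal{M}'_u).$$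
   Context: $R$ is a complete discrete valuation ring with uniformizer $\pi$ and fraction field $K$; $v_K$ is the valuation on $K$ normalized by $v_K(\pi)=1$. Write $\nu=\beta/\alpha$ with $\alpha\ge 1$ and $\alpha,\beta$ coprime integers. Define: - $S_\nu=\{\sum_{i\ge 0}a_iu^i\in K[[u]] : v_K(a_i)+\nu i\ge 0\ \forall i\}$; - $S_{\nu,\pi}=S_\nu[1/\pi]=\{\sum_{i\ge0}a_iu^i : a_i\in K,\ v_K(a_i)+\nu i \text{ bounded below}\}$; - $S_{\nu,u}$, the completion of $S_\nu[\pi^\beta/u^\alpha]$ for the Gauss valuation $v_\nu(\sum a_iu^i)=\min_i(v_K(a_i)+\nu i)$, i.e. $S_{\nu,u}=\{\sum_{i\in\mathbb{Z}}a_iu^i: a_i\in K,\ v_K(a_i)+\nu i\ge0,\ \lim_{i\to-\infty}(v_K(a_i)+\nu i)=+\infty\}$; - $\mathcal{E}=\{\sum_{i\in\mathbb{Z}}a_iu^i: a_i\in K,\ v_K(a_i)+\nu i\text{ bounded below},\ \lim_{i\to-\infty}(v_K(a_i)+\nu i)=+\infty\}$, a field containing all the rings above. A morphism of finitely generated $S_\nu$-modules is a quasi-isomorphism if its kernel and cokernel have finite length. A finitely generated torsion-free $S_\nu$-module $\mathcal{M}'$ together with a quasi-isomorphism $f:\mathcal{M}\to\mathcal{M}'$ from a finitely generated torsion-free module $\mathcal{M}$ is maximal for $\mathcal{M}$ if for every finitely generated torsion-free $\mathcal{N}$ and every quasi-isomorphism $f':\mathcal{M}\to\mathcal{N}$ there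 is $g:\mathcal{N}\to\mathcal{M}'$ with $g\circ f'=f$; it is then unique up to isomorphism and denoted $\mathrm{Max}(\mathcal{M})$. For a submodule $\mathcal{M}\subset S_\nu^d$ it is realized as $\mathrm{Max}(\mathcal{M})=\{x\in S_\nu^d:\exists n\in\mathbb{N},\ \pi^nx\in\mathcal{M}\text{ and }(u^\alpha/\pi^\beta)^nx\in\mathcal{M}\}$; $\mathcal{M}$ is called maximal if $\mathrm{Max}(\mathcal{M})=\mathcal{M}$. $\mathrm{Max}^d_{S_\nu}$ is the set of maximal sub-$S_\nu$-modules of $S_\nu^d$, and $\mathcal{M}+_{\max}\mathcal{M}'=\mathrm{Max}(\mathcal{M}+\mathcal{M}')$. For $A=S_{\nu,\pi}$ or $S_{\nu,u}$, $\mathrm{Free}^d_A$ is the set of sub-$A$-modules of $A^d$ that are free over $A$. For an $S_\nu$-submodule $\mathcal{M}$ of $\mathcal{E}^d$, $\mathcal{M}_\pi$ (resp. $\mathcal{M}_u$) is the sub-$S_{\nu,\pi}$-module (resp. sub-$S_{\nu,u}$-module) of $\mathcal{E}^d$ generated by $\mathcal{M}$. -}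

module Defs where

open import Algebra.Bundles using (CommutativeRing; RawRing)
open import Algebra.Definitions.RawMonoid using () renaming (sum to sumOf)
import Algebra.Definitions.RawSemiring as RawSemiringDefs
open import Algebra.Module.Bundles.Raw using (RawLeftModule)
open import Algebra.Morphism.Structures using (module RingMorphisms)
import Algebra.Properties.Ring as RingProperties
open import Data.Fin.Base using (Fin)
open import Data.Integer.Base as ℤ using (ℤ; +_; -[1+_]; 0ℤ; 1ℤ)
import Data.Integer.Properties as ℤ
open import Data.Maybe.Base using (map; zipWith)
open import Data.Nat.Base as ℕ using (ℕ; zero; suc)
import Data.Nat.Properties as ℕ
open import Data.Product.Base using (∃-syntax; Σ-syntax; _×_; _,_; proj₁; proj₂)
open import Data.Product.Relation.Binary.Pointwise.NonDependent using (Pointwise)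
open import Data.Rational.Base as ℚ using (ℚ; ↥_; ↧_)
import Data.Rational.Properties as ℚ
import Data.Rational.Unnormalised.Base as ℚᵘ
import Data.Rational.Unnormalised.Properties as ℚᵘ
open import Data.Sum.Base using (inj₁; inj₂)
open import Data.Vec.Functional using (Vector)
open import Function.Bundles using (_⇔_; Equivalence)
open import Function.Definitions using (Injective)
open import Level using (Level; _⊔_; 0ℓ) renaming (suc to lsuc)
open import Relation.Binary.Core using (Rel)
open import Relation.Binary.PropositionalEquality as ≡ using (_≡_; _≢_; refl)
open import Relation.Nullary using (¬_; yes; no; contradiction)
open import Relation.Nullary.Construct.Add.Supremum using (_⁺; ⊤⁺; [_])
open import Relation.Unary using (Pred; _∈_; _⊆_; _≐_; U)
import Relation.Binary.Construct.Add.Supremum.NonStrict as Sup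

-- `A ⁺` adjoins a top element ⊤⁺, read as +∞.
open Sup ℤ._≤_ using () renaming (_≤⁺_ to _≤ℤ⁺_)
open Sup ℚ._≤_ using () renaming (_≤⁺_ to _≤ℚ⁺_)

private
  variable
    c ℓ : Level

record IsField (K : CommutativeRing c ℓ) : Set (c ⊔ ℓ) where
  open CommutativeRing K
  field
    1≉0     : ¬ 1# ≈ 0#
    inverse : ∀ x → ¬ x ≈ 0# → ∃[ y ] x * y ≈ 1#

record IsDiscreteValuation (K : CommutativeRing c ℓ)
                           (v : CommutativeRing.Carrier K → ℤ ⁺) : Set (c ⊔ ℓ) where
  open CommutativeRing K
  field
    v-cong : ∀ {x y} → x ≈ y → v x ≡ v y
    v-∞    : ∀ {x} → v x ≡ ⊤⁺ ⇔ x ≈ 0#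
    v-*    : ∀ x y → v (x * y) ≡ zipWith ℤ._+_ (v x) (v y)
    -- v (x + y) ≥ min (v x) (v y)
    v-+    : ∀ {x y n} → n ≤ℤ⁺ v x → n ≤ℤ⁺ v y → n ≤ℤ⁺ v (x + y)

-- R is the valuation ring of a discrete valuation v, normalised by v π = 1, on
-- its fraction field K, and is complete for v.
record CompleteDVR c ℓ : Set (lsuc (c ⊔ ℓ)) where
  field
    R K : CommutativeRing c ℓ

  module R = CommutativeRing R
  module K = CommutativeRing K

  field
    isField : IsField K
    ι       : R.Carrier → K.Carrier
    ι-mono  : RingMorphisms.IsRingMonomorphism R.rawRing K.rawRing ι
    isFrac  : ∀ x → ∃[ a ] ∃[ b ] (¬ b R.≈ R.0#) × x K.* ι b K.≈ ι a

    v           : K.Carrier → ℤ ⁺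
    isValuation : IsDiscreteValuation K v
    v-ring      : ∀ x → [ 0ℤ ] ≤ℤ⁺ v x ⇔ (∃[ a ] ι a K.≈ x)

    π   : R.Carrier
    v-π : v (ι π) ≡ [ 1ℤ ]

  IsLimitᴿ : (ℕ → R.Carrier) → R.Carrier → Set
  IsLimitᴿ s l = ∀ n → ∃[ N ] ∀ m → N ℕ.≤ m → [ n ] ≤ℤ⁺ v (ι (s m R.- l))

  IsCauchyᴿ : (ℕ → R.Carrier) → Set
  IsCauchyᴿ s = ∀ n → ∃[ N ] ∀ m m′ → N ℕ.≤ m → N ℕ.≤ m′ →
                [ n ] ≤ℤ⁺ v (ι (s m R.- s m′))

  field
    complete : ∀ s → IsCauchyᴿ s → ∃[ l ] IsLimitᴿ s l

  open IsField isField public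
  open IsDiscreteValuation isValuation public
  open RingMorphisms.IsRingMonomorphism ι-mono public
    using () renaming (⟦⟧-cong to ι-cong; injective to ι-injective;
                       +-homo to ι-+; -‿homo to ι-neg; *-homo to ι-*;
                       0#-homo to ι-0; 1#-homo to ι-1)

module Convergence (D : CompleteDVR c ℓ) where
  open CompleteDVR D
  open K hiding (zero; refl)
  open RingProperties ring
    using (-1*x≈-x; -‿+-comm)
  open import Relation.Binary.Reasoning.Setoid setoid

  infix 4 _≤v_
  _≤v_ : ℤ ⁺ → Carrier → Set
  n ≤v x = n ≤ℤ⁺ v x

  ≤v-cong : ∀ {n x y} → x ≈ y → n ≤v x → n ≤v y
  ≤v-cong {n} x≈y = ≡.subst (n ≤ℤ⁺_) (v-cong x≈y)

  ≤v-0 : ∀ {n} → n ≤v 0#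
  ≤v-0 {n} = ≡.subst (n ≤ℤ⁺_) (≡.sym (Equivalence.from v-∞ K.refl)) (n Sup.≤⊤⁺)

  ≤v-neg : ∀ {n x} → n ≤v x → n ≤v - x
  ≤v-neg {n} {x} n≤x =
    ≤v-cong (-1*x≈-x x) (≡.subst (n ≤ℤ⁺_) (≡.sym (v-* (- 1#) x)) (grow n≤x 0≤v-1))
    where
    0≤v-1 : [ 0ℤ ] ≤v - 1#
    0≤v-1 = Equivalence.from (v-ring (- 1#))
      (R.- R.1# , K.trans (ι-neg R.1#) (-‿cong ι-1))

    grow : ∀ {a b k} → k ≤ℤ⁺ a → [ 0ℤ ] ≤ℤ⁺ b → k ≤ℤ⁺ zipWith ℤ._+_ b a
    grow {⊤⁺}    {⊤⁺}    _ _ = _ Sup.≤⊤⁺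
    grow {⊤⁺}    {[ _ ]} _ _ = _ Sup.≤⊤⁺
    grow {[ _ ]} {⊤⁺}    _ _ = _ Sup.≤⊤⁺
    grow {[ a ]} {[ b ]} Sup.[ k≤a ] Sup.[ 0≤b ] =
      Sup.[ ≡.subst (ℤ._≤ b ℤ.+ a) (ℤ.+-identityˡ _) (ℤ.+-mono-≤ 0≤b k≤a) ]

  telescope : ∀ x y z → (x - y) + (y - z) ≈ x - z
  telescope x y z = begin
    (x - y) + (y - z)     ≈⟨ +-assoc x (- y) (y - z) ⟩
    x + (- y + (y - z))   ≈⟨ +-congˡ (K.sym (+-assoc (- y) y (- z))) ⟩
    x + ((- y + y) - z)   ≈⟨ +-congˡ (+-congʳ (-‿inverseˡ y)) ⟩
    x + (0# - z)          ≈⟨ +-congˡ (+-identityˡ (- z)) ⟩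
    x - z                 ∎

  neg-diff : ∀ x y → - (x - y) ≈ y - x
  neg-diff x y = begin
    - (x - y)       ≈⟨ K.sym (-‿+-comm x (- y)) ⟩
    - x + - - y     ≈⟨ +-congˡ (RingProperties.-‿involutive ring y) ⟩
    - x + y         ≈⟨ +-comm (- x) y ⟩
    y - x           ∎

  ≤v-swap : ∀ {n x y} → n ≤v x - y → n ≤v y - x
  ≤v-swap {x = x} {y} p = ≤v-cong (neg-diff x y) (≤v-neg p)

  ≤v-tele : ∀ {n x y z} → n ≤v x - y → n ≤v y - z → n ≤v x - z
  ≤v-tele {x = x} {y} {z} p q = ≤v-cong (telescope x y z) (v-+ p q)

  IsLimit : (ℕ → Carrier) → Carrier → Set
  IsLimit s l = ∀ n → ∃[ N ] ∀ m → N ℕ.≤ m → [ n ] ≤v s m - l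

  IsCauchy : (ℕ → Carrier) → Set
  IsCauchy s = ∀ n → ∃[ N ] ∀ m m′ → N ℕ.≤ m → N ℕ.≤ m′ → [ n ] ≤v s m - s m′

  -- From some index N₀ on, a Cauchy sequence differs from its N₀-th term by
  -- elements of R.
  completeᴷ : ∀ s → IsCauchy s → ∃[ l ] IsLimit s l
  completeᴷ s cauchy = s N₀ + ι lᴿ , limit
    where
    N₀ : ℕ
    N₀ = proj₁ (cauchy 0ℤ)

    pre : ∀ j → ∃[ a ] ι a ≈ s (N₀ ℕ.+ j) - s N₀
    pre j = Equivalence.to (v-ring _)
      (proj₂ (cauchy 0ℤ) (N₀ ℕ.+ j) N₀ (ℕ.m≤m+n N₀ j) ℕ.≤-refl)

    r : ℕ → R.Carrier
    r j = proj₁ (pre j)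

    ι-diff : ∀ a b → ι (a R.- b) ≈ ι a - ι b
    ι-diff a b = K.trans (ι-+ a (R.- b)) (+-congˡ (ι-neg b))

    cauchyᴿ : IsCauchyᴿ r
    cauchyᴿ n = N , λ m m′ N≤m N≤m′ → ≤v-cong (K.sym (eq m m′))
        (proj₂ (cauchy n) _ _ (ℕ.≤-trans N≤m (ℕ.m≤n+m m N₀))
                              (ℕ.≤-trans N≤m′ (ℕ.m≤n+m m′ N₀)))
      where
      N : ℕ
      N = proj₁ (cauchy n)
      eq : ∀ m m′ → ι (r m R.- r m′) ≈ s (N₀ ℕ.+ m) - s (N₀ ℕ.+ m′)
      eq m m′ = begin
        ι (r m R.- r m′)                                      ≈⟨ ι-diff _ _ ⟩
        ι (r m) - ι (r m′)                                    ≈⟨ +-cong (proj₂ (pre m)) (-‿cong (proj₂ (pre m′))) ⟩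
        (s (N₀ ℕ.+ m) - s N₀) - (s (N₀ ℕ.+ m′) - s N₀)        ≈⟨ +-congˡ (neg-diff _ _) ⟩
        (s (N₀ ℕ.+ m) - s N₀) + (s N₀ - s (N₀ ℕ.+ m′))        ≈⟨ telescope _ _ _ ⟩
        s (N₀ ℕ.+ m) - s (N₀ ℕ.+ m′)                          ∎

    lᴿ : R.Carrier
    lᴿ = proj₁ (complete r cauchyᴿ)

    eqˡ : ∀ j → ι (r j R.- lᴿ) ≈ s (N₀ ℕ.+ j) - (s N₀ + ι lᴿ)
    eqˡ j = begin
      ι (r j R.- lᴿ)                        ≈⟨ ι-diff _ _ ⟩
      ι (r j) - ι lᴿ                        ≈⟨ +-congʳ (proj₂ (pre j)) ⟩
      (s (N₀ ℕ.+ j) - s N₀) - ι lᴿ          ≈⟨ +-assoc _ _ _ ⟩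
      s (N₀ ℕ.+ j) + (- s N₀ - ι lᴿ)        ≈⟨ +-congˡ (-‿+-comm _ _) ⟩
      s (N₀ ℕ.+ j) - (s N₀ + ι lᴿ)          ∎

    limit : IsLimit s (s N₀ + ι lᴿ)
    limit n with proj₂ (complete r cauchyᴿ) n
    ... | N , h = N₀ ℕ.+ N , λ m N₀+N≤m →
      let j     = m ℕ.∸ N₀
          N₀≤m  = ℕ.≤-trans (ℕ.m≤m+n N₀ N) N₀+N≤m
          N₀+j≡m = ℕ.m+[n∸m]≡n N₀≤m
          N≤j   = ℕ.+-cancelˡ-≤ N₀ N j (≡.subst (N₀ ℕ.+ N ℕ.≤_) (≡.sym N₀+j≡m) N₀+N≤m)
      in ≡.subst (λ k → [ n ] ≤v s k - (s N₀ + ι lᴿ)) N₀+j≡m (≤v-cong (eqˡ j) (h j N≤j))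

  -- Σ_{-N ≤ i ≤ N} f i
  partialSum : (ℤ → Carrier) → ℕ → Carrier
  partialSum f zero    = f 0ℤ
  partialSum f (suc N) = partialSum f N + (f (+ suc N) + f -[1+ N ])

  IsNull : (ℤ → Carrier) → Set
  IsNull f = ∀ n → ∃[ N ] ∀ m → N ℕ.≤ m → [ n ] ≤v f (+ m) × [ n ] ≤v f (ℤ.- + m)

  partialSum-cauchy : ∀ f → IsNull f → IsCauchy (partialSum f)
  partialSum-cauchy f null n = N , λ m m′ N≤m N≤m′ →
      ≤v-tele (from-N m N≤m) (≤v-swap (from-N m′ N≤m′))
    where
    N : ℕ
    N = proj₁ (null n)

    tail : ∀ j → [ n ] ≤v partialSum f (j ℕ.+ N) - partialSum f N
    tail zero    = ≤v-cong (K.sym (-‿inverseʳ _)) ≤v-0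
    tail (suc j) = ≤v-cong rearrange (v-+ (v-+ (proj₁ h) (proj₂ h)) (tail j))
      where
      h : [ n ] ≤v f (+ suc (j ℕ.+ N)) × [ n ] ≤v f -[1+ j ℕ.+ N ]
      h = proj₂ (null n) (suc (j ℕ.+ N)) (ℕ.m≤n⇒m≤1+n (ℕ.m≤n+m N j))
      rearrange : ∀ {x y z} → x + (y - z) ≈ (y + x) - z
      rearrange {x} {y} {z} = K.trans (K.sym (+-assoc x y (- z))) (+-congʳ (+-comm x y))

    from-N : ∀ m → N ℕ.≤ m → [ n ] ≤v partialSum f m - partialSum f N
    from-N m N≤m = ≡.subst (λ k → [ n ] ≤v partialSum f k - partialSum f N)
      (ℕ.m∸n+n≡m N≤m) (tail (m ℕ.∸ N))

  sumℤ : ∀ f → IsNull f → ∃[ l ] IsLimit (partialSum f) l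
  sumℤ f null = completeᴷ (partialSum f) (partialSum-cauchy f null)

module Series (D : CompleteDVR c ℓ) (ν : ℚ) where
  open CompleteDVR D
  open Convergence D
  open K using (Carrier; _≈_)

  -- v_ν(x u^i) = v_K(x) + ν i, as a function of v_K(x)
  wt : ℤ → ℤ ⁺ → ℚ ⁺
  wt i = map (λ n → n ℚ./ 1 ℚ.+ ν ℚ.* (i ℚ./ 1))

  infix 4 _≤w[_]_
  -- (a record, so that C, i and x can be inferred)
  record _≤w[_]_ (C : ℚ) (i : ℤ) (x : Carrier) : Set where
    constructor ⟪_⟫
    field ≤-wt : [ C ] ≤ℚ⁺ wt i (v x)

  open _≤w[_]_ public

  private
    shift : ℤ → ℚ
    shift i = ν ℚ.* (i ℚ./ 1)

    /1-+ : ∀ m n → (m ℤ.+ n) ℚ./ 1 ≡ m ℚ./ 1 ℚ.+ n ℚ./ 1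
    /1-+ m n = ℚ.toℚᵘ-injective (begin
      ℚ.toℚᵘ ((m ℤ.+ n) ℚ./ 1)              ≈⟨ ℚ.toℚᵘ-fromℚᵘ (ℚᵘ.mkℚᵘ (m ℤ.+ n) 0) ⟩
      ℚᵘ.mkℚᵘ (m ℤ.+ n) 0                   ≈⟨ ℚᵘ.*≡* (≡.cong (ℤ._* 1ℤ)
                                                (≡.cong₂ ℤ._+_ (≡.sym (ℤ.*-identityʳ m)) (≡.sym (ℤ.*-identityʳ n)))) ⟩
      ℚᵘ.mkℚᵘ m 0 ℚᵘ.+ ℚᵘ.mkℚᵘ n 0          ≈⟨ ℚᵘ.+-cong (ℚᵘ.≃-sym (ℚ.toℚᵘ-fromℚᵘ (ℚᵘ.mkℚᵘ m 0)))
                                                         (ℚᵘ.≃-sym (ℚ.toℚᵘ-fromℚᵘ (ℚᵘ.mkℚᵘ n 0))) ⟩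
      ℚ.toℚᵘ (m ℚ./ 1) ℚᵘ.+ ℚ.toℚᵘ (n ℚ./ 1) ≈⟨ ℚᵘ.≃-sym (ℚ.toℚᵘ-homo-+ (m ℚ./ 1) (n ℚ./ 1)) ⟩
      ℚ.toℚᵘ (m ℚ./ 1 ℚ.+ n ℚ./ 1)          ∎)
      where open import Relation.Binary.Reasoning.Setoid ℚᵘ.≃-setoid

    /1-mono : ∀ {m n} → m ℤ.≤ n → m ℚ./ 1 ℚ.≤ n ℚ./ 1
    /1-mono {m} {n} m≤n = ℚ.toℚᵘ-cancel-≤
      (ℚᵘ.≤-respˡ-≃ (ℚᵘ.≃-sym (ℚ.toℚᵘ-fromℚᵘ (ℚᵘ.mkℚᵘ m 0)))
      (ℚᵘ.≤-respʳ-≃ (ℚᵘ.≃-sym (ℚ.toℚᵘ-fromℚᵘ (ℚᵘ.mkℚᵘ n 0)))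
      (ℚᵘ.*≤* (ℤ.*-monoʳ-≤-nonNeg 1ℤ m≤n))))

    /1-cancel : ∀ {m n} → m ℚ./ 1 ℚ.≤ n ℚ./ 1 → m ℤ.≤ n
    /1-cancel {m} {n} p with
      ℚᵘ.≤-respˡ-≃ (ℚ.toℚᵘ-fromℚᵘ (ℚᵘ.mkℚᵘ m 0))
        (ℚᵘ.≤-respʳ-≃ (ℚ.toℚᵘ-fromℚᵘ (ℚᵘ.mkℚᵘ n 0)) (ℚ.toℚᵘ-mono-≤ p))
    ... | ℚᵘ.*≤* q = ≡.subst₂ ℤ._≤_ (ℤ.*-identityʳ m) (ℤ.*-identityʳ n) q

    archimedean : ∀ q → ∃[ n ] q ℚ.≤ n ℚ./ 1
    archimedean q@record{} = + ℤ.∣ ↥ q ∣ , ℚ.toℚᵘ-cancel-≤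
      (ℚᵘ.≤-respʳ-≃ (ℚᵘ.≃-sym (ℚ.toℚᵘ-fromℚᵘ (ℚᵘ.mkℚᵘ (+ ℤ.∣ ↥ q ∣) 0)))
        (ℚᵘ.*≤* (bound (↥ q) (ℚ.denominator-1 q))))
      where
      bound : ∀ a d → a ℤ.* 1ℤ ℤ.≤ + ℤ.∣ a ∣ ℤ.* + suc d
      bound (+ a)    d = ℤ.≤-trans (ℤ.≤-reflexive (ℤ.*-identityʳ (+ a)))
        (≡.subst ((+ a) ℤ.≤_) (ℤ.pos-* a (suc d)) (ℤ.+≤+ (ℕ.m≤m*n a (suc d))))
      bound -[1+ a ] d = ℤ.-≤+

    shift-+ : ∀ i j → shift (i ℤ.+ j) ≡ shift i ℚ.+ shift j
    shift-+ i j = ≡.trans (≡.cong (ν ℚ.*_) (/1-+ i j))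
                          (ℚ.*-distribˡ-+ ν (i ℚ./ 1) (j ℚ./ 1))

    +-middle : ∀ p q r s → (p ℚ.+ q) ℚ.+ (r ℚ.+ s) ≡ (p ℚ.+ r) ℚ.+ (q ℚ.+ s)
    +-middle p q r s = begin
      (p ℚ.+ q) ℚ.+ (r ℚ.+ s)   ≡⟨ ℚ.+-assoc p q _ ⟩
      p ℚ.+ (q ℚ.+ (r ℚ.+ s))   ≡⟨ ≡.cong (p ℚ.+_) (ℚ.+-assoc q r s) ⟨
      p ℚ.+ ((q ℚ.+ r) ℚ.+ s)   ≡⟨ ≡.cong (λ t → p ℚ.+ (t ℚ.+ s)) (ℚ.+-comm q r) ⟩
      p ℚ.+ ((r ℚ.+ q) ℚ.+ s)   ≡⟨ ≡.cong (p ℚ.+_) (ℚ.+-assoc r q s) ⟩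
      p ℚ.+ (r ℚ.+ (q ℚ.+ s))   ≡⟨ ℚ.+-assoc p r _ ⟨
      (p ℚ.+ r) ℚ.+ (q ℚ.+ s)   ∎
      where open ≡.≡-Reasoning

    +-undo : ∀ p q → (p ℚ.+ q) ℚ.+ ℚ.- q ≡ p
    +-undo p q = ≡.trans (ℚ.+-assoc p q (ℚ.- q))
      (≡.trans (≡.cong (p ℚ.+_) (ℚ.+-inverseʳ q)) (ℚ.+-identityʳ p))

    -undo : ∀ p q → (p ℚ.+ ℚ.- q) ℚ.+ q ≡ p
    -undo p q = ≡.trans (ℚ.+-assoc p (ℚ.- q) q)
      (≡.trans (≡.cong (p ℚ.+_) (ℚ.+-inverseˡ q)) (ℚ.+-identityʳ p))

    undo- : ∀ p q → p ℚ.+ (q ℚ.+ ℚ.- p) ≡ q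
    undo- p q = ≡.trans (ℚ.+-comm p _) (-undo q p)

    wt-mono : ∀ {C} i {m n} → m ≤ℤ⁺ n → [ C ] ≤ℚ⁺ wt i m → [ C ] ≤ℚ⁺ wt i n
    wt-mono i {n = ⊤⁺}    _          _          = _ Sup.≤⊤⁺
    wt-mono i {[ m ]} {[ n ]} Sup.[ m≤n ] Sup.[ C≤m ] =
      Sup.[ ℚ.≤-trans C≤m (ℚ.+-monoˡ-≤ (shift i) (/1-mono m≤n)) ]

    wt-+ : ∀ {C C′} i j {m n} → [ C ] ≤ℚ⁺ wt i m → [ C′ ] ≤ℚ⁺ wt j n →
           [ C ℚ.+ C′ ] ≤ℚ⁺ wt (i ℤ.+ j) (zipWith ℤ._+_ m n)
    wt-+ i j {⊤⁺}    {_}     _ _ = _ Sup.≤⊤⁺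
    wt-+ i j {[ _ ]} {⊤⁺}    _ _ = _ Sup.≤⊤⁺
    wt-+ i j {[ m ]} {[ n ]} Sup.[ p ] Sup.[ q ] =
      Sup.[ ≡.subst (_ ℚ.≤_)
        (≡.trans (+-middle (m ℚ./ 1) (shift i) (n ℚ./ 1) (shift j))
                 (≡.cong₂ ℚ._+_ (≡.sym (/1-+ m n)) (≡.sym (shift-+ i j))))
        (ℚ.+-mono-≤ p q) ]

  ≤w-cong : ∀ {C i x y} → x ≈ y → C ≤w[ i ] x → C ≤w[ i ] y
  ≤w-cong {C} {i} x≈y ⟪ p ⟫ = ⟪ ≡.subst (λ n → [ C ] ≤ℚ⁺ wt i n) (v-cong x≈y) p ⟫

  ≤w-weaken : ∀ {C C′ i x} → C ℚ.≤ C′ → C′ ≤w[ i ] x → C ≤w[ i ] x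
  ≤w-weaken C≤C′ ⟪ p ⟫ = ⟪ Sup.≤⁺-trans ℚ._≤_ ℚ.≤-trans Sup.[ C≤C′ ] p ⟫

  ≤w-0 : ∀ {C} i → C ≤w[ i ] K.0#
  ≤w-0 {C} i = ⟪ ≡.subst (λ n → [ C ] ≤ℚ⁺ wt i n)
    (≡.sym (Equivalence.from v-∞ K.refl)) (_ Sup.≤⊤⁺) ⟫

  ≤w-* : ∀ {C C′ i j x y} → C ≤w[ i ] x → C′ ≤w[ j ] y →
         C ℚ.+ C′ ≤w[ i ℤ.+ j ] x K.* y
  ≤w-* {C} {C′} {i} {j} {x} {y} ⟪ p ⟫ ⟪ q ⟫ =
    ⟪ ≡.subst (λ n → [ C ℚ.+ C′ ] ≤ℚ⁺ wt (i ℤ.+ j) n) (≡.sym (v-* x y))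
        (wt-+ i j {v x} {v y} p q) ⟫

  ≤w-mono : ∀ {C i x y} → v x ≤v y → C ≤w[ i ] x → C ≤w[ i ] y
  ≤w-mono {i = i} x≤y ⟪ p ⟫ = ⟪ wt-mono i x≤y p ⟫

  private
    ≤v-refl : ∀ {x} → v x ≤v x
    ≤v-refl = Sup.≤⁺-reflexive-≡ ℤ._≤_ ℤ.≤-reflexive refl

  ≤w-+ : ∀ {C i x y} → C ≤w[ i ] x → C ≤w[ i ] y → C ≤w[ i ] x K.+ y
  ≤w-+ {x = x} {y} p q with Sup.≤⁺-total ℤ._≤_ ℤ.≤-total (v x) (v y)
  ... | inj₁ x≤y = ≤w-mono (v-+ {x} {y} (≤v-refl {x}) x≤y) p
  ... | inj₂ y≤x = ≤w-mono (v-+ {x} {y} y≤x (≤v-refl {y})) q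

  ≤w-neg : ∀ {C i x} → C ≤w[ i ] x → C ≤w[ i ] K.- x
  ≤w-neg {x = x} = ≤w-mono (≤v-neg {v x} {x} (≤v-refl {x}))

  ≤w⇒≤v : ∀ {n i x} → n ℚ./ 1 ℚ.+ ν ℚ.* (i ℚ./ 1) ≤w[ i ] x → [ n ] ≤v x
  ≤w⇒≤v {n} {i} {x} ⟪ p ⟫ = cancel (v x) p
    where
    cancel : ∀ m → [ n ℚ./ 1 ℚ.+ shift i ] ≤ℚ⁺ wt i m → [ n ] ≤ℤ⁺ m
    cancel ⊤⁺    _         = _ Sup.≤⊤⁺
    cancel [ m ] Sup.[ q ] = Sup.[ /1-cancel
      (≡.subst₂ ℚ._≤_ (+-undo (n ℚ./ 1) (shift i)) (+-undo (m ℚ./ 1) (shift i))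
        (ℚ.+-monoˡ-≤ (ℚ.- shift i) q)) ]

  -- {x : v_ν(x u^i) ≥ C} contains {x : v_K(x) ≥ n} for n large.
  ≤v⇒≤w : ∀ C i → ∃[ n ] (∀ {x} → [ n ] ≤v x → C ≤w[ i ] x)
  ≤v⇒≤w C i = n , λ p → ⟪ wt-mono i p Sup.[ C≤n+νi ] ⟫
    where
    n : ℤ
    n = proj₁ (archimedean (C ℚ.- shift i))
    C≤n+νi : C ℚ.≤ n ℚ./ 1 ℚ.+ shift i
    C≤n+νi = ≡.subst (ℚ._≤ n ℚ./ 1 ℚ.+ shift i) (-undo C (shift i))
      (ℚ.+-monoˡ-≤ (shift i) (proj₂ (archimedean (C ℚ.- shift i))))

  ≤w-limit : ∀ {C i s l} → IsLimit s l → (∀ m → C ≤w[ i ] s m) → C ≤w[ i ] l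
  ≤w-limit {C} {i} {s} {l} lim h = ≤w-cong eq (≤w-+ (h N) (near (≤v-swap (close N ℕ.≤-refl))))
    where
    n : ℤ
    n = proj₁ (≤v⇒≤w C i)
    near : ∀ {x} → [ n ] ≤v x → C ≤w[ i ] x
    near = proj₂ (≤v⇒≤w C i)
    N : ℕ
    N = proj₁ (lim n)
    close : ∀ m → N ℕ.≤ m → [ n ] ≤v s m K.- l
    close = proj₂ (lim n)
    open import Relation.Binary.Reasoning.Setoid K.setoid
    eq : s N K.+ (l K.- s N) ≈ l
    eq = begin
      s N K.+ (l K.- s N)     ≈⟨ K.+-comm _ _ ⟩
      (l K.- s N) K.+ s N     ≈⟨ K.+-assoc _ _ _ ⟩
      l K.+ (K.- s N K.+ s N) ≈⟨ K.+-congˡ (K.-‿inverseˡ _) ⟩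
      l K.+ K.0#              ≈⟨ K.+-identityʳ l ⟩
      l                       ∎

  ≤w-partialSum : ∀ {C i f} → (∀ j → C ≤w[ i ] f j) → ∀ N → C ≤w[ i ] partialSum f N
  ≤w-partialSum h zero    = h 0ℤ
  ≤w-partialSum h (suc N) = ≤w-+ (≤w-partialSum h N) (≤w-+ (h (+ suc N)) (h -[1+ N ]))

  -- Formal series Σ_{i ∈ ℤ} (coeff i) u^i.
  record ℰ : Set c where
    field
      coeff   : ℤ → Carrier
      bounded : ∃[ C ] ∀ i → C ≤w[ i ] coeff i
      lim-∞   : ∀ C → ∃[ N ] ∀ i → i ℤ.≤ N → C ≤w[ i ] coeff i

  open ℰ public

  infix  4 _≈ᴱ_
  infixl 6 _+ᴱ_
  infixl 7 _*ᴱ_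
  infix  8 -ᴱ_

  _≈ᴱ_ : Rel ℰ ℓ
  f ≈ᴱ g = ∀ i → coeff f i ≈ coeff g i

  -- x · u^i
  monomial : Carrier → ℤ → ℰ
  monomial x i = record
    { coeff   = a
    ; bounded = proj₁ bound , bounded′
    ; lim-∞   = λ C → ℤ.pred i , λ j j<i → vanish (ℤ.<⇒≢ (ℤ.i≤pred[j]⇒i<j j<i))
    }
    where
    a : ℤ → Carrier
    a j with j ℤ.≟ i
    ... | yes _ = x
    ... | no  _ = K.0#

    vanish : ∀ {C j} → j ≢ i → C ≤w[ j ] a j
    vanish {j = j} j≢i with j ℤ.≟ i
    ... | yes j≡i = contradiction j≡i j≢i
    ... | no  _   = ≤w-0 j

    bound : ∃[ C ] [ C ] ≤ℚ⁺ wt i (v x)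
    bound with v x
    ... | ⊤⁺    = ℚ.0ℚ , (_ Sup.≤⊤⁺)
    ... | [ n ] = _ , Sup.[ ℚ.≤-refl ]

    bounded′ : ∀ j → proj₁ bound ≤w[ j ] a j
    bounded′ j with j ℤ.≟ i
    ... | yes refl = ⟪ proj₂ bound ⟫
    ... | no  _    = ≤w-0 j

  0ᴱ : ℰ
  0ᴱ = record
    { coeff   = λ _ → K.0#
    ; bounded = ℚ.0ℚ , ≤w-0
    ; lim-∞   = λ _ → 0ℤ , λ i _ → ≤w-0 i
    }

  1ᴱ : ℰ
  1ᴱ = monomial K.1# 0ℤ

  _+ᴱ_ : ℰ → ℰ → ℰ
  f +ᴱ g = record
    { coeff   = λ i → coeff f i K.+ coeff g i
    ; bounded = let (C , p) = bounded f ; (C′ , q) = bounded g in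
        C ℚ.⊓ C′ , λ i → ≤w-+ (≤w-weaken (ℚ.p⊓q≤p C C′) (p i)) (≤w-weaken (ℚ.p⊓q≤q C C′) (q i))
    ; lim-∞   = λ C → let (M , p) = lim-∞ f C ; (N , q) = lim-∞ g C in
        M ℤ.⊓ N , λ i i≤ → ≤w-+ (p i (ℤ.≤-trans i≤ (ℤ.i⊓j≤i M N))) (q i (ℤ.≤-trans i≤ (ℤ.i⊓j≤j M N)))
    }

  -ᴱ_ : ℰ → ℰ
  -ᴱ f = record
    { coeff   = λ i → K.- coeff f i
    ; bounded = proj₁ (bounded f) , λ i → ≤w-neg (proj₂ (bounded f) i)
    ; lim-∞   = λ C → proj₁ (lim-∞ f C) , λ i i≤ → ≤w-neg (proj₂ (lim-∞ f C) i i≤)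
    }

  module Product (f g : ℰ) where

    term : ℤ → ℤ → Carrier
    term k i = coeff f i K.* coeff g (k ℤ.- i)

    private
      split : ∀ k i → i ℤ.+ (k ℤ.- i) ≡ k
      split k i = begin
        i ℤ.+ (k ℤ.- i)         ≡⟨ ℤ.+-comm i _ ⟩
        k ℤ.+ ℤ.- i ℤ.+ i       ≡⟨ ℤ.+-assoc k (ℤ.- i) i ⟩
        k ℤ.+ (ℤ.- i ℤ.+ i)     ≡⟨ ≡.cong (λ t → k ℤ.+ t) (ℤ.+-inverseˡ i) ⟩
        k ℤ.+ 0ℤ                ≡⟨ ℤ.+-identityʳ k ⟩
        k                       ∎
        where open ≡.≡-Reasoning

      ≤w-term : ∀ {C C′ k i} → C ≤w[ i ] coeff f i → C′ ≤w[ k ℤ.- i ] coeff g (k ℤ.- i) →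
                C ℚ.+ C′ ≤w[ k ] term k i
      ≤w-term {k = k} {i} p q =
        ≡.subst (λ j → _ ≤w[ j ] term k i) (split k i) (≤w-* p q)

      Cᶠ Cᵍ : ℚ
      Cᶠ = proj₁ (bounded f)
      Cᵍ = proj₁ (bounded g)

      Nᶠ Nᵍ : ℚ → ℤ
      Nᶠ C = proj₁ (lim-∞ f (C ℚ.- Cᵍ))
      Nᵍ C = proj₁ (lim-∞ g (C ℚ.- Cᶠ))

      term-left : ∀ C k i → i ℤ.≤ Nᶠ C → C ≤w[ k ] term k i
      term-left C k i i≤ = ≡.subst (_≤w[ k ] term k i) (-undo C Cᵍ)
        (≤w-term (proj₂ (lim-∞ f _) i i≤) (proj₂ (bounded g) _))

      term-right : ∀ C k i → k ℤ.- i ℤ.≤ Nᵍ C → C ≤w[ k ] term k i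
      term-right C k i ≤N = ≡.subst (_≤w[ k ] term k i) (undo- Cᶠ C)
        (≤w-term (proj₂ (bounded f) i) (proj₂ (lim-∞ g _) _ ≤N))

    term-null : ∀ k → IsNull (term k)
    term-null k n = N , λ m N≤m →
        ≤w⇒≤v {i = k} (term-right C k (+ m) (right m (ℕ.≤-trans (ℕ.m≤n+m _ _) N≤m)))
      , ≤w⇒≤v {i = k} (term-left C k (ℤ.- + m) (left m (ℕ.≤-trans (ℕ.m≤m+n _ _) N≤m)))
      where
      C : ℚ
      C = n ℚ./ 1 ℚ.+ ν ℚ.* (k ℚ./ 1)

      N : ℕ
      N = ℤ.∣ Nᶠ C ∣ ℕ.+ ℤ.∣ k ℤ.- Nᵍ C ∣

      i≤∣i∣ : ∀ i → i ℤ.≤ + ℤ.∣ i ∣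
      i≤∣i∣ (+ _)    = ℤ.≤-refl
      i≤∣i∣ -[1+ _ ] = ℤ.-≤+

      left : ∀ m → ℤ.∣ Nᶠ C ∣ ℕ.≤ m → ℤ.- + m ℤ.≤ Nᶠ C
      left m h = ≡.subst (ℤ.- + m ℤ.≤_) (ℤ.neg-involutive (Nᶠ C))
        (ℤ.neg-mono-≤ (ℤ.≤-trans (i≤∣i∣ (ℤ.- Nᶠ C))
          (ℤ.+≤+ (≡.subst (ℕ._≤ m) (≡.sym (ℤ.∣-i∣≡∣i∣ (Nᶠ C))) h))))

      right : ∀ m → ℤ.∣ k ℤ.- Nᵍ C ∣ ℕ.≤ m → k ℤ.- + m ℤ.≤ Nᵍ C
      right m h = ≡.subst (k ℤ.- + m ℤ.≤_) eq
        (ℤ.+-monoʳ-≤ k (ℤ.neg-mono-≤ (ℤ.≤-trans (i≤∣i∣ (k ℤ.- Nᵍ C)) (ℤ.+≤+ h))))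
        where
        open ≡.≡-Reasoning
        eq : k ℤ.- (k ℤ.- Nᵍ C) ≡ Nᵍ C
        eq = begin
          k ℤ.- (k ℤ.- Nᵍ C)            ≡⟨ ≡.cong (λ t → k ℤ.+ t) (ℤ.neg-distrib-+ k (ℤ.- Nᵍ C)) ⟩
          k ℤ.+ (ℤ.- k ℤ.+ ℤ.- ℤ.- Nᵍ C) ≡⟨ ≡.cong (λ t → k ℤ.+ (ℤ.- k ℤ.+ t)) (ℤ.neg-involutive (Nᵍ C)) ⟩
          k ℤ.+ (ℤ.- k ℤ.+ Nᵍ C)        ≡⟨ ℤ.+-assoc k (ℤ.- k) (Nᵍ C) ⟨
          k ℤ.+ ℤ.- k ℤ.+ Nᵍ C          ≡⟨ ≡.cong (ℤ._+ Nᵍ C) (ℤ.+-inverseʳ k) ⟩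
          0ℤ ℤ.+ Nᵍ C                   ≡⟨ ℤ.+-identityˡ (Nᵍ C) ⟩
          Nᵍ C                          ∎

    coeff-* : ℤ → Carrier
    coeff-* k = proj₁ (sumℤ (term k) (term-null k))

    coeff-*-limit : ∀ k → IsLimit (partialSum (term k)) (coeff-* k)
    coeff-*-limit k = proj₂ (sumℤ (term k) (term-null k))

    private
      ≤w-coeff : ∀ {C k} → (∀ i → C ≤w[ k ] term k i) → C ≤w[ k ] coeff-* k
      ≤w-coeff {k = k} h = ≤w-limit (coeff-*-limit k) (≤w-partialSum h)

    bounded-* : ∃[ C ] ∀ k → C ≤w[ k ] coeff-* k
    bounded-* = Cᶠ ℚ.+ Cᵍ , λ k → ≤w-coeff
      (λ i → ≤w-term (proj₂ (bounded f) i) (proj₂ (bounded g) _))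

    lim-∞-* : ∀ C → ∃[ N ] ∀ k → k ℤ.≤ N → C ≤w[ k ] coeff-* k
    lim-∞-* C = Nᶠ C ℤ.+ Nᵍ C , λ k k≤ → ≤w-coeff (bound k k≤)
      where
      bound : ∀ k → k ℤ.≤ Nᶠ C ℤ.+ Nᵍ C → ∀ i → C ≤w[ k ] term k i
      bound k k≤ i with ℤ.≤-total i (Nᶠ C)
      ... | inj₁ i≤N = term-left C k i i≤N
      ... | inj₂ N≤i = term-right C k i (≡.subst (k ℤ.- i ℤ.≤_) eq
                         (ℤ.+-mono-≤ k≤ (ℤ.neg-mono-≤ N≤i)))
        where
        eq : Nᶠ C ℤ.+ Nᵍ C ℤ.- Nᶠ C ≡ Nᵍ C
        eq = ≡.trans (≡.cong (ℤ._- Nᶠ C) (ℤ.+-comm (Nᶠ C) (Nᵍ C)))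
          (≡.trans (ℤ.+-assoc (Nᵍ C) (Nᶠ C) (ℤ.- Nᶠ C))
            (≡.trans (≡.cong (λ t → Nᵍ C ℤ.+ t) (ℤ.+-inverseʳ (Nᶠ C))) (ℤ.+-identityʳ (Nᵍ C))))

  -- The coefficient of u^k is Σ_{i ∈ ℤ} f_i g_{k-i}, the limit in K of the
  -- symmetric partial sums (which are shown to converge).
  _*ᴱ_ : ℰ → ℰ → ℰ
  f *ᴱ g = record { coeff = coeff-* ; bounded = bounded-* ; lim-∞ = lim-∞-* }
    where open Product f g

  ℰ-rawRing : RawRing c ℓ
  ℰ-rawRing = record
    { Carrier = ℰ ; _≈_ = _≈ᴱ_ ; _+_ = _+ᴱ_ ; _*_ = _*ᴱ_ ; -_ = -ᴱ_ ; 0# = 0ᴱ ; 1# = 1ᴱ }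

  open RawSemiringDefs (RawRing.rawSemiring ℰ-rawRing) public
    using () renaming (_^_ to _^ᴱ_)

  Holomorphic : Pred ℰ ℓ
  Holomorphic f = ∀ i → i ℤ.< 0ℤ → coeff f i ≈ K.0#

  -- S_ν, S_{ν,π} and S_{ν,u} as subsets of ℰ.  For S_{ν,π} no growth condition
  -- is left to impose: elements of ℰ are bounded already.
  S : Pred ℰ ℓ
  S f = Holomorphic f × (∀ i → ℚ.0ℚ ≤w[ i ] coeff f i)

  Sπ : Pred ℰ ℓ
  Sπ = Holomorphic

  Sᵤ : Pred ℰ 0ℓ
  Sᵤ f = ∀ i → ℚ.0ℚ ≤w[ i ] coeff f i

  open RawSemiringDefs (RawRing.rawSemiring K.rawRing)
    using () renaming (_^_ to _^ᴷ_)

  π≉0 : ¬ ι π ≈ K.0#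
  π≉0 π≈0 with ≡.trans (≡.sym v-π) (Equivalence.from v-∞ π≈0)
  ... | ()

  π⁻¹ : Carrier
  π⁻¹ = proj₁ (inverse (ι π) π≉0)

  π^_ : ℤ → Carrier
  π^ (+ n)    = ι π ^ᴷ n
  π^ -[1+ n ] = π⁻¹ ^ᴷ suc n

  πᴱ : ℰ
  πᴱ = monomial (ι π) 0ℤ

  -- u^α / π^β, where ν = β / α in lowest terms
  u^α/π^β : ℰ
  u^α/π^β = monomial (π^ (ℤ.- ↥ ν)) (↧ ν)

  module Modules (d : ℕ) where

    ℰᵈ : RawLeftModule ℰ c ℓ
    ℰᵈ = record
      { Carrierᴹ = Vector ℰ d
      ; _≈ᴹ_     = λ x y → ∀ j → x j ≈ᴱ y j
      ; _+ᴹ_     = λ x y j → x j +ᴱ y j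
      ; _*ₗ_     = λ f x j → f *ᴱ x j
      ; 0ᴹ       = λ _ → 0ᴱ
      ; -ᴹ_      = λ x j → -ᴱ x j
      }

    open RawLeftModule ℰᵈ public

    Subset : Set (lsuc (c ⊔ ℓ))
    Subset = Pred Carrierᴹ (c ⊔ ℓ)

    combination : ∀ {n} → Vector ℰ n → Vector Carrierᴹ n → Carrierᴹ
    combination f x = sumOf +ᴹ-rawMonoid (λ k → f k *ₗ x k)

    -- The A-submodule of ℰᵈ generated by M.
    Span : ∀ {a} → Pred ℰ a → Subset → Pred Carrierᴹ (c ⊔ ℓ ⊔ a)
    Span A M x = ∃[ n ] Σ[ f ∈ Vector ℰ n ] Σ[ m ∈ Vector Carrierᴹ n ]
      (∀ k → f k ∈ A) × (∀ k → m k ∈ M) × x ≈ᴹ combination f m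

    infixl 6 _⊞_
    _⊞_ : Subset → Subset → Subset
    (M ⊞ N) x = Σ[ m ∈ Carrierᴹ ] Σ[ n ∈ Carrierᴹ ] m ∈ M × n ∈ N × x ≈ᴹ m +ᴹ n

    infix 9 _ᵈ
    _ᵈ : ∀ {a} → Pred ℰ a → Pred Carrierᴹ a
    (A ᵈ) x = ∀ j → x j ∈ A

    module _ {a} (A : Pred ℰ a) where

      record IsSubmodule (M : Subset) : Set (a ⊔ c ⊔ ℓ) where
        field
          resp      : ∀ {x y} → x ≈ᴹ y → x ∈ M → y ∈ M
          0-closed  : 0ᴹ ∈ M
          +-closed  : ∀ {x y} → x ∈ M → y ∈ M → x +ᴹ y ∈ M
          *ₗ-closed : ∀ {f x} → f ∈ A → x ∈ M → f *ₗ x ∈ M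

      LinearlyIndependent : {I : Set (c ⊔ ℓ)} → (I → Carrierᴹ) → Set (a ⊔ c ⊔ ℓ)
      LinearlyIndependent {I} b =
        ∀ {n} (i : Fin n → I) → Injective _≡_ _≡_ i →
        (f : Vector ℰ n) → (∀ k → f k ∈ A) →
        combination f (λ k → b (i k)) ≈ᴹ 0ᴹ → ∀ k → f k ≈ᴱ 0ᴱ

      -- No finiteness is imposed on the index set of the basis.
      IsFree : Subset → Set (a ⊔ lsuc (c ⊔ ℓ))
      IsFree M = Σ[ I ∈ Set (c ⊔ ℓ) ] Σ[ b ∈ (I → Carrierᴹ) ]
        LinearlyIndependent b × M ≐ Span A (λ x → ∃[ i ] x ≈ᴹ b i)

      Freeᵈ : Pred Subset (a ⊔ lsuc (c ⊔ ℓ))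
      Freeᵈ M = IsSubmodule M × M ⊆ A ᵈ × IsFree M

    Max : Subset → Subset
    Max M x = (S ᵈ) x × ∃[ n ] ((πᴱ ^ᴱ n) *ₗ x ∈ M) × ((u^α/π^β ^ᴱ n) *ₗ x ∈ M)

    Maxᵈ : Pred Subset (c ⊔ ℓ)
    Maxᵈ M = IsSubmodule S M × M ⊆ S ᵈ × Max M ≐ M

    infixl 6 _+max_
    _+max_ : Subset → Subset → Subset
    M +max N = Max (M ⊞ N)

    infix 9 _⟨π⟩ _⟨u⟩
    _⟨π⟩ _⟨u⟩ : Subset → Subset
    M ⟨π⟩ = Span Sπ M
    M ⟨u⟩ = Span Sᵤ M

    Ψ : Subset → Subset × Subset
    Ψ M = M ⟨π⟩ , M ⟨u⟩

    infix 4 _≐²_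
    _≐²_ : Rel (Subset × Subset) (c ⊔ ℓ)
    _≐²_ = Pointwise _≐_ _≐_

    SameℰSpan : Subset → Subset → Set (c ⊔ ℓ)
    SameℰSpan A B = Span {0ℓ} U A ≐ Span {0ℓ} U B

-- ℰ is a field: a nonzero series is its leading term (least Gauss weight, then
-- least exponent) times 1 + p + s, with p in positive degrees and s of positive
-- Gauss valuation in negative degrees, and geometric series invert 1 + p and then
-- 1 + s/(1 + p).  The same factorisation gives Weierstrass division in S_{ν,π}.
-- Hence S_{ν,π} and the valuation ring S_{ν,u} are principal, and submodules of
-- their d-th powers have finite bases, which stay independent over ℰ.  That ℰ is a
-- commutative ring at all reduces to monomials, by continuity of the product.
--
-- Let A over S_{ν,π} and B over S_{ν,u} span the same ℰ-space.  A power of π carries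
-- any x ∈ A into A ∩ B.  Cutting the coefficients of an ℰ-combination of elements of
-- A ∩ B at a very negative exponent writes x ∈ B as y + z, with (u^α/π^β)^n y ∈ A and
-- z in the S_{ν,u}-span of A ∩ B.  So A ∩ B generates both A and B.
--
-- Conversely let M be maximal.  Writing a basis of M_u in terms of one of M_π gives a
-- single N with π^N (M_π ∩ M_u) ⊆ M, and the same cutting, modulo π^N, then shows
-- M_π ∩ M_u ⊆ Max M = M.  For intersections it remains to see that M_π ∩ M′_π and
-- M_u ∩ M′_u span the same ℰ-space, which holds because kernels of linear forms
-- commute with the extension of scalars from S_{ν,π} to ℰ.

module Submission where

open import Algebra.Bundles using (AbelianGroup; CommutativeRing; RawRing; RawSemiring)
import Algebra.Definitions.RawSemiring as RawSemiringDefinitions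
import Algebra.Properties.CommutativeSemigroup as CommutativeSemigroupProperties
import Algebra.Properties.Group as GroupProperties
import Algebra.Properties.Ring as RingProperties
open import Axiom.ExcludedMiddle using (ExcludedMiddle)
open import Data.Fin.Base using (Fin; zero; suc)
open import Data.Integer.Base as ℤ using (ℤ; +_; -[1+_]; 0ℤ; 1ℤ)
import Data.Integer.Properties as ℤ
open import Data.Integer.Tactic.RingSolver using (solve-∀)
open import Data.Maybe.Base using (zipWith)
open import Data.Nat.Base as ℕ using (ℕ; zero; suc; NonZero)
import Data.Nat.Induction as ℕ
import Data.Nat.Properties as ℕ
open import Data.Product.Base using (∃-syntax; Σ-syntax; _×_; _,_; proj₁; proj₂)
open import Data.Rational.Base as ℚ using (ℚ; ↥_; ↧_; ↧ₙ_)
import Data.Rational.Properties as ℚ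
import Data.Rational.Unnormalised.Base as ℚᵘ
import Data.Rational.Unnormalised.Properties as ℚᵘ
open import Data.Sum.Base as Sum using (_⊎_; inj₁; inj₂)
open import Function.Base using (_∘_)
open import Function.Bundles using (_⇔_; mk⇔; Equivalence)
open import Induction.WellFounded using (Acc; acc)
open import Level using (Level; _⊔_)
import Relation.Binary.Construct.Add.Supremum.NonStrict as Sup
open import Relation.Binary.Definitions using (tri<; tri≈; tri>)
open import Relation.Binary.PropositionalEquality as ≡ using (_≡_; _≢_; refl)
open import Relation.Nullary using (¬_; Dec; yes; no; contradiction)
open import Relation.Nullary.Construct.Add.Supremum using (_⁺; ⊤⁺; [_])
open import Relation.Unary using (Pred; _∈_; _⊆_; _≐_; _∩_; U; _⟨×⟩_)
open import Defs

-- Two obstacles shape the proof. The Gauss valuation alone does not control convergence: a series p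
-- in positive degrees may have Gauss valuation 0, and still its geometric series has to be summed.
-- Convergence to 0 is therefore taken coefficientwise, under uniform versions of the two conditions
-- that define ℰ (`Null`); this covers series that shrink u-adically as well as those that shrink
-- π-adically. The second obstacle is in `saturate`. There x becomes y + π^N z, and π^N must clear
-- the denominators of ω^m z over M. Since m and z depend on N, an exponent chosen element by
-- element would be circular; N has to serve all of M_π ∩ M_u at once. It comes from bases whose
-- coordinates are linear forms on all of ℰ^d. The gluing itself is carried out for two subrings P
-- and Q of a field. Its analytic input is only that every f has some π^n f in Q, and is some g + h
-- with ω^n g in P and h in Q. Excluded middle decides whether series and linear forms vanish, and
-- provides minima of weights and exponents.

module RingIdentities {c ℓ} (E : CommutativeRing c ℓ) where
  open CommutativeRing E
  open RingProperties ring using (-‿+-comm)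
  open CommutativeSemigroupProperties +-commutativeSemigroup public using (interchange)
  open CommutativeSemigroupProperties *-commutativeSemigroup public
    using () renaming (interchange to *-interchange; x∙yz≈y∙xz to x*yz≈y*xz)

  difference-+ : ∀ s x t y → (s - x) + (t - y) ≈ (s + t) - (x + y)
  difference-+ s x t y = trans (interchange s (- x) t (- y)) (+-congˡ (-‿+-comm x y))

  regroup : ∀ x y a a′ b b′ →
    (x + y) + ((a + a′) + (b + b′)) ≈ (x + (a + b)) + (y + (a′ + b′))
  regroup x y a a′ b b′ = trans (+-congˡ (interchange a a′ b b′)) (interchange x y _ _)

  [x-y]+y≈x : ∀ x y → (x - y) + y ≈ x
  [x-y]+y≈x x y = trans (+-assoc x (- y) y) (trans (+-congˡ (-‿inverseˡ y)) (+-identityʳ x))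

  x≈y+[x-y] : ∀ x y → x ≈ y + (x - y)
  x≈y+[x-y] x y = sym (trans (+-comm y _) ([x-y]+y≈x x y))

-- Limits and symmetric sums in K.

module Limits {c ℓ} (D : CompleteDVR c ℓ) where
  open CompleteDVR D
  open Convergence D
  open K hiding (zero; refl)
  open RingIdentities K
  open Sup ℤ._≤_ using () renaming (_≤⁺_ to _≤ℤ⁺_)
  open import Relation.Binary.Reasoning.Setoid setoid

  ≤v-all⇒≈0 : ∀ {x} → (∀ n → [ n ] ≤v x) → x ≈ 0#
  ≤v-all⇒≈0 {x} h = Equivalence.to v-∞ (top (v x) h)
    where
    top : ∀ m → (∀ n → [ n ] ≤ℤ⁺ m) → m ≡ ⊤⁺
    top ⊤⁺    _ = refl
    top [ m ] h with h (ℤ.suc m)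
    ... | Sup.[ 1+m≤m ] = contradiction (ℤ.suc[i]≤j⇒i<j 1+m≤m) (ℤ.<-irrefl refl)

  x-y≈0⇒x≈y : ∀ {x y} → x - y ≈ 0# → x ≈ y
  x-y≈0⇒x≈y {x} {y} = GroupProperties.x∙y⁻¹≈ε⇒x≈y +-group x y

  IsLimit-unique : ∀ {s x y} → IsLimit s x → IsLimit s y → x ≈ y
  IsLimit-unique p q = x-y≈0⇒x≈y (≤v-all⇒≈0 λ n →
    let (M , p′) = p n ; (N , q′) = q n in
    ≤v-tele (≤v-swap (p′ (M ℕ.⊔ N) (ℕ.m≤m⊔n M N))) (q′ (M ℕ.⊔ N) (ℕ.m≤n⊔m M N)))

  IsLimit-cong : ∀ {s t x} → (∀ m → s m ≈ t m) → IsLimit s x → IsLimit t x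
  IsLimit-cong s≈t p n = let (N , p′) = p n in
    N , λ m N≤m → ≤v-cong (+-congʳ (s≈t m)) (p′ m N≤m)

  IsLimit-+ : ∀ {s t x y} → IsLimit s x → IsLimit t y → IsLimit (λ m → s m + t m) (x + y)
  IsLimit-+ {s} {t} {x} {y} p q n = let (M , p′) = p n ; (N , q′) = q n in
    M ℕ.⊔ N , λ m ≤m → ≤v-cong (difference-+ (s m) x (t m) y)
      (v-+ (p′ m (ℕ.≤-trans (ℕ.m≤m⊔n M N) ≤m)) (q′ m (ℕ.≤-trans (ℕ.m≤n⊔m M N) ≤m)))

  IsLimit-eventually : ∀ {s x} N → (∀ m → N ℕ.≤ m → s m ≈ x) → IsLimit s x
  IsLimit-eventually {x = x} N h n = N , λ m N≤m →
    ≤v-cong (K.trans (K.sym (-‿inverseʳ x)) (+-congʳ (K.sym (h m N≤m)))) ≤v-0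

  partialSum-cong : ∀ {f g} → (∀ i → f i ≈ g i) → ∀ N → partialSum f N ≈ partialSum g N
  partialSum-cong f≈g zero    = f≈g 0ℤ
  partialSum-cong f≈g (suc N) = +-cong (partialSum-cong f≈g N) (+-cong (f≈g _) (f≈g _))

  partialSum-+ : ∀ f g N → partialSum (λ i → f i + g i) N ≈ partialSum f N + partialSum g N
  partialSum-+ f g zero    = K.refl
  partialSum-+ f g (suc N) = begin
    partialSum (λ i → f i + g i) N + ((a + a′) + (b + b′))     ≈⟨ +-congʳ (partialSum-+ f g N) ⟩
    (partialSum f N + partialSum g N) + ((a + a′) + (b + b′))  ≈⟨ regroup _ _ a a′ b b′ ⟩
    (partialSum f N + (a + b)) + (partialSum g N + (a′ + b′))  ∎
    where
    a = f (+ suc N)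
    a′ = g (+ suc N)
    b = f -[1+ N ]
    b′ = g -[1+ N ]

  partialSum-zero : ∀ {f} N → (∀ j → ℤ.∣ j ∣ ℕ.≤ N → f j ≈ 0#) → partialSum f N ≈ 0#
  partialSum-zero zero    h = h 0ℤ ℕ.z≤n
  partialSum-zero (suc N) h = K.trans
    (+-cong (partialSum-zero N λ j ≤N → h j (ℕ.m≤n⇒m≤1+n ≤N))
            (+-cong (h (+ suc N) ℕ.≤-refl) (h -[1+ N ] ℕ.≤-refl)))
    (K.trans (+-congˡ (+-identityʳ 0#)) (+-identityʳ 0#))

  partialSum-single : ∀ {f} i → (∀ j → j ≢ i → f j ≈ 0#) →
                      ∀ N → ℤ.∣ i ∣ ℕ.≤ N → partialSum f N ≈ f i
  partialSum-single (+ zero) h zero _ = K.refl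
  partialSum-single {f} i h (suc N) ∣i∣≤1+N with ℕ.m≤n⇒m<n∨m≡n ∣i∣≤1+N
  ... | inj₁ (ℕ.s≤s ∣i∣≤N) = begin
    partialSum f N + (f (+ suc N) + f -[1+ N ]) ≈⟨ +-cong (partialSum-single i h N ∣i∣≤N)
                                                     (+-cong (h _ (big refl)) (h _ (big refl))) ⟩
    f i + (0# + 0#)                             ≈⟨ drop (f i) ⟩
    f i                                         ∎
    where
    drop : ∀ x → x + (0# + 0#) ≈ x
    drop x = K.trans (+-congˡ (+-identityʳ 0#)) (+-identityʳ x)
    big : ∀ {j} → ℤ.∣ j ∣ ≡ suc N → j ≢ i
    big ∣j∣≡1+N refl = ℕ.<-irrefl ∣j∣≡1+N (ℕ.s≤s ∣i∣≤N)
  partialSum-single {f} (+ suc N) h (suc N) _ | inj₂ refl = begin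
    partialSum f N + (f (+ suc N) + f -[1+ N ]) ≈⟨ +-cong (partialSum-zero N λ j ∣j∣≤N →
                                                     h j λ { refl → ℕ.<-irrefl refl ∣j∣≤N })
                                                     (+-congˡ (h _ λ ())) ⟩
    0# + (f (+ suc N) + 0#)                     ≈⟨ drop (f (+ suc N)) ⟩
    f (+ suc N)                                 ∎
    where
    drop : ∀ x → 0# + (x + 0#) ≈ x
    drop x = K.trans (+-identityˡ _) (+-identityʳ x)
  partialSum-single {f} -[1+ N ] h (suc N) _ | inj₂ refl = begin
    partialSum f N + (f (+ suc N) + f -[1+ N ]) ≈⟨ +-cong (partialSum-zero N λ j ∣j∣≤N →
                                                     h j λ { refl → ℕ.<-irrefl refl ∣j∣≤N })
                                                     (+-congʳ (h _ λ ())) ⟩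
    0# + (0# + f -[1+ N ])                      ≈⟨ drop (f -[1+ N ]) ⟩
    f -[1+ N ]                                  ∎
    where
    drop : ∀ x → 0# + (0# + x) ≈ x
    drop x = K.trans (+-identityˡ _) (+-identityˡ x)

i+[k-i]≡k : ∀ i k → i ℤ.+ (k ℤ.- i) ≡ k
i+[k-i]≡k = solve-∀

k-[i+j]≡k-i-j : ∀ k i j → k ℤ.- (i ℤ.+ j) ≡ k ℤ.- i ℤ.- j
k-[i+j]≡k-i-j = solve-∀

k-[k-i]≡i : ∀ k i → k ℤ.- (k ℤ.- i) ≡ i
k-[k-i]≡i = solve-∀

i+j-i≡j : ∀ i j → i ℤ.+ j ℤ.- i ≡ j
i+j-i≡j = solve-∀

p+[q-p]≡q : ∀ p q → p ℚ.+ (q ℚ.- p) ≡ q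
p+[q-p]≡q p q = ≡.trans (ℚ.+-comm p (q ℚ.- p)) (≡.trans (ℚ.+-assoc q (ℚ.- p) p)
  (≡.trans (≡.cong (λ t → q ℚ.+ t) (ℚ.+-inverseˡ p)) (ℚ.+-identityʳ q)))

[q-p]+p≡q : ∀ p q → (q ℚ.- p) ℚ.+ p ≡ q
[q-p]+p≡q p q = ≡.trans (ℚ.+-comm (q ℚ.- p) p) (p+[q-p]≡q p q)

∣i∣-bound : ∀ {a b i} → a ℤ.≤ i → i ℤ.≤ b → ℤ.∣ i ∣ ℕ.≤ ℤ.∣ a ∣ ℕ.⊔ ℤ.∣ b ∣
∣i∣-bound {a} {i = + _}    _             (ℤ.+≤+ i≤b) = ℕ.≤-trans i≤b (ℕ.m≤n⊔m ℤ.∣ a ∣ _)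
∣i∣-bound {b = b} { -[1+ _ ]} (ℤ.-≤- i≤a) _           = ℕ.≤-trans (ℕ.s≤s i≤a) (ℕ.m≤m⊔n _ ℤ.∣ b ∣)

-- Only finitely many indices satisfy |i| ≤ m, so the maximum of their thresholds serves them all.
eventually-uniform : {P : ℤ → ℕ → Set} → (∀ i → ∃[ K ] ∀ k → K ℕ.≤ k → P i k) →
  ∀ m → ∃[ K ] ∀ k → K ℕ.≤ k → ∀ i → ℤ.∣ i ∣ ℕ.≤ m → P i k
eventually-uniform h zero = proj₁ (h 0ℤ) , λ { k K≤k (+ zero) _ → proj₂ (h 0ℤ) k K≤k }
eventually-uniform {P} h (suc m) =
  let (K , p) = eventually-uniform {P} h m ; (K₊ , p₊) = h (+ suc m) ; (K₋ , p₋) = h -[1+ m ] in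
  K ℕ.⊔ (K₊ ℕ.⊔ K₋) , λ k ≤k i ∣i∣≤ → step p p₊ p₋ k
    (ℕ.≤-trans (ℕ.m≤m⊔n K _) ≤k)
    (ℕ.≤-trans (ℕ.≤-trans (ℕ.m≤m⊔n K₊ K₋) (ℕ.m≤n⊔m K _)) ≤k)
    (ℕ.≤-trans (ℕ.≤-trans (ℕ.m≤n⊔m K₊ K₋) (ℕ.m≤n⊔m K _)) ≤k) i ∣i∣≤
  where
  step : ∀ {K K₊ K₋} → (∀ k → K ℕ.≤ k → ∀ i → ℤ.∣ i ∣ ℕ.≤ m → P i k) →
         (∀ k → K₊ ℕ.≤ k → P (+ suc m) k) → (∀ k → K₋ ℕ.≤ k → P -[1+ m ] k) →
         ∀ k → K ℕ.≤ k → K₊ ℕ.≤ k → K₋ ℕ.≤ k → ∀ i → ℤ.∣ i ∣ ℕ.≤ suc m → P i k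
  step p p₊ p₋ k K≤k K₊≤k K₋≤k i ∣i∣≤1+m with ℕ.m≤n⇒m<n∨m≡n ∣i∣≤1+m
  ... | inj₁ (ℕ.s≤s ∣i∣≤m) = p k K≤k i ∣i∣≤m
  step p p₊ p₋ k K≤k K₊≤k K₋≤k (+ _)    _ | inj₂ refl = p₊ k K₊≤k
  step p p₊ p₋ k K≤k K₊≤k K₋≤k -[1+ _ ] _ | inj₂ refl = p₋ k K₋≤k

-- The commutative ring structure of ℰ.

module LaurentSeries {c ℓ} (D : CompleteDVR c ℓ) (ν : ℚ) where
  open CompleteDVR D
  open Convergence D
  open Limits D
  open Series D ν
  open K using (Carrier; _≈_; 0#; 1#)
  open RingIdentities K
  open import Relation.Binary.Reasoning.Setoid K.setoid

  infixl 7 _·_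

  term : ℰ → ℰ → ℤ → ℤ → Carrier
  term f g k i = coeff f i K.* coeff g (k ℤ.- i)

  -- Unfolding the limit that defines _*ᴱ_ makes conversion checking blow up.
  opaque
    _·_ : ℰ → ℰ → ℰ
    _·_ = _*ᴱ_

    ·-limit : ∀ f g k → IsLimit (partialSum (term f g k)) (coeff (f · g) k)
    ·-limit f g k = Product.coeff-*-limit f g k

    ·≈*ᴱ : ∀ f g → f · g ≈ᴱ Series._*ᴱ_ D ν f g
    ·≈*ᴱ f g i = K.refl

  ≤w-all⇒≈0 : ∀ {x} i → (∀ C → C ≤w[ i ] x) → x ≈ 0#
  ≤w-all⇒≈0 i h = ≤v-all⇒≈0 λ n → ≤w⇒≤v {n} {i} (h _)

  ≤w-difference : ∀ {C i x y} → C ≤w[ i ] x → C ≤w[ i ] y → C ≤w[ i ] x K.- y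
  ≤w-difference p q = ≤w-+ p (≤w-neg q)

  ≤w-*-at : ∀ {C C′ i k x y} → C ≤w[ i ] x → C′ ≤w[ k ℤ.- i ] y → C ℚ.+ C′ ≤w[ k ] x K.* y
  ≤w-*-at {C} {C′} {i} {k} {x} {y} p q = ≡.subst (λ j → C ℚ.+ C′ ≤w[ j ] x K.* y) (i+[k-i]≡k i k) (≤w-* p q)

  ≤w-coeff-· : ∀ {C k} f g → (∀ i → C ≤w[ k ] coeff f i K.* coeff g (k ℤ.- i)) →
               C ≤w[ k ] coeff (f · g) k
  ≤w-coeff-· {k = k} f g h = ≤w-limit (·-limit f g k) (≤w-partialSum h)

  -- The conditions `bounded` and `lim-∞` of ℰ, with constants that do not depend on the member of
  -- the family.
  record Tame (h : ℕ → ℰ) : Set where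
    field
      lower : ∃[ C ] ∀ k i → C ≤w[ i ] coeff (h k) i
      left  : ∀ C → ∃[ N ] ∀ k i → i ℤ.≤ N → C ≤w[ i ] coeff (h k) i

  -- Coefficientwise convergence to 0, dominated as in the definition of ℰ.
  record Null (h : ℕ → ℰ) : Set where
    field
      tame   : Tame h
      vanish : ∀ i C → ∃[ K ] ∀ k → K ℕ.≤ k → C ≤w[ i ] coeff (h k) i
    open Tame tame public

  tame-const : ∀ f → Tame (λ _ → f)
  tame-const f = record
    { lower = let (C , p) = bounded f in C , λ _ → p
    ; left  = λ C → let (N , p) = lim-∞ f C in N , λ _ → p }

  -- Tameness makes the terms with i ≤ `Nᶠ C` or k - i ≤ `Nᵍ C` small for all n at once. Finitely
  -- many i remain, so smallness of each single term for large n suffices.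
  null-· : ∀ {f g} → Tame f → Tame g →
    (∀ k i C → ∃[ K ] ∀ n → K ℕ.≤ n → C ≤w[ k ] coeff (f n) i K.* coeff (g n) (k ℤ.- i)) →
    Null (λ n → f n · g n)
  null-· {f} {g} tf tg h = record
    { tame = record
      { lower = Cᶠ ℚ.+ Cᵍ , λ n k → ≤w-coeff-· (f n) (g n) λ i →
          ≤w-*-at {Cᶠ} {Cᵍ} (proj₂ (Tame.lower tf) n i) (proj₂ (Tame.lower tg) n (k ℤ.- i))
      ; left = λ C → Nᶠ C ℤ.+ Nᵍ C , λ n k k≤ → ≤w-coeff-· (f n) (g n) (outside C n k k≤) }
    ; vanish = vanish }
    where
    Cᶠ Cᵍ : ℚ
    Cᶠ = proj₁ (Tame.lower tf)
    Cᵍ = proj₁ (Tame.lower tg)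

    Nᶠ Nᵍ : ℚ → ℤ
    Nᶠ C = proj₁ (Tame.left tf (C ℚ.- Cᵍ))
    Nᵍ C = proj₁ (Tame.left tg (C ℚ.- Cᶠ))

    small : ℚ → ℕ → ℤ → ℤ → Set
    small C n k i = C ≤w[ k ] coeff (f n) i K.* coeff (g n) (k ℤ.- i)

    smallˡ : ∀ C n k i → i ℤ.≤ Nᶠ C → small C n k i
    smallˡ C n k i i≤ = ≡.subst (λ C → small C n k i)
      ([q-p]+p≡q Cᵍ C)
      (≤w-*-at {C ℚ.- Cᵍ} {Cᵍ} (proj₂ (Tame.left tf (C ℚ.- Cᵍ)) n i i≤) (proj₂ (Tame.lower tg) n (k ℤ.- i)))

    smallʳ : ∀ C n k i → k ℤ.- i ℤ.≤ Nᵍ C → small C n k i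
    smallʳ C n k i ≤N = ≡.subst (λ C → small C n k i) (p+[q-p]≡q Cᶠ C)
      (≤w-*-at {Cᶠ} {C ℚ.- Cᶠ} (proj₂ (Tame.lower tf) n i) (proj₂ (Tame.left tg (C ℚ.- Cᶠ)) n (k ℤ.- i) ≤N))

    outside : ∀ C n k → k ℤ.≤ Nᶠ C ℤ.+ Nᵍ C → ∀ i → small C n k i
    outside C n k k≤ i = pick (ℤ.≤-total i (Nᶠ C))
      where
      pick : i ℤ.≤ Nᶠ C ⊎ Nᶠ C ℤ.≤ i → small C n k i
      pick (inj₁ i≤N) = smallˡ C n k i i≤N
      pick (inj₂ N≤i) = smallʳ C n k i (≡.subst (k ℤ.- i ℤ.≤_) (i+j-i≡j (Nᶠ C) (Nᵍ C))
        (ℤ.+-mono-≤ k≤ (ℤ.neg-mono-≤ N≤i)))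

    vanish : ∀ k C → ∃[ K ] ∀ n → K ℕ.≤ n → C ≤w[ k ] coeff (f n · g n) k
    vanish k C = proj₁ inner , λ n K≤n → ≤w-coeff-· (f n) (g n) (bound n K≤n)
      where
      inner : ∃[ K ] ∀ n → K ℕ.≤ n → ∀ i → ℤ.∣ i ∣ ℕ.≤ ℤ.∣ Nᶠ C ∣ ℕ.⊔ ℤ.∣ k ℤ.- Nᵍ C ∣ →
              small C n k i
      inner = eventually-uniform {λ i n → small C n k i} (λ i → h k i C)
                (ℤ.∣ Nᶠ C ∣ ℕ.⊔ ℤ.∣ k ℤ.- Nᵍ C ∣)
      flip : ∀ {i} → Nᵍ C ℤ.≤ k ℤ.- i → i ℤ.≤ k ℤ.- Nᵍ C
      flip {i} q = ≡.subst (ℤ._≤ k ℤ.- Nᵍ C)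
        (k-[k-i]≡i k i)
        (ℤ.+-monoʳ-≤ k (ℤ.neg-mono-≤ q))
      bound : ∀ n → proj₁ inner ℕ.≤ n → ∀ i → small C n k i
      bound n K≤n i = pick (ℤ.≤-total i (Nᶠ C)) (ℤ.≤-total (k ℤ.- i) (Nᵍ C))
        where
        pick : i ℤ.≤ Nᶠ C ⊎ Nᶠ C ℤ.≤ i → k ℤ.- i ℤ.≤ Nᵍ C ⊎ Nᵍ C ℤ.≤ k ℤ.- i → small C n k i
        pick (inj₁ i≤N) _         = smallˡ C n k i i≤N
        pick (inj₂ _)   (inj₁ ≤N) = smallʳ C n k i ≤N
        pick (inj₂ N≤i) (inj₂ N≤) = proj₂ inner n K≤n i (∣i∣-bound N≤i (flip N≤))

  null-·ˡ : ∀ f {h} → Null h → Null (λ n → f · h n)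
  null-·ˡ f {h} null = null-· {λ _ → f} {h} (tame-const f) (Null.tame null) λ k i C →
    let (Cᶠ , p) = bounded f ; (K , q) = Null.vanish null (k ℤ.- i) (C ℚ.- Cᶠ) in
    K , λ n K≤n → ≡.subst (_≤w[ k ] _) (p+[q-p]≡q Cᶠ C) (≤w-*-at {Cᶠ} {C ℚ.- Cᶠ} (p i) (q n K≤n))

  null-·ʳ : ∀ f {h} → Null h → Null (λ n → h n · f)
  null-·ʳ f {h} null = null-· {h} {λ _ → f} (Null.tame null) (tame-const f) λ k i C →
    let (Cᶠ , p) = bounded f ; (K , q) = Null.vanish null i (C ℚ.- Cᶠ) in
    K , λ n K≤n → ≡.subst (_≤w[ k ] _) ([q-p]+p≡q Cᶠ C)
      (≤w-*-at {C ℚ.- Cᶠ} {Cᶠ} (q n K≤n) (p (k ℤ.- i)))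

  -- Additivity reduces sequential continuity to sequences that tend to 0.
  record IsContinuous (T : ℰ → ℰ) : Set (c ⊔ ℓ) where
    field
      T-cong : ∀ {f g} → f ≈ᴱ g → T f ≈ᴱ T g
      T-+    : ∀ f g → T (f +ᴱ g) ≈ᴱ T f +ᴱ T g
      T-null : ∀ {h} → Null h → Null (T ∘ h)

  ·-cong : ∀ {f f′ g g′} → f ≈ᴱ f′ → g ≈ᴱ g′ → f · g ≈ᴱ f′ · g′
  ·-cong {f} {f′} {g} {g′} f≈ g≈ k = IsLimit-unique
    (IsLimit-cong (partialSum-cong λ i → K.*-cong (f≈ i) (g≈ _)) (·-limit f g k))
    (·-limit f′ g′ k)

  coeff-·-unique : ∀ f g k x → IsLimit (partialSum (term f g k)) x →
                   coeff (f · g) k ≈ x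
  coeff-·-unique f g k x = IsLimit-unique {partialSum (term f g k)} {coeff (f · g) k} {x}
    (·-limit f g k)

  ·-distribˡ : ∀ f g h → f · (g +ᴱ h) ≈ᴱ f · g +ᴱ f · h
  ·-distribˡ f g h k = coeff-·-unique f (g +ᴱ h) k (coeff (f · g) k K.+ coeff (f · h) k)
    (IsLimit-cong {λ N → partialSum s N K.+ partialSum t N} {partialSum (term f (g +ᴱ h) k)}
      {coeff (f · g) k K.+ coeff (f · h) k}
    (λ N → K.sym (K.trans (partialSum-cong {term f (g +ᴱ h) k} {λ i → s i K.+ t i} (λ i → K.distribˡ _ _ _) N)
                          (partialSum-+ s t N)))
    (IsLimit-+ {partialSum s} {partialSum t} {coeff (f · g) k} {coeff (f · h) k}
      (·-limit f g k) (·-limit f h k)))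
    where
    s t : ℤ → Carrier
    s = term f g k
    t = term f h k

  ·-distribʳ : ∀ f g h → (g +ᴱ h) · f ≈ᴱ g · f +ᴱ h · f
  ·-distribʳ f g h k = coeff-·-unique (g +ᴱ h) f k (coeff (g · f) k K.+ coeff (h · f) k)
    (IsLimit-cong
    (λ N → K.sym (K.trans (partialSum-cong {term (g +ᴱ h) f k} {λ i → s i K.+ t i} (λ i → K.distribʳ _ _ _) N)
                          (partialSum-+ s t N)))
    (IsLimit-+ {partialSum s} {partialSum t} (·-limit g f k) (·-limit h f k)))
    where
    s t : ℤ → Carrier
    s = term g f k
    t = term h f k

  ·-continuousˡ : ∀ f → IsContinuous (f ·_)
  ·-continuousˡ f = record
    { T-cong = λ {g} {h} → ·-cong {f} {f} {g} {h} (λ _ → K.refl)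
    ; T-+    = ·-distribˡ f
    ; T-null = null-·ˡ f }

  ·-continuousʳ : ∀ f → IsContinuous (_· f)
  ·-continuousʳ f = record
    { T-cong = λ {g} {h} g≈h → ·-cong {g} {h} {f} {f} g≈h (λ _ → K.refl)
    ; T-+    = ·-distribʳ f
    ; T-null = null-·ʳ f }

  ∘-continuous : ∀ {T T′} → IsContinuous T → IsContinuous T′ → IsContinuous (T ∘ T′)
  ∘-continuous {T} {T′} t t′ = record
    { T-cong = λ {f} {g} f≈g → T.T-cong {T′ f} {T′ g} (T′.T-cong {f} {g} f≈g)
    ; T-+    = λ f g i → K.trans (T.T-cong {T′ (f +ᴱ g)} {T′ f +ᴱ T′ g} (T′.T-+ f g) i) (T.T-+ (T′ f) (T′ g) i)
    ; T-null = λ null → T.T-null (T′.T-null null) }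
    where
    module T = IsContinuous t
    module T′ = IsContinuous t′

  coeff-monomial-≡ : ∀ x i → coeff (monomial x i) i ≈ x
  coeff-monomial-≡ x i with i ℤ.≟ i
  ... | yes _  = K.refl
  ... | no i≢i = contradiction refl i≢i

  coeff-monomial-≢ : ∀ x i {j} → j ≢ i → coeff (monomial x i) j ≈ 0#
  coeff-monomial-≢ x i {j} j≢i with j ℤ.≟ i
  ... | yes j≡i = contradiction j≡i j≢i
  ... | no _    = K.refl

  -- Only the term of index i survives, so the symmetric partial sums are constant from |i| on.
  coeff-monomial-· : ∀ x i g k → coeff (monomial x i · g) k ≈ x K.* coeff g (k ℤ.- i)
  coeff-monomial-· x i g k = coeff-·-unique (monomial x i) g k _
    (IsLimit-eventually {partialSum t} {x K.* coeff g (k ℤ.- i)} ℤ.∣ i ∣ λ N ∣i∣≤N →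
      K.trans (partialSum-single {t} i off N ∣i∣≤N) (K.*-congʳ (coeff-monomial-≡ x i)))
    where
    t = term (monomial x i) g k
    off : ∀ j → j ≢ i → t j ≈ 0#
    off j j≢i = K.trans (K.*-congʳ (coeff-monomial-≢ x i j≢i)) (K.zeroˡ _)

  polynomial : ℰ → ℕ → ℰ
  polynomial f zero    = monomial (coeff f 0ℤ) 0ℤ
  polynomial f (suc N) = polynomial f N +ᴱ
    (monomial (coeff f (+ suc N)) (+ suc N) +ᴱ monomial (coeff f -[1+ N ]) -[1+ N ])

  coeff-polynomial-outside : ∀ f N i → N ℕ.< ℤ.∣ i ∣ → coeff (polynomial f N) i ≈ 0#
  coeff-polynomial-outside f zero    i 0<∣i∣ =
    coeff-monomial-≢ _ 0ℤ {i} λ { refl → ℕ.<-irrefl refl 0<∣i∣ }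
  coeff-polynomial-outside f (suc N) i N<∣i∣ = K.trans
    (K.+-cong (coeff-polynomial-outside f N i (ℕ.≤-trans (ℕ.n≤1+n _) N<∣i∣))
      (K.+-cong (coeff-monomial-≢ _ (+ suc N) {i} λ { refl → ℕ.<-irrefl refl N<∣i∣ })
                (coeff-monomial-≢ _ -[1+ N ] {i} λ { refl → ℕ.<-irrefl refl N<∣i∣ })))
    (K.trans (K.+-congˡ (K.+-identityʳ 0#)) (K.+-identityʳ 0#))

  coeff-polynomial-inside : ∀ f N i → ℤ.∣ i ∣ ℕ.≤ N → coeff (polynomial f N) i ≈ coeff f i
  coeff-polynomial-inside f zero    (+ zero) _ = coeff-monomial-≡ _ 0ℤ
  coeff-polynomial-inside f (suc N) i ∣i∣≤1+N with ℕ.m≤n⇒m<n∨m≡n ∣i∣≤1+N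
  ... | inj₁ (ℕ.s≤s ∣i∣≤N) = K.trans
    (K.+-cong (coeff-polynomial-inside f N i ∣i∣≤N)
      (K.+-cong (coeff-monomial-≢ _ (+ suc N) {i} λ { refl → ℕ.<-irrefl refl ∣i∣≤N })
                (coeff-monomial-≢ _ -[1+ N ] {i} λ { refl → ℕ.<-irrefl refl ∣i∣≤N })))
    (K.trans (K.+-congˡ (K.+-identityʳ 0#)) (K.+-identityʳ _))
  coeff-polynomial-inside f (suc N) (+ suc N) _ | inj₂ refl = K.trans
    (K.+-cong (coeff-polynomial-outside f N (+ suc N) ℕ.≤-refl)
      (K.+-cong (coeff-monomial-≡ _ (+ suc N)) (coeff-monomial-≢ (coeff f -[1+ N ]) -[1+ N ] {+ suc N} λ ())))
    (K.trans (K.+-identityˡ _) (K.+-identityʳ _))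
  coeff-polynomial-inside f (suc N) -[1+ N ] _ | inj₂ refl = K.trans
    (K.+-cong (coeff-polynomial-outside f N -[1+ N ] ℕ.≤-refl)
      (K.+-cong (coeff-monomial-≢ (coeff f (+ suc N)) (+ suc N) { -[1+ N ]} λ ()) (coeff-monomial-≡ _ -[1+ N ])))
    (K.trans (K.+-identityˡ _) (K.+-identityˡ _))

  remainder : ℰ → ℕ → ℰ
  remainder f N = f +ᴱ (-ᴱ polynomial f N)

  remainder-inside : ∀ f N i → ℤ.∣ i ∣ ℕ.≤ N → coeff (remainder f N) i ≈ 0#
  remainder-inside f N i ∣i∣≤N =
    K.trans (K.+-congˡ (K.-‿cong (coeff-polynomial-inside f N i ∣i∣≤N))) (K.-‿inverseʳ _)

  -- Every coefficient of a remainder is 0 or a coefficient of f, so the constants of f bound all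
  -- remainders.
  ≤w-remainder : ∀ {C i} f N → C ≤w[ i ] coeff f i → C ≤w[ i ] coeff (remainder f N) i
  ≤w-remainder {i = i} f N p with ℕ.≤-<-connex ℤ.∣ i ∣ N
  ... | inj₁ ∣i∣≤N = ≤w-cong (K.sym (remainder-inside f N i ∣i∣≤N)) (≤w-0 i)
  ... | inj₂ N<∣i∣ = ≤w-difference p (≤w-cong (K.sym (coeff-polynomial-outside f N i N<∣i∣)) (≤w-0 i))

  remainder-null : ∀ f → Null (remainder f)
  remainder-null f = record
    { tame = record
      { lower = let (C , p) = bounded f in C , λ N i → ≤w-remainder f N (p i)
      ; left  = λ C → let (M , p) = lim-∞ f C in M , λ N i i≤M → ≤w-remainder f N (p i i≤M) }
    ; vanish = λ i C → ℤ.∣ i ∣ , λ N ∣i∣≤N → ≤w-cong (K.sym (remainder-inside f N i ∣i∣≤N)) (≤w-0 i) }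

  polynomial+remainder : ∀ f N → f ≈ᴱ polynomial f N +ᴱ remainder f N
  polynomial+remainder f N i = x≈y+[x-y] (coeff f i) (coeff (polynomial f N) i)

  -- Additivity settles the Laurent polynomials that truncate f. What is left are the images of the
  -- remainders, and these form null sequences.
  continuous-ext : ∀ {T T′} → IsContinuous T → IsContinuous T′ →
    (∀ x i → T (monomial x i) ≈ᴱ T′ (monomial x i)) → ∀ f → T f ≈ᴱ T′ f
  continuous-ext {T} {T′} t t′ h f i = x-y≈0⇒x≈y (≤w-all⇒≈0 i λ C →
    let (M , p) = Null.vanish (T.T-null (remainder-null f)) i C
        (M′ , q) = Null.vanish (T′.T-null (remainder-null f)) i C
        N = M ℕ.⊔ M′
    in ≤w-cong (K.sym (difference N))
         (≤w-difference (p N (ℕ.m≤m⊔n M M′)) (q N (ℕ.m≤n⊔m M M′))))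
    where
    module T = IsContinuous t
    module T′ = IsContinuous t′
    on-polynomial : ∀ N → T (polynomial f N) ≈ᴱ T′ (polynomial f N)
    on-polynomial zero      = h _ _
    on-polynomial (suc N) k = K.trans (T.T-+ (polynomial f N) _ k) (K.trans
      (K.+-cong (on-polynomial N k) (K.trans (T.T-+ (monomial _ _) (monomial _ _) k)
        (K.trans (K.+-cong (h _ _ k) (h _ _ k)) (K.sym (T′.T-+ (monomial _ _) (monomial _ _) k)))))
      (K.sym (T′.T-+ (polynomial f N) _ k)))
    split : ∀ N → coeff (T f) i ≈ coeff (T (polynomial f N)) i K.+ coeff (T (remainder f N)) i
    split N = K.trans (T.T-cong {f} {polynomial f N +ᴱ remainder f N} (polynomial+remainder f N) i)
      (T.T-+ (polynomial f N) (remainder f N) i)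
    split′ : ∀ N → coeff (T′ f) i ≈ coeff (T′ (polynomial f N)) i K.+ coeff (T′ (remainder f N)) i
    split′ N = K.trans (T′.T-cong {f} {polynomial f N +ᴱ remainder f N} (polynomial+remainder f N) i)
      (T′.T-+ (polynomial f N) (remainder f N) i)
    difference : ∀ N → coeff (T f) i K.- coeff (T′ f) i ≈
                       coeff (T (remainder f N)) i K.- coeff (T′ (remainder f N)) i
    difference N = begin
      coeff (T f) i K.- coeff (T′ f) i ≈⟨ K.+-cong (split N) (K.-‿cong (K.trans (split′ N) (K.+-congʳ (K.sym (on-polynomial N i))))) ⟩
      (a K.+ b) K.- (a K.+ d)          ≈⟨ difference-+ a a b d ⟨
      (a K.- a) K.+ (b K.- d)          ≈⟨ K.+-congʳ (K.-‿inverseʳ a) ⟩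
      0# K.+ (b K.- d)                 ≈⟨ K.+-identityˡ _ ⟩
      b K.- d                          ∎
      where
      a = coeff (T (polynomial f N)) i
      b = coeff (T (remainder f N)) i
      d = coeff (T′ (remainder f N)) i

  monomial-·-monomial : ∀ x i y j → monomial x i · monomial y j ≈ᴱ monomial (x K.* y) (i ℤ.+ j)
  monomial-·-monomial x i y j k = K.trans (coeff-monomial-· x i (monomial y j) k) (at k)
    where
    at : ∀ k → x K.* coeff (monomial y j) (k ℤ.- i) ≈ coeff (monomial (x K.* y) (i ℤ.+ j)) k
    at k with k ℤ.≟ i ℤ.+ j
    ... | yes refl = K.*-congˡ (≡.subst (λ n → coeff (monomial y j) n ≈ y) (≡.sym (i+j-i≡j i j))
                       (coeff-monomial-≡ y j))
    ... | no k≢i+j = K.trans (K.*-congˡ (coeff-monomial-≢ y j λ k-i≡j →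
                       k≢i+j (≡.trans (≡.sym (i+[k-i]≡k i k)) (≡.cong (λ t → i ℤ.+ t) k-i≡j)))) (K.zeroʳ x)

  monomial-≡-cong : ∀ {x y i j} → x ≈ y → i ≡ j → monomial x i ≈ᴱ monomial y j
  monomial-≡-cong {i = i} x≈y refl k with k ℤ.≟ i
  ... | yes _ = x≈y
  ... | no  _ = K.refl

  -- Density of Laurent polynomials is applied once in each factor.
  ·-comm : ∀ f g → f · g ≈ᴱ g · f
  ·-comm f = continuous-ext {f ·_} {_· f} (·-continuousˡ f) (·-continuousʳ f) λ y j →
    continuous-ext {_· monomial y j} {monomial y j ·_}
      (·-continuousʳ (monomial y j)) (·-continuousˡ (monomial y j)) (λ x i k →
      K.trans (monomial-·-monomial x i y j k)
      (K.trans (monomial-≡-cong (K.*-comm x y) (ℤ.+-comm i j) k)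
        (K.sym (monomial-·-monomial y j x i k)))) f

  monomial-·-assoc : ∀ x i y j h → (monomial x i · monomial y j) · h ≈ᴱ monomial x i · (monomial y j · h)
  monomial-·-assoc x i y j h k = begin
    coeff ((monomial x i · monomial y j) · h) k      ≈⟨ ·-cong {monomial x i · monomial y j} {monomial (x K.* y) (i ℤ.+ j)} {h} {h}
                                                            (monomial-·-monomial x i y j) (λ _ → K.refl) k ⟩
    coeff (monomial (x K.* y) (i ℤ.+ j) · h) k        ≈⟨ coeff-monomial-· (x K.* y) (i ℤ.+ j) h k ⟩
    (x K.* y) K.* coeff h (k ℤ.- (i ℤ.+ j))            ≈⟨ K.*-assoc x y _ ⟩
    x K.* (y K.* coeff h (k ℤ.- (i ℤ.+ j)))            ≡⟨ ≡.cong (λ n → x K.* (y K.* coeff h n)) (k-[i+j]≡k-i-j k i j) ⟩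
    x K.* (y K.* coeff h (k ℤ.- i ℤ.- j))              ≈⟨ K.*-congˡ (coeff-monomial-· y j h (k ℤ.- i)) ⟨
    x K.* coeff (monomial y j · h) (k ℤ.- i)          ≈⟨ coeff-monomial-· x i (monomial y j · h) k ⟨
    coeff (monomial x i · (monomial y j · h)) k      ∎

  -- Reducing f and g to monomials is enough: against an arbitrary h, both sides then have explicit
  -- coefficients.
  ·-assoc : ∀ f g h → (f · g) · h ≈ᴱ f · (g · h)
  ·-assoc f g h = continuous-ext
    {λ f → (f · g) · h} {λ f → f · (g · h)}
    (∘-continuous {_· h} {_· g} (·-continuousʳ h) (·-continuousʳ g)) (·-continuousʳ (g · h))
    (λ x i → continuous-ext
      {λ g → (monomial x i · g) · h} {λ g → monomial x i · (g · h)}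
      (∘-continuous {_· h} {monomial x i ·_} (·-continuousʳ h) (·-continuousˡ (monomial x i)))
      (∘-continuous {monomial x i ·_} {_· h} (·-continuousˡ (monomial x i)) (·-continuousʳ h))
      (λ y j → monomial-·-assoc x i y j h) g)
    f

  ·-identityˡ : ∀ f → 1ᴱ · f ≈ᴱ f
  ·-identityˡ f k = K.trans (coeff-monomial-· 1# 0ℤ f k) (K.trans (K.*-identityˡ _)
    (K.reflexive (≡.cong (coeff f) (ℤ.+-identityʳ k))))

  ℰ-commutativeRing : CommutativeRing c ℓ
  ℰ-commutativeRing = record
    { Carrier = ℰ ; _≈_ = _≈ᴱ_ ; _+_ = _+ᴱ_ ; _*_ = _·_ ; -_ = -ᴱ_ ; 0# = 0ᴱ ; 1# = 1ᴱ
    ; isCommutativeRing = record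
      { isRing = record
        { +-isAbelianGroup = record
          { isGroup = record
            { isMonoid = record
              { isSemigroup = record
                { isMagma = record
                  { isEquivalence = record
                    { refl  = λ _ → K.refl
                    ; sym   = λ p i → K.sym (p i)
                    ; trans = λ p q i → K.trans (p i) (q i) }
                  ; ∙-cong = λ p q i → K.+-cong (p i) (q i) }
                ; assoc = λ f g h i → K.+-assoc _ _ _ }
              ; identity = (λ f i → K.+-identityˡ _) , (λ f i → K.+-identityʳ _) }
            ; inverse = (λ f i → K.-‿inverseˡ _) , (λ f i → K.-‿inverseʳ _)
            ; ⁻¹-cong = λ p i → K.-‿cong (p i) }
          ; comm = λ f g i → K.+-comm _ _ }
        ; *-cong = λ {f} {f′} {g} {g′} → ·-cong {f} {f′} {g} {g′}
        ; *-assoc = ·-assoc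
        ; *-identity = ·-identityˡ , λ f k → K.trans (·-comm f 1ᴱ k) (·-identityˡ f k)
        ; distrib = ·-distribˡ , ·-distribʳ }
      ; *-comm = ·-comm } }

i≤∣i∣ : ∀ i → i ℤ.≤ + ℤ.∣ i ∣
i≤∣i∣ (+ _)    = ℤ.≤-refl
i≤∣i∣ -[1+ _ ] = ℤ.-≤+

[]-injective : ∀ {i j : ℤ} → _≡_ {A = ℤ ⁺} [ i ] [ j ] → i ≡ j
[]-injective refl = refl

<-≤-connex : ∀ i j → i ℤ.< j ⊎ j ℤ.≤ i
<-≤-connex i j with i ℤ.<? j
... | yes i<j = inj₁ i<j
... | no  i≮j = inj₂ (ℤ.≮⇒≥ i≮j)

-- Infinite sums, fixed points and truncation of series.

module SeriesSum {c ℓ} (D : CompleteDVR c ℓ) (ν : ℚ) where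
  open CompleteDVR D
  open Convergence D
  open Limits D
  open Series D ν
  open LaurentSeries D ν
  open K using (Carrier; _≈_; 0#; 1#)
  open RingIdentities K
  open import Relation.Binary.Reasoning.Setoid K.setoid

  partial : (ℕ → ℰ) → ℕ → ℰ
  partial h zero    = 0ᴱ
  partial h (suc k) = partial h k +ᴱ h k

  ≤w-partial : ∀ {C i h} → (∀ k → C ≤w[ i ] coeff (h k) i) → ∀ k → C ≤w[ i ] coeff (partial h k) i
  ≤w-partial {i = i} p zero    = ≤w-0 i
  ≤w-partial         p (suc k) = ≤w-+ (≤w-partial p k) (p k)

  ≤w-partial-tail : ∀ {C i h K} → (∀ k → K ℕ.≤ k → C ≤w[ i ] coeff (h k) i) →
    ∀ k → C ≤w[ i ] coeff (partial h (k ℕ.+ K)) i K.- coeff (partial h K) i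
  ≤w-partial-tail {i = i} p zero = ≤w-cong (K.sym (K.-‿inverseʳ _)) (≤w-0 i)
  ≤w-partial-tail {K = K} p (suc k) = ≤w-cong (rearrange _ _ _)
    (≤w-+ (≤w-partial-tail p k) (p (k ℕ.+ K) (ℕ.m≤n+m K k)))
    where
    rearrange : ∀ x y z → (x K.- y) K.+ z ≈ (x K.+ z) K.- y
    rearrange x y z = K.trans (K.+-assoc x (K.- y) z)
      (K.trans (K.+-congˡ (K.+-comm (K.- y) z)) (K.sym (K.+-assoc x z (K.- y))))

  module _ {h : ℕ → ℰ} (null : Null h) where

    partial-cauchy : ∀ i → IsCauchy (λ k → coeff (partial h k) i)
    partial-cauchy i n = M , λ m m′ M≤m M≤m′ → ≤v-tele (from-M m M≤m) (≤v-swap (from-M m′ M≤m′))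
      where
      M : ℕ
      M = proj₁ (Null.vanish null i (n ℚ./ 1 ℚ.+ ν ℚ.* (i ℚ./ 1)))
      from-M : ∀ m → M ℕ.≤ m → [ n ] ≤v coeff (partial h m) i K.- coeff (partial h M) i
      from-M m M≤m = ≡.subst (λ k → [ n ] ≤v coeff (partial h k) i K.- coeff (partial h M) i)
        (ℕ.m∸n+n≡m M≤m)
        (≤w⇒≤v {n} {i} (≤w-partial-tail {h = h} {M} (proj₂ (Null.vanish null i _)) (m ℕ.∸ M)))

    sum-coeff : ℤ → Carrier
    sum-coeff i = proj₁ (completeᴷ (λ k → coeff (partial h k) i) (partial-cauchy i))

    sum-limit : ∀ i → IsLimit (λ k → coeff (partial h k) i) (sum-coeff i)
    sum-limit i = proj₂ (completeᴷ (λ k → coeff (partial h k) i) (partial-cauchy i))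

    ≤w-sum : ∀ {C} i → (∀ k → C ≤w[ i ] coeff (h k) i) → C ≤w[ i ] sum-coeff i
    ≤w-sum i p = ≤w-limit (sum-limit i) (≤w-partial {h = h} p)

    sum : ℰ
    sum = record
      { coeff   = sum-coeff
      ; bounded = let (C , p) = Null.lower null in C , λ i → ≤w-sum i λ k → p k i
      ; lim-∞   = λ C → let (N , p) = Null.left null C in N , λ i i≤N → ≤w-sum i λ k → p k i i≤N }

    tail : ℕ → ℰ
    tail K = sum +ᴱ (-ᴱ partial h K)

    ≤w-tail : ∀ {C} i K → (∀ k → K ℕ.≤ k → C ≤w[ i ] coeff (h k) i) → C ≤w[ i ] coeff (tail K) i
    ≤w-tail i K p = ≤w-limit
      (IsLimit-+ {λ k → coeff (partial h (k ℕ.+ K)) i} {λ _ → K.- coeff (partial h K) i}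
        (λ n → let (N , q) = sum-limit i n in
          N , λ m N≤m → q (m ℕ.+ K) (ℕ.≤-trans N≤m (ℕ.m≤m+n m K)))
        (IsLimit-eventually 0 λ _ _ → K.refl))
      (≤w-partial-tail {h = h} p)

    tail-null : Null tail
    tail-null = record
      { tame = record
        { lower = let (C , p) = Null.lower null in C , λ K i → ≤w-tail i K λ k _ → p k i
        ; left = λ C → let (N , p) = Null.left null C in
            N , λ K i i≤N → ≤w-tail i K λ k _ → p k i i≤N }
      ; vanish = λ i C → let (K , p) = Null.vanish null i C in
          K , λ K′ K≤K′ → ≤w-tail i K′ λ k K′≤k → p k (ℕ.≤-trans K≤K′ K′≤k) }

  iterate : (ℰ → ℰ) → ℰ → ℕ → ℰ
  iterate T g zero    = g
  iterate T g (suc k) = T (iterate T g k)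

  module FixedPoint {T : ℰ → ℰ} (t : IsContinuous T) {g : ℰ} (null : Null (iterate T g)) where
    open IsContinuous t

    -- The Neumann series g + T g + T² g + ...
    solution : ℰ
    solution = sum null

    T-0 : T 0ᴱ ≈ᴱ 0ᴱ
    T-0 i = RingProperties.x+x≈x⇒x≈0 K.ring (coeff (T 0ᴱ) i) (begin
      coeff (T 0ᴱ) i K.+ coeff (T 0ᴱ) i  ≈⟨ T-+ 0ᴱ 0ᴱ i ⟨
      coeff (T (0ᴱ +ᴱ 0ᴱ)) i             ≈⟨ T-cong {0ᴱ +ᴱ 0ᴱ} {0ᴱ} (λ _ → K.+-identityʳ 0#) i ⟩
      coeff (T 0ᴱ) i                     ∎)

    partial-suc : ∀ k → partial (iterate T g) (suc k) ≈ᴱ g +ᴱ T (partial (iterate T g) k)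
    partial-suc zero    i = K.trans (K.+-comm 0# _) (K.+-congˡ (K.sym (T-0 i)))
    partial-suc (suc k) i = begin
      coeff (partial h (suc k)) i K.+ coeff (T (h k)) i                ≈⟨ K.+-congʳ (partial-suc k i) ⟩
      (coeff g i K.+ coeff (T (partial h k)) i) K.+ coeff (T (h k)) i  ≈⟨ K.+-assoc _ _ _ ⟩
      coeff g i K.+ (coeff (T (partial h k)) i K.+ coeff (T (h k)) i)  ≈⟨ K.+-congˡ (T-+ (partial h k) (h k) i) ⟨
      coeff g i K.+ coeff (T (partial h (suc k))) i                    ∎
      where
      h : ℕ → ℰ
      h = iterate T g

    -- Cut after k terms, the defect of the equation is `tail` (k + 1) minus T applied to `tail` k,
    -- and both are null.
    solves : solution ≈ᴱ g +ᴱ T solution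
    solves i = x-y≈0⇒x≈y (≤w-all⇒≈0 i λ C →
      let (M , p)  = Null.vanish (tail-null null) i C
          (M′ , q) = Null.vanish (T-null (tail-null null)) i C
          N = M ℕ.⊔ M′
      in ≤w-cong (K.sym (difference N))
           (≤w-difference (p (suc N) (ℕ.m≤n⇒m≤1+n (ℕ.m≤m⊔n M M′))) (q N (ℕ.m≤n⊔m M M′))))
      where
      p : ℕ → ℰ
      p = partial (iterate T g)
      split : ∀ k → T solution ≈ᴱ T (p k) +ᴱ T (tail null k)
      split k j = K.trans
        (T-cong {solution} {p k +ᴱ tail null k} (λ j → x≈y+[x-y] (coeff solution j) (coeff (p k) j)) j)
        (T-+ (p k) (tail null k) j)
      difference : ∀ k → coeff solution i K.- (coeff g i K.+ coeff (T solution) i) ≈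
                         coeff (tail null (suc k)) i K.- coeff (T (tail null k)) i
      difference k = begin
        s K.- (coeff g i K.+ coeff (T solution) i)  ≈⟨ K.+-congˡ (K.-‿cong (K.+-congˡ (split k i))) ⟩
        s K.- (coeff g i K.+ (a K.+ b))             ≈⟨ K.+-congˡ (K.-‿cong (K.+-assoc _ a b)) ⟨
        s K.- ((coeff g i K.+ a) K.+ b)             ≈⟨ K.+-congˡ (K.-‿cong (K.+-congʳ (partial-suc k i))) ⟨
        s K.- (coeff (p (suc k)) i K.+ b)           ≈⟨ K.+-congˡ (RingProperties.-‿+-comm K.ring _ b) ⟨
        s K.+ (K.- coeff (p (suc k)) i K.- b)       ≈⟨ K.+-assoc s _ _ ⟨
        (s K.- coeff (p (suc k)) i) K.- b           ∎
        where
        s = coeff solution i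
        a = coeff (T (p k)) i
        b = coeff (T (tail null k)) i

    ≤w-solution : ∀ {C} i → (∀ k → C ≤w[ i ] coeff (iterate T g k) i) → C ≤w[ i ] coeff solution i
    ≤w-solution = ≤w-sum null

  coeff-·-zero : ∀ f g k → (∀ i → term f g k i ≈ 0#) → coeff (f · g) k ≈ 0#
  coeff-·-zero f g k h = coeff-·-unique f g k 0#
    (IsLimit-eventually 0 λ m _ → partialSum-zero m λ j _ → h j)

  ≤w-· : ∀ {C C′} f g → (∀ i → C ≤w[ i ] coeff f i) → (∀ i → C′ ≤w[ i ] coeff g i) →
         ∀ i → C ℚ.+ C′ ≤w[ i ] coeff (f · g) i
  ≤w-· {C} {C′} f g p q k = ≤w-coeff-· f g λ i → ≤w-*-at {C} {C′} (p i) (q (k ℤ.- i))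

  holomorphic-+ : ∀ {f g} → Holomorphic f → Holomorphic g → Holomorphic (f +ᴱ g)
  holomorphic-+ p q i i<0 = K.trans (K.+-cong (p i i<0) (q i i<0)) (K.+-identityʳ 0#)

  holomorphic-neg : ∀ {f} → Holomorphic f → Holomorphic (-ᴱ f)
  holomorphic-neg p i i<0 = K.trans (K.-‿cong (p i i<0)) (RingProperties.-0#≈0# K.ring)

  -- If k is negative, then for every i one of i and k - i is negative.
  holomorphic-· : ∀ {f g} → Holomorphic f → Holomorphic g → Holomorphic (f · g)
  holomorphic-· {f} {g} p q k k<0 = coeff-·-zero f g k λ i → pick i (<-≤-connex i 0ℤ)
    where
    pick : ∀ i → i ℤ.< 0ℤ ⊎ 0ℤ ℤ.≤ i → term f g k i ≈ 0#
    pick i (inj₁ i<0) = K.trans (K.*-congʳ (p i i<0)) (K.zeroˡ _)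
    pick i (inj₂ 0≤i) = K.trans (K.*-congˡ (q (k ℤ.- i) (ℤ.≤-<-trans (ℤ.i-j≤i k i {{ℤ.nonNegative 0≤i}}) k<0))) (K.zeroʳ _)

  module _ {P : ℤ → Set} (P? : ∀ i → Dec (P i)) where

    select : ∀ {A : Set} → Dec A → Carrier → Carrier
    select (yes _) x = x
    select (no _)  x = 0#

    ≤w-select : ∀ {A : Set} {C i x} (d : Dec A) → C ≤w[ i ] x → C ≤w[ i ] select d x
    ≤w-select         (yes _) p = p
    ≤w-select {i = i} (no _)  p = ≤w-0 i

    restrict : ℰ → ℰ
    restrict f = record
      { coeff   = λ i → select (P? i) (coeff f i)
      ; bounded = let (C , p) = bounded f in C , λ i → ≤w-select (P? i) (p i)
      ; lim-∞   = λ C → let (N , p) = lim-∞ f C in N , λ i i≤N → ≤w-select (P? i) (p i i≤N) }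

    restrict-inside : ∀ f {i} → P i → coeff (restrict f) i ≈ coeff f i
    restrict-inside f {i} Pi with P? i
    ... | yes _  = K.refl
    ... | no ¬Pi = contradiction Pi ¬Pi

    restrict-outside : ∀ f {i} → ¬ P i → coeff (restrict f) i ≈ 0#
    restrict-outside f {i} ¬Pi with P? i
    ... | yes Pi = contradiction Pi ¬Pi
    ... | no _   = K.refl

    ≤w-restrict : ∀ {C i} f → C ≤w[ i ] coeff f i → C ≤w[ i ] coeff (restrict f) i
    ≤w-restrict {i = i} f = ≤w-select (P? i)

    restrict-continuous : IsContinuous restrict
    restrict-continuous = record
      { T-cong = λ f≈g i → select-cong (P? i) (f≈g i)
      ; T-+    = λ f g i → select-+ (P? i) _ _
      ; T-null = λ {h} null → record
        { tame = record
          { lower = let (C , p) = Null.lower null in C , λ k i → ≤w-restrict (h k) (p k i)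
          ; left = λ C → let (N , p) = Null.left null C in N , λ k i i≤N → ≤w-restrict (h k) (p k i i≤N) }
        ; vanish = λ i C → let (K , p) = Null.vanish null i C in
            K , λ k K≤k → ≤w-restrict (h k) (p k K≤k) } }
      where
      select-cong : ∀ {A : Set} {x y} (d : Dec A) → x ≈ y → select d x ≈ select d y
      select-cong (yes _) x≈y = x≈y
      select-cong (no _)  _   = K.refl
      select-+ : ∀ {A : Set} (d : Dec A) x y → select d (x K.+ y) ≈ select d x K.+ select d y
      select-+ (yes _) x y = K.refl
      select-+ (no _)  x y = K.sym (K.+-identityʳ 0#)

-- Gauss valuations in integral units.

module Weights (ν : ℚ) where

  -- The weight of x u^i with v x = n, in units of 1/α.
  weight : ℤ → ℤ → ℤ
  weight n i = ↧ ν ℤ.* n ℤ.+ ↥ ν ℤ.* i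

  private
    d : ℕ
    d = ℚ.denominator-1 ν

  opaque
    q : ℤ → ℚ
    q z = z ℚ./ ↧ₙ ν

    toℚᵘ-q : ∀ z → ℚ.toℚᵘ (q z) ℚᵘ.≃ ℚᵘ.mkℚᵘ z d
    toℚᵘ-q z = ℚ.toℚᵘ-fromℚᵘ (ℚᵘ.mkℚᵘ z d)

  private
    toℚᵘ-/1 : ∀ z → ℚ.toℚᵘ (z ℚ./ 1) ℚᵘ.≃ ℚᵘ.mkℚᵘ z 0
    toℚᵘ-/1 z = ℚ.toℚᵘ-fromℚᵘ (ℚᵘ.mkℚᵘ z 0)

    toℚᵘ-ν : ∀ ν → ℚ.toℚᵘ ν ≡ ℚᵘ.mkℚᵘ (↥ ν) (ℚ.denominator-1 ν)
    toℚᵘ-ν record{} = refl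

  q-mono : ∀ {y z} → y ℤ.≤ z → q y ℚ.≤ q z
  q-mono {y} {z} y≤z = ℚ.toℚᵘ-cancel-≤
    (ℚᵘ.≤-respˡ-≃ (ℚᵘ.≃-sym (toℚᵘ-q y)) (ℚᵘ.≤-respʳ-≃ (ℚᵘ.≃-sym (toℚᵘ-q z))
      (ℚᵘ.*≤* (ℤ.*-monoʳ-≤-nonNeg (+ suc d) y≤z))))

  q-cancel : ∀ {y z} → q y ℚ.≤ q z → y ℤ.≤ z
  q-cancel {y} {z} p with ℚᵘ.≤-respˡ-≃ (toℚᵘ-q y) (ℚᵘ.≤-respʳ-≃ (toℚᵘ-q z) (ℚ.toℚᵘ-mono-≤ p))
  ... | ℚᵘ.*≤* y≤z = ℤ.*-cancelʳ-≤-pos y z (+ suc d) y≤z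

  q-+ : ∀ y z → q (y ℤ.+ z) ≡ q y ℚ.+ q z
  q-+ y z = ℚ.toℚᵘ-injective (begin
    ℚ.toℚᵘ (q (y ℤ.+ z))               ≈⟨ toℚᵘ-q (y ℤ.+ z) ⟩
    ℚᵘ.mkℚᵘ (y ℤ.+ z) d                ≈⟨ ℚᵘ.*≡* (cross y z (+ suc d)) ⟩
    ℚᵘ.mkℚᵘ y d ℚᵘ.+ ℚᵘ.mkℚᵘ z d       ≈⟨ ℚᵘ.+-cong (toℚᵘ-q y) (toℚᵘ-q z) ⟨
    ℚ.toℚᵘ (q y) ℚᵘ.+ ℚ.toℚᵘ (q z)     ≈⟨ ℚ.toℚᵘ-homo-+ (q y) (q z) ⟨
    ℚ.toℚᵘ (q y ℚ.+ q z)               ∎)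
    where
    open import Relation.Binary.Reasoning.Setoid ℚᵘ.≃-setoid
    cross : ∀ y z D → (y ℤ.+ z) ℤ.* (D ℤ.* D) ≡ (y ℤ.* D ℤ.+ z ℤ.* D) ℤ.* D
    cross = solve-∀

  -- Since ν is rational, Gauss valuations lie in (1/α)ℤ. Comparing them becomes a matter of
  -- integers, where sets bounded below have minima and a strict inequality gains a full unit.
  q-weight : ∀ n i → n ℚ./ 1 ℚ.+ ν ℚ.* (i ℚ./ 1) ≡ q (weight n i)
  q-weight n i = ℚ.toℚᵘ-injective (begin
    ℚ.toℚᵘ (n ℚ./ 1 ℚ.+ ν ℚ.* (i ℚ./ 1))                 ≈⟨ ℚ.toℚᵘ-homo-+ (n ℚ./ 1) (ν ℚ.* (i ℚ./ 1)) ⟩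
    ℚ.toℚᵘ (n ℚ./ 1) ℚᵘ.+ ℚ.toℚᵘ (ν ℚ.* (i ℚ./ 1))       ≈⟨ ℚᵘ.+-cong (toℚᵘ-/1 n) (ℚ.toℚᵘ-homo-* ν (i ℚ./ 1)) ⟩
    N ℚᵘ.+ ℚ.toℚᵘ ν ℚᵘ.* ℚ.toℚᵘ (i ℚ./ 1)                ≈⟨ ℚᵘ.+-congʳ N (ℚᵘ.*-cong (ℚᵘ.≃-reflexive (toℚᵘ-ν ν)) (toℚᵘ-/1 i)) ⟩
    N ℚᵘ.+ ℚᵘ.mkℚᵘ (↥ ν) d ℚᵘ.* ℚᵘ.mkℚᵘ i 0              ≈⟨ ℚᵘ.*≡* (cross n (↥ ν) i (↧ ν)) ⟩
    ℚᵘ.mkℚᵘ (weight n i) d                               ≈⟨ toℚᵘ-q (weight n i) ⟨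
    ℚ.toℚᵘ (q (weight n i))                              ∎)
    where
    open import Relation.Binary.Reasoning.Setoid ℚᵘ.≃-setoid
    N = ℚᵘ.mkℚᵘ n 0
    cross : ∀ n b i D → (n ℤ.* (D ℤ.* 1ℤ) ℤ.+ (b ℤ.* i) ℤ.* 1ℤ) ℤ.* D ≡
                        (D ℤ.* n ℤ.+ b ℤ.* i) ℤ.* (1ℤ ℤ.* (D ℤ.* 1ℤ))
    cross = solve-∀

  q-0 : q 0ℤ ≡ ℚ.0ℚ
  q-0 = ℚ.toℚᵘ-injective (ℚᵘ.≃-trans (toℚᵘ-q 0ℤ) (ℚᵘ.*≡* refl))

  ≤q-archimedean : ∀ C → ∃[ z ] C ℚ.≤ q z
  ≤q-archimedean C@record{} = z , ℚ.toℚᵘ-cancel-≤ (ℚᵘ.≤-respʳ-≃ (ℚᵘ.≃-sym (toℚᵘ-q z))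
    (ℚᵘ.*≤* (≡.subst (ℤ._≤ z ℤ.* ↧ C) (ℤ.*-comm (+ suc d) (↥ C)) bound)))
    where
    -- α times the absolute numerator of C, so that `q z` is that absolute numerator itself, which
    -- is at least C.
    z : ℤ
    z = + suc d ℤ.* + ℤ.∣ ↥ C ∣
    scale : ∀ a e → + a ℤ.≤ + a ℤ.* + suc e
    scale a e = ≡.subst ((+ a) ℤ.≤_) (ℤ.pos-* a (suc e)) (ℤ.+≤+ (ℕ.m≤m*n a (suc e)))
    bound : + suc d ℤ.* ↥ C ℤ.≤ z ℤ.* ↧ C
    bound = ≡.subst (+ suc d ℤ.* ↥ C ℤ.≤_) (≡.sym (ℤ.*-assoc (+ suc d) (+ ℤ.∣ ↥ C ∣) (↧ C)))
      (ℤ.*-monoˡ-≤-nonNeg (+ suc d) (ℤ.≤-trans (i≤∣i∣ (↥ C)) (scale ℤ.∣ ↥ C ∣ (ℚ.denominator-1 C))))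

  q≤-archimedean : ∀ C → ∃[ z ] q z ℚ.≤ C
  q≤-archimedean C = ℤ.- z , ≡.subst₂ ℚ._≤_ eq (GroupProperties.⁻¹-involutive ℚ.+-0-group C) (ℚ.neg-antimono-≤ (proj₂ (≤q-archimedean (ℚ.- C))))
    where
    z : ℤ
    z = proj₁ (≤q-archimedean (ℚ.- C))
    eq : ℚ.- q z ≡ q (ℤ.- z)
    eq = begin
      ℚ.- q z                               ≡⟨ ℚ.+-identityʳ _ ⟨
      ℚ.- q z ℚ.+ ℚ.0ℚ                      ≡⟨ ≡.cong (λ t → ℚ.- q z ℚ.+ t) (≡.trans (≡.cong q (ℤ.+-inverseʳ z)) q-0) ⟨
      ℚ.- q z ℚ.+ q (z ℤ.+ ℤ.- z)           ≡⟨ ≡.cong (λ t → ℚ.- q z ℚ.+ t) (q-+ z (ℤ.- z)) ⟩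
      ℚ.- q z ℚ.+ (q z ℚ.+ q (ℤ.- z))       ≡⟨ ℚ.+-assoc (ℚ.- q z) (q z) _ ⟨
      (ℚ.- q z ℚ.+ q z) ℚ.+ q (ℤ.- z)       ≡⟨ ≡.cong (ℚ._+ q (ℤ.- z)) (ℚ.+-inverseˡ (q z)) ⟩
      ℚ.0ℚ ℚ.+ q (ℤ.- z)                    ≡⟨ ℚ.+-identityˡ _ ⟩
      q (ℤ.- z)                             ∎
      where open ≡.≡-Reasoning

module Minimum (em : ∀ {a} → ExcludedMiddle a) where

  minimumℕ : ∀ {a} {X : Set a} (μ : X → ℕ) → X → ∃[ x ] ∀ y → μ x ℕ.≤ μ y
  minimumℕ {X = X} μ x = descend x (ℕ.<-wellFounded (μ x))
    where
    descend : ∀ x → Acc ℕ._<_ (μ x) → ∃[ x ] ∀ y → μ x ℕ.≤ μ y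
    descend x (acc rec) with em {P = ∃[ y ] μ y ℕ.< μ x}
    ... | yes (y , y<x) = descend y (rec y<x)
    ... | no  ¬smaller  = x , λ y → ℕ.≮⇒≥ λ y<x → ¬smaller (y , y<x)

  minimumℤ : ∀ {a} {X : Set a} (μ : X → ℤ) (b : ℤ) → (∀ x → b ℤ.≤ μ x) → X →
             ∃[ x ] ∀ y → μ x ℤ.≤ μ y
  minimumℤ μ b b≤μ x =
    let (x , x-min) = minimumℕ (λ x → ℤ.∣ μ x ℤ.- b ∣) x in
    x , λ y → ≡.subst₂ ℤ._≤_ (cancel (μ x) b) (cancel (μ y) b) (ℤ.+-monoˡ-≤ b
      (≡.subst₂ ℤ._≤_ (ℤ.0≤i⇒+∣i∣≡i (ℤ.i≤j⇒0≤j-i (b≤μ x))) (ℤ.0≤i⇒+∣i∣≡i (ℤ.i≤j⇒0≤j-i (b≤μ y)))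
        (ℤ.+≤+ (x-min y))))
    where
    cancel : ∀ i j → i ℤ.- j ℤ.+ j ≡ i
    cancel = solve-∀

-- Ring identities behind inversion and Weierstrass division.

module FactorIdentities {c ℓ} (E : CommutativeRing c ℓ) where
  open CommutativeRing E
  open RingProperties ring using (-‿distribʳ-*; -‿+-comm)
  open import Relation.Binary.Reasoning.Setoid setoid

  *-rotate : ∀ f m r s → f * (m * (r * s)) ≈ (r * (m * f)) * s
  *-rotate f m r s = begin
    f * (m * (r * s))   ≈⟨ *-assoc f m _ ⟨
    (f * m) * (r * s)   ≈⟨ *-assoc _ r s ⟨
    ((f * m) * r) * s   ≈⟨ *-congʳ (trans (*-comm _ r) (*-congˡ (*-comm f m))) ⟩
    (r * (m * f)) * s   ∎

  *-expand : ∀ m g r h f → m * (g - (r * h) * f) ≈ m * g - h * (r * (m * f))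
  *-expand m g r h f = begin
    m * (g - (r * h) * f)             ≈⟨ distribˡ m g _ ⟩
    m * g + m * (- ((r * h) * f))     ≈⟨ +-congˡ (-‿distribʳ-* m _) ⟨
    m * g - m * ((r * h) * f)         ≈⟨ +-congˡ (-‿cong (trans (*-comm m _) (*-assoc _ f m))) ⟩
    m * g - (r * h) * (f * m)         ≈⟨ +-congˡ (-‿cong (*-cong (*-comm r h) (*-comm f m))) ⟩
    m * g - (h * r) * (m * f)         ≈⟨ +-congˡ (-‿cong (*-assoc h r _)) ⟩
    m * g - h * (r * (m * f))         ∎

  fixed-point⇒inverse : ∀ p r → r ≈ 1# + (- p) * r → (1# + p) * r ≈ 1#
  fixed-point⇒inverse p r r≈ = begin
    (1# + p) * r                   ≈⟨ distribʳ r 1# p ⟩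
    1# * r + p * r                 ≈⟨ +-congʳ (trans (*-identityˡ r) r≈) ⟩
    (1# + (- p) * r) + p * r       ≈⟨ +-assoc 1# _ _ ⟩
    1# + ((- p) * r + p * r)       ≈⟨ +-congˡ (distribʳ r (- p) p) ⟨
    1# + (- p + p) * r             ≈⟨ +-congˡ (*-congʳ (-‿inverseˡ p)) ⟩
    1# + 0# * r                    ≈⟨ +-congˡ (zeroˡ r) ⟩
    1# + 0#                        ≈⟨ +-identityʳ 1# ⟩
    1#                             ∎

  module _ {f m p s r : Carrier} (mf≈ : m * f ≈ (1# + p) + s) (r-inv : (1# + p) * r ≈ 1#) where

    r*[m*f] : r * (m * f) ≈ 1# + r * s
    r*[m*f] = begin
      r * (m * f)              ≈⟨ *-congˡ mf≈ ⟩
      r * ((1# + p) + s)       ≈⟨ distribˡ r (1# + p) s ⟩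
      r * (1# + p) + r * s     ≈⟨ +-congʳ (trans (*-comm r (1# + p)) r-inv) ⟩
      1# + r * s               ∎

    factor-inverse : ∀ {r′} → (1# + r * s) * r′ ≈ 1# → f * (m * (r * r′)) ≈ 1#
    factor-inverse {r′} r′-inv = begin
      f * (m * (r * r′))       ≈⟨ *-rotate f m r r′ ⟩
      (r * (m * f)) * r′       ≈⟨ *-congʳ r*[m*f] ⟩
      (1# + r * s) * r′        ≈⟨ r′-inv ⟩
      1#                       ∎

    -- The algebraic core of Weierstrass division: if h agrees with m g - h (r s) in degrees ≥ 0,
    -- then the remainder, shifted by m, has negative degrees only.
    factor-remainder : ∀ g h → m * (g - (r * h) * f) ≈ (m * g - h) - h * (r * s)
    factor-remainder g h = begin
      m * (g - (r * h) * f)               ≈⟨ *-expand m g r h f ⟩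
      m * g - h * (r * (m * f))           ≈⟨ +-congˡ (-‿cong (*-congˡ r*[m*f])) ⟩
      m * g - h * (1# + r * s)            ≈⟨ +-congˡ (-‿cong (distribˡ h 1# _)) ⟩
      m * g - (h * 1# + h * (r * s))      ≈⟨ +-congˡ (-‿cong (+-congʳ (*-identityʳ h))) ⟩
      m * g - (h + h * (r * s))           ≈⟨ +-congˡ (-‿+-comm h _) ⟨
      m * g + (- h - h * (r * s))         ≈⟨ +-assoc _ _ _ ⟨
      (m * g - h) - h * (r * s)           ∎

-- Leading terms of nonzero series.

module LeadingTerms (em : ∀ {a} → ExcludedMiddle a) {c ℓ} (D : CompleteDVR c ℓ) (ν : ℚ) where
  open Minimum em
  open CompleteDVR D
  open Series D ν
  open LaurentSeries D ν
  open SeriesSum D ν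
  open Weights ν
  open K using (Carrier; _≈_; 0#; 1#)

  ≤w⇒≤weight : ∀ {z n} i x → v x ≡ [ n ] → q z ≤w[ i ] x → z ℤ.≤ weight n i
  ≤w⇒≤weight {z} {n} i x vx≡n ⟪ p ⟫ with v x
  ≤w⇒≤weight {z} {n} i x refl ⟪ Sup.[ p ] ⟫ | _ = q-cancel (≡.subst (q z ℚ.≤_) (q-weight n i) p)

  ≤weight⇒≤w : ∀ {z} i x → (∀ n → v x ≡ [ n ] → z ℤ.≤ weight n i) → q z ≤w[ i ] x
  ≤weight⇒≤w {z} i x h = ⟪ bound (v x) h ⟫
    where
    open Sup ℚ._≤_ using () renaming (_≤⁺_ to _≤ℚ⁺_)
    bound : ∀ w → (∀ n → w ≡ [ n ] → z ℤ.≤ weight n i) → [ q z ] ≤ℚ⁺ wt i w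
    bound ⊤⁺    _ = _ Sup.≤⊤⁺
    bound [ n ] h = Sup.[ ≡.subst (q z ℚ.≤_) (≡.sym (q-weight n i)) (q-mono (h n refl)) ]

  v≡[]⇒≉0 : ∀ {x n} → v x ≡ [ n ] → ¬ x ≈ 0#
  v≡[]⇒≉0 vx≡n x≈0 with ≡.trans (≡.sym vx≡n) (Equivalence.from v-∞ x≈0)
  ... | ()

  ≉0⇒v≡[] : ∀ {x} → ¬ x ≈ 0# → ∃[ n ] v x ≡ [ n ]
  ≉0⇒v≡[] {x} x≉0 with v x in vx≡
  ... | ⊤⁺    = contradiction (Equivalence.to v-∞ vx≡) x≉0
  ... | [ n ] = n , refl

  v-1 : v 1# ≡ [ 0ℤ ]
  v-1 with ≉0⇒v≡[] 1≉0
  ... | n , v1≡n = ≡.trans v1≡n (≡.cong [_] (idempotent n ([]-injective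
    (≡.trans (≡.sym (≡.cong₂ (zipWith ℤ._+_) v1≡n v1≡n))
      (≡.trans (≡.sym (v-* 1# 1#)) (≡.trans (v-cong (K.*-identityˡ 1#)) v1≡n))))))
    where
    idempotent : ∀ n → n ℤ.+ n ≡ n → n ≡ 0ℤ
    idempotent n n+n≡n = GroupProperties.identityˡ-unique (AbelianGroup.group ℤ.+-0-abelianGroup) n n n+n≡n

  v-inverse : ∀ {x y n} → v x ≡ [ n ] → x K.* y ≈ 1# → v y ≡ [ ℤ.- n ]
  v-inverse {x} {y} {n} vx≡n xy≈1 = solve-for (v y)
    (≡.trans (≡.sym (≡.trans (v-* x y) (≡.cong (λ a → zipWith ℤ._+_ a (v y)) vx≡n)))
      (≡.trans (v-cong xy≈1) v-1))
    where
    solve-for : ∀ w → zipWith ℤ._+_ [ n ] w ≡ [ 0ℤ ] → w ≡ [ ℤ.- n ]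
    solve-for [ m ] eq = ≡.cong [_] (GroupProperties.inverseʳ-unique (AbelianGroup.group ℤ.+-0-abelianGroup) n m (inj eq))
      where
      inj : [ n ℤ.+ m ] ≡ [ 0ℤ ] → n ℤ.+ m ≡ 0ℤ
      inj eq with n ℤ.+ m
      inj refl | _ = refl

  infix 4 _≤ᴱ_
  _≤ᴱ_ : ℤ → ℰ → Set
  z ≤ᴱ f = ∀ i → q z ≤w[ i ] coeff f i

  ≤ᴱ-· : ∀ {y z} f g → y ≤ᴱ f → z ≤ᴱ g → y ℤ.+ z ≤ᴱ f · g
  ≤ᴱ-· {y} {z} f g p r i = ≡.subst (_≤w[ i ] coeff (f · g) i) (≡.sym (q-+ y z)) (≤w-· f g p r i)

  ≤ᴱ-bound : ∀ f → ∃[ z ] z ≤ᴱ f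
  ≤ᴱ-bound f = let (C , p) = bounded f ; (z , qz≤C) = q≤-archimedean C in
    z , λ i → ≤w-weaken qz≤C (p i)

  Sᵤ⇒0≤ᴱ : ∀ {f} → Sᵤ f → 0ℤ ≤ᴱ f
  Sᵤ⇒0≤ᴱ {f} p i = ≡.subst (_≤w[ i ] coeff f i) (≡.sym q-0) (p i)

  0≤ᴱ⇒Sᵤ : ∀ {f} → 0ℤ ≤ᴱ f → Sᵤ f
  0≤ᴱ⇒Sᵤ {f} p i = ≡.subst (_≤w[ i ] coeff f i) q-0 (p i)

  ≤ᴱ-weaken : ∀ {y z} f → y ℤ.≤ z → z ≤ᴱ f → y ≤ᴱ f
  ≤ᴱ-weaken f y≤z p i = ≤w-weaken (q-mono y≤z) (p i)

  -- The term of least weight and, among those, of least exponent.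
  record Leading (f : ℰ) : Set where
    field
      order index value : ℤ
      v-leading : v (coeff f index) ≡ [ value ]
      order≡    : order ≡ weight value index
      order≤    : order ≤ᴱ f
      order<    : ∀ i → i ℤ.< index → q (1ℤ ℤ.+ order) ≤w[ i ] coeff f i

    leading≉0 : ¬ coeff f index ≈ 0#
    leading≉0 = v≡[]⇒≉0 v-leading

  -- Two minimisations: first of the weight, bounded below by `≤ᴱ-bound`, then of the exponent among
  -- the terms of least weight, bounded below because weights tend to infinity as the exponent tends
  -- to -∞.
  leading : ∀ f → ¬ f ≈ᴱ 0ᴱ → Leading f
  leading f f≉0 = record
    { order = weight (n⋆) i⋆ ; index = proj₁ (proj₁ x₂) ; value = proj₁ (proj₂ (proj₁ x₂))
    ; v-leading = proj₂ (proj₂ (proj₁ x₂))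
    ; order≡ = ≡.sym (proj₂ x₂)
    ; order≤ = λ i → ≤weight⇒≤w i (coeff f i) λ n v≡n → x₁-min (i , n , v≡n)
    -- A term of least weight at a smaller exponent would contradict the choice of `x₂`; so the
    -- weight is strictly larger, hence larger by at least 1.
    ; order< = λ i i<index → ≤weight⇒≤w i (coeff f i) λ n v≡n →
        ℤ.i<j⇒suc[i]≤j (ℤ.≤∧≢⇒< (x₁-min (i , n , v≡n)) λ eq →
          ℤ.<⇒≱ i<index (x₂-min ((i , n , v≡n) , ≡.sym eq)))
    }
    where
    Term : Set
    Term = Σ[ i ∈ ℤ ] Σ[ n ∈ ℤ ] v (coeff f i) ≡ [ n ]

    μ : Term → ℤ
    μ (i , n , _) = weight n i

    some : Term
    some with em {P = ∃[ i ] ¬ coeff f i ≈ 0#}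
    ... | yes (i , fi≉0) = i , ≉0⇒v≡[] fi≉0
    ... | no all-zero = contradiction f≈0 f≉0
      where
      f≈0 : f ≈ᴱ 0ᴱ
      f≈0 i with em {P = coeff f i ≈ 0#}
      ... | yes fi≈0 = fi≈0
      ... | no fi≉0  = contradiction (i , fi≉0) all-zero

    first : ∃[ x ] ∀ y → μ x ℤ.≤ μ y
    first = let (z , z≤f) = ≤ᴱ-bound f in
      minimumℤ μ z (λ { (i , n , v≡n) → ≤w⇒≤weight i (coeff f i) v≡n (z≤f i) }) some

    x₁ : Term
    x₁ = proj₁ first
    x₁-min : ∀ y → μ x₁ ℤ.≤ μ y
    x₁-min = proj₂ first
    i⋆ n⋆ : ℤ
    i⋆ = proj₁ x₁
    n⋆ = proj₁ (proj₂ x₁)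

    second : ∃[ x ] ∀ (y : Σ[ t ∈ Term ] μ t ≡ μ x₁) → proj₁ (proj₁ x) ℤ.≤ proj₁ (proj₁ y)
    -- Up to N every weight is at least one more than the minimum, so the exponents in question lie
    -- above N.
    second = let (N , p) = lim-∞ f (q (1ℤ ℤ.+ μ x₁)) in
      minimumℤ {X = Σ[ t ∈ Term ] μ t ≡ μ x₁} (λ y → proj₁ (proj₁ y)) N
        (λ { ((i , n , v≡n) , eq) → ℤ.<⇒≤ (ℤ.≰⇒> λ i≤N → ℤ.<⇒≱ (ℤ.suc[i]≤j⇒i<j ℤ.≤-refl)
           (≡.subst (ℤ.suc (μ x₁) ℤ.≤_) eq (≤w⇒≤weight {1ℤ ℤ.+ μ x₁} i (coeff f i) v≡n (p i i≤N)))) })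
        (x₁ , refl)

    x₂ : Σ[ t ∈ Term ] μ t ≡ μ x₁
    x₂ = proj₁ second
    x₂-min : ∀ y → proj₁ (proj₁ x₂) ℤ.≤ proj₁ (proj₁ y)
    x₂-min = proj₂ second

-- Factorisation by the leading term and inverses in ℰ.

module Factorisation (em : ∀ {a} → ExcludedMiddle a) {c ℓ} (D : CompleteDVR c ℓ) (ν : ℚ) where
  open CompleteDVR D
  open Limits D
  open Series D ν
  open LaurentSeries D ν
  open SeriesSum D ν
  open Weights ν
  open LeadingTerms em D ν
  open K using (Carrier; _≈_; 0#; 1#)
  open FactorIdentities ℰ-commutativeRing
  open import Relation.Binary.Reasoning.Setoid K.setoid

  ≤ᴱ-neg : ∀ {z} f → z ≤ᴱ f → z ≤ᴱ -ᴱ f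
  ≤ᴱ-neg f p i = ≤w-neg (p i)

  ≤ᴱ-monomial : ∀ {z} x i → q z ≤w[ i ] x → z ≤ᴱ monomial x i
  ≤ᴱ-monomial x i p j with j ℤ.≟ i
  ... | yes refl = p
  ... | no _     = ≤w-0 j

  0≤ᴱ1 : 0ℤ ≤ᴱ 1ᴱ
  0≤ᴱ1 = ≤ᴱ-monomial 1# 0ℤ (≤weight⇒≤w 0ℤ 1# λ n v1≡n →
    ℤ.≤-reflexive (≡.sym (≡.trans (≡.cong (λ n → weight n 0ℤ) ([]-injective (≡.trans (≡.sym v1≡n) v-1)))
      (≡.cong₂ ℤ._+_ (ℤ.*-zeroʳ (↧ ν)) (ℤ.*-zeroʳ (↥ ν))))))

  -- For given C, all but finitely many members exceed C in every degree. The others are single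
  -- elements of ℰ, whose thresholds towards -∞ have a minimum.
  growth⇒null : ∀ (h : ℕ → ℰ) z → (∀ k → z ℤ.+ + k ≤ᴱ h k) → Null h
  growth⇒null h z grows = record
    { tame = record
      { lower = q z , λ k i → ≤w-weaken (q-mono (ℤ.i≤i+j z (+ k))) (grows k i)
      ; left = left }
    ; vanish = λ i C → proj₁ (large C) , λ k K≤k → proj₂ (large C) k K≤k i }
    where

    large : ∀ C → ∃[ K ] ∀ k → K ℕ.≤ k → ∀ i → C ≤w[ i ] coeff (h k) i
    large C = let (y , C≤qy) = ≤q-archimedean C in
      ℤ.∣ y ℤ.- z ∣ , λ k ≤k i → ≤w-weaken
        (ℚ.≤-trans C≤qy (q-mono (≡.subst (ℤ._≤ z ℤ.+ + k) (i+[k-i]≡k z y)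
          (ℤ.+-monoʳ-≤ z (ℤ.≤-trans (i≤∣i∣ (y ℤ.- z)) (ℤ.+≤+ ≤k))))))
        (grows k i)

    left-below : ∀ C m → ∃[ N ] ∀ k → k ℕ.< m → ∀ i → i ℤ.≤ N → C ≤w[ i ] coeff (h k) i
    left-below C zero    = 0ℤ , λ _ ()
    left-below C (suc m) = N ℤ.⊓ N′ , bound
      where
      N N′ : ℤ
      N  = proj₁ (left-below C m)
      N′ = proj₁ (lim-∞ (h m) C)
      bound : ∀ k → k ℕ.< suc m → ∀ i → i ℤ.≤ N ℤ.⊓ N′ → C ≤w[ i ] coeff (h k) i
      bound k k<1+m i i≤ with ℕ.m≤n⇒m<n∨m≡n (ℕ.s≤s⁻¹ k<1+m)
      ... | inj₁ k<m  = proj₂ (left-below C m) k k<m i (ℤ.≤-trans i≤ (ℤ.i⊓j≤i N N′))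
      ... | inj₂ refl = proj₂ (lim-∞ (h m) C) i (ℤ.≤-trans i≤ (ℤ.i⊓j≤j N N′))

    left : ∀ C → ∃[ N ] ∀ k i → i ℤ.≤ N → C ≤w[ i ] coeff (h k) i
    left C = N , bound
      where
      M = proj₁ (large C)
      N = proj₁ (left-below C M)
      bound : ∀ k i → i ℤ.≤ N → C ≤w[ i ] coeff (h k) i
      bound k i i≤N with ℕ.<-≤-connex k M
      ... | inj₁ k<M = proj₂ (left-below C M) k k<M i i≤N
      ... | inj₂ M≤k = proj₂ (large C) k M≤k i

  OrderAtLeast : ℕ → ℰ → Set ℓ
  OrderAtLeast k f = ∀ i → i ℤ.< + k → coeff f i ≈ 0#

  orderAtLeast-· : ∀ f g {k} → OrderAtLeast 1 f → OrderAtLeast k g → OrderAtLeast (suc k) (f · g)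
  orderAtLeast-· f g {k} p r n n<1+k = coeff-·-zero f g n λ i → pick i (<-≤-connex i 1ℤ)
    where
    shift : ∀ i → 1ℤ ℤ.≤ i → n ℤ.- i ℤ.< + k
    shift i 1≤i = ℤ.<-≤-trans (ℤ.+-mono-<-≤ n<1+k (ℤ.neg-mono-≤ 1≤i)) (ℤ.≤-reflexive (pred-suc k))
      where
      pred-suc : ∀ k → + suc k ℤ.+ ℤ.- 1ℤ ≡ + k
      pred-suc k = refl
    pick : ∀ i → i ℤ.< 1ℤ ⊎ 1ℤ ℤ.≤ i → term f g n i ≈ 0#
    pick i (inj₁ i<1) = K.trans (K.*-congʳ (p i i<1)) (K.zeroˡ _)
    pick i (inj₂ 1≤i) = K.trans (K.*-congˡ (r (n ℤ.- i) (shift i 1≤i))) (K.zeroʳ _)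

  1-holomorphic : Holomorphic 1ᴱ
  1-holomorphic i i<0 = coeff-monomial-≢ 1# 0ℤ (ℤ.<⇒≢ i<0)

  module GeometricSeries (t : ℰ) where

    powers : ℕ → ℰ
    powers = iterate ((-ᴱ t) ·_) 1ᴱ

    module Solution (null : Null powers) where
      open FixedPoint {(-ᴱ t) ·_} (·-continuousˡ (-ᴱ t)) {1ᴱ} null public

      inverse-1+t : (1ᴱ +ᴱ t) · solution ≈ᴱ 1ᴱ
      inverse-1+t = fixed-point⇒inverse t solution solves

  module _ (p : ℰ) (0≤p : 0ℤ ≤ᴱ p) (order≥1 : OrderAtLeast 1 p) where

    open GeometricSeries p

    powers-order : ∀ k → OrderAtLeast k (powers k)
    powers-order zero    = 1-holomorphic
    powers-order (suc k) = orderAtLeast-· (-ᴱ p) (powers k)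
      (λ i i<1 → K.trans (K.-‿cong (order≥1 i i<1)) (RingProperties.-0#≈0# K.ring)) (powers-order k)

    0≤powers : ∀ k → 0ℤ ≤ᴱ powers k
    0≤powers zero    = 0≤ᴱ1
    0≤powers (suc k) = ≤ᴱ-· (-ᴱ p) (powers k) (≤ᴱ-neg p 0≤p) (0≤powers k)

    -- The weights of the powers need not grow. Their u-adic orders do, so each coefficient is
    -- eventually 0.
    unipotent-null : Null powers
    unipotent-null = record
      { tame = record
        { lower = q 0ℤ , 0≤powers
        -- No power has a term of negative degree, so the threshold -1 serves every C.
        ; left = λ C → -[1+ 0 ] , λ k i i≤-1 →
            ≤w-cong (K.sym (powers-order k i (ℤ.≤-<-trans i≤-1 ℤ.-<+))) (≤w-0 i) }
      ; vanish = λ i C → suc ℤ.∣ i ∣ , λ k i<k → ≤w-cong (K.sym (powers-order k i (below i i<k))) (≤w-0 i) }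
      where
      below : ∀ i {k} → ℤ.∣ i ∣ ℕ.< k → i ℤ.< + k
      below (+ _)    i<k = ℤ.+<+ i<k
      below -[1+ _ ] _   = ℤ.-<+

    -- Holomorphy of r is recorded because the quotient in Weierstrass division is r times a
    -- holomorphic series.
    unipotent-inverse : ∃[ r ] (1ᴱ +ᴱ p) · r ≈ᴱ 1ᴱ × 0ℤ ≤ᴱ r × Holomorphic r
    unipotent-inverse = solution , inverse-1+t
      , (λ i → ≤w-solution i λ k → 0≤powers k i)
      , (λ i i<0 → ≤w-all⇒≈0 i λ C → ≤w-solution i λ k →
          ≤w-cong (K.sym (powers-order k i (ℤ.<-≤-trans i<0 (ℤ.+≤+ ℕ.z≤n)))) (≤w-0 i))
      where open Solution unipotent-null

  module _ (t : ℰ) (1≤t : 1ℤ ≤ᴱ t) where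

    open GeometricSeries t

    powers-growth : ∀ k → 0ℤ ℤ.+ + k ≤ᴱ powers k
    powers-growth zero    = 0≤ᴱ1
    powers-growth (suc k) = ≤ᴱ-· (-ᴱ t) (powers k) (≤ᴱ-neg t 1≤t) (powers-growth k)

    contracting-inverse : ∃[ r ] (1ᴱ +ᴱ t) · r ≈ᴱ 1ᴱ × 0ℤ ≤ᴱ r
    contracting-inverse = solution , inverse-1+t , λ i → ≤w-solution i λ k →
        ≤ᴱ-weaken (powers k) (ℤ.+≤+ ℕ.z≤n) (powers-growth k) i
      where open Solution (growth⇒null powers 0ℤ powers-growth)

  -- Normalised by its leading term, a series is 1 + p + s with p supported in
  -- positive degrees and s of positive Gauss valuation in negative degrees.
  module Normalised (f : ℰ) (L : Leading f) where
    open Leading L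

    x y : Carrier
    x = coeff f index
    y = proj₁ (inverse x leading≉0)

    xy≈1 : x K.* y ≈ 1#
    xy≈1 = proj₂ (inverse x leading≉0)

    m : ℰ
    m = monomial y (ℤ.- index)

    -- `m` inverts the leading term, so its value and exponent change sign and with them the weight.
    -order≤m : ℤ.- order ≤ᴱ m
    -order≤m = ≤ᴱ-monomial y (ℤ.- index) (≤weight⇒≤w (ℤ.- index) y λ n vy≡n →
      ℤ.≤-reflexive (≡.trans (≡.cong ℤ.-_ order≡) (≡.trans (neg-weight (↧ ν) value (↥ ν) index)
        (≡.cong (λ n → weight n (ℤ.- index)) ([]-injective (≡.trans (≡.sym (v-inverse v-leading xy≈1)) vy≡n))))))
      where
      neg-weight : ∀ a n b i → ℤ.- (a ℤ.* n ℤ.+ b ℤ.* i) ≡ a ℤ.* (ℤ.- n) ℤ.+ b ℤ.* (ℤ.- i)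
      neg-weight = solve-∀

    coeff-m· : ∀ g k → coeff (m · g) k ≈ y K.* coeff g (k ℤ.- ℤ.- index)
    coeff-m· = coeff-monomial-· y (ℤ.- index)

    g p s : ℰ
    g = m · f
    p = restrict (0ℤ ℤ.<?_) g
    s = restrict (ℤ._<? 0ℤ) g

    0≤g : 0ℤ ≤ᴱ g
    0≤g = ≡.subst (_≤ᴱ g) (ℤ.+-inverseˡ order) (≤ᴱ-· m f -order≤m order≤)

    -- Multiplication by `m` moves the leading exponent to 0, and `order<` supplies an extra unit of
    -- weight at every exponent before it.
    1≤g : ∀ k → k ℤ.< 0ℤ → q 1ℤ ≤w[ k ] coeff g k
    1≤g k k<0 = ≤w-cong (K.sym (coeff-m· f k))
      (≡.subst (_≤w[ k ] y K.* coeff f (k ℤ.- ℤ.- index)) (≡.sym (≡.trans (≡.cong q (1≡ order)) (q-+ _ _)))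
        (≤w-*-at (≤w-cong (coeff-monomial-≡ y (ℤ.- index)) (-order≤m (ℤ.- index)))
                 (order< (k ℤ.- ℤ.- index) below)))
      where
      1≡ : ∀ z → 1ℤ ≡ ℤ.- z ℤ.+ (1ℤ ℤ.+ z)
      1≡ = solve-∀
      below : k ℤ.- ℤ.- index ℤ.< index
      below = ≡.subst₂ ℤ._<_ (≡.cong (λ t → k ℤ.+ t) (≡.sym (ℤ.neg-involutive index))) (ℤ.+-identityˡ index)
        (ℤ.+-monoˡ-< index k<0)

    g₀≈1 : coeff g 0ℤ ≈ 1#
    g₀≈1 = begin
      coeff g 0ℤ                          ≈⟨ coeff-m· f 0ℤ ⟩
      y K.* coeff f (0ℤ ℤ.- ℤ.- index)    ≡⟨ ≡.cong (λ i → y K.* coeff f i) (≡.trans (ℤ.+-identityˡ _) (ℤ.neg-involutive index)) ⟩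
      y K.* x                             ≈⟨ K.trans (K.*-comm y x) xy≈1 ⟩
      1#                                  ∎

    g≈1+p+s : g ≈ᴱ (1ᴱ +ᴱ p) +ᴱ s
    g≈1+p+s k with ℤ.<-cmp k 0ℤ
    ... | tri< k<0 k≢0 k≯0 = K.sym (K.trans (K.+-cong
      (K.trans (K.+-cong (coeff-monomial-≢ 1# 0ℤ k≢0) (restrict-outside (0ℤ ℤ.<?_) g k≯0)) (K.+-identityʳ 0#))
      (restrict-inside (ℤ._<? 0ℤ) g k<0)) (K.+-identityˡ _))
    ... | tri≈ k≮0 refl k≯0 = K.sym (K.trans (K.+-cong
      (K.trans (K.+-cong (K.trans (coeff-monomial-≡ 1# 0ℤ) (K.sym g₀≈1)) (restrict-outside (0ℤ ℤ.<?_) g k≯0)) (K.+-identityʳ _))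
      (restrict-outside (ℤ._<? 0ℤ) g k≮0)) (K.+-identityʳ _))
    ... | tri> k≮0 k≢0 0<k = K.sym (K.trans (K.+-cong
      (K.trans (K.+-cong (coeff-monomial-≢ 1# 0ℤ k≢0) (restrict-inside (0ℤ ℤ.<?_) g 0<k)) (K.+-identityˡ _))
      (restrict-outside (ℤ._<? 0ℤ) g k≮0)) (K.+-identityʳ _))

    1≤s : 1ℤ ≤ᴱ s
    1≤s k = bound (k ℤ.<? 0ℤ)
      where
      bound : Dec (k ℤ.< 0ℤ) → q 1ℤ ≤w[ k ] coeff s k
      bound (yes k<0) = ≤w-restrict (ℤ._<? 0ℤ) g (1≤g k k<0)
      bound (no k≮0)  = ≤w-cong (K.sym (restrict-outside (ℤ._<? 0ℤ) g k≮0)) (≤w-0 k)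

    p-order : OrderAtLeast 1 p
    p-order i i<1 = restrict-outside (0ℤ ℤ.<?_) g λ 0<i → ℤ.<⇒≱ i<1 (ℤ.i<j⇒suc[i]≤j 0<i)

    p-unit : ∃[ r ] (1ᴱ +ᴱ p) · r ≈ᴱ 1ᴱ × 0ℤ ≤ᴱ r × Holomorphic r
    p-unit = unipotent-inverse p (λ i → ≤w-restrict (0ℤ ℤ.<?_) g (0≤g i)) p-order

    r t : ℰ
    r = proj₁ p-unit
    t = r · s

    r-inverse : (1ᴱ +ᴱ p) · r ≈ᴱ 1ᴱ
    r-inverse = proj₁ (proj₂ p-unit)

    0≤r : 0ℤ ≤ᴱ r
    0≤r = proj₁ (proj₂ (proj₂ p-unit))

    r-holomorphic : Holomorphic r
    r-holomorphic = proj₂ (proj₂ (proj₂ p-unit))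

    1≤t : 1ℤ ≤ᴱ t
    1≤t = ≤ᴱ-· r s 0≤r 1≤s

    -- Besides inverting f, the lower bound -order shows that the quotient of y by f is integral
    -- whenever the order of y is at least that of f.
    inverseᴱ : ∃[ h ] f · h ≈ᴱ 1ᴱ × ℤ.- order ≤ᴱ h
    inverseᴱ = let (r′ , r′-inverse , 0≤r′) = contracting-inverse t 1≤t in
      m · (r · r′)
      , factor-inverse {f} {m} {p} {s} {r} g≈1+p+s r-inverse {r′} r′-inverse
      , ≡.subst (_≤ᴱ m · (r · r′)) (ℤ.+-identityʳ (ℤ.- order))
          (≤ᴱ-· m (r · r′) -order≤m (≤ᴱ-· r r′ 0≤r 0≤r′))

-- Subrings and principal ideals.

module Subrings {c ℓ} (E : CommutativeRing c ℓ) where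
  open CommutativeRing E hiding (zero) renaming (refl to ≈-refl)

  record IsSubring {a} (A : Pred Carrier a) : Set (a ⊔ c ⊔ ℓ) where
    field
      resp : ∀ {x y} → x ≈ y → x ∈ A → y ∈ A
      0∈   : 0# ∈ A
      1∈   : 1# ∈ A
      +∈   : ∀ {x y} → x ∈ A → y ∈ A → x + y ∈ A
      neg∈ : ∀ {x} → x ∈ A → - x ∈ A
      *∈   : ∀ {x y} → x ∈ A → y ∈ A → x * y ∈ A

  -- Ideals enter through the single operation y - a x, the step of division with remainder.
  record IsPrincipal {a} (A : Pred Carrier a) : Set (a ⊔ Level.suc (c ⊔ ℓ)) where
    field
      generator : ∀ (J : Pred Carrier (c ⊔ ℓ)) → J ⊆ A →
        (∀ {a x y} → a ∈ A → x ∈ J → y ∈ J → y - a * x ∈ J) →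
        ∀ {x} → x ∈ J → ¬ x ≈ 0# →
        ∃[ g ] g ∈ J × ¬ g ≈ 0# × (∀ {y} → y ∈ J → ∃[ a ] a ∈ A × y ≈ a * g)

  U-isSubring : IsSubring U
  U-isSubring = record { resp = λ _ _ → _ ; 0∈ = _ ; 1∈ = _ ; +∈ = λ _ _ → _ ; neg∈ = λ _ → _ ; *∈ = λ _ _ → _ }

  ∩-isSubring : ∀ {a b} {A : Pred Carrier a} {B : Pred Carrier b} →
                IsSubring A → IsSubring B → IsSubring (A ∩ B)
  ∩-isSubring A B = record
    { resp = λ x≈y (p , q) → A.resp x≈y p , B.resp x≈y q
    ; 0∈   = A.0∈ , B.0∈
    ; 1∈   = A.1∈ , B.1∈
    ; +∈   = λ (p , q) (p′ , q′) → A.+∈ p p′ , B.+∈ q q′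
    ; neg∈ = λ (p , q) → A.neg∈ p , B.neg∈ q
    ; *∈   = λ (p , q) (p′ , q′) → A.*∈ p p′ , B.*∈ q q′ }
    where
    module A = IsSubring A
    module B = IsSubring B

-- Submodules, spans and bases over subrings.

module Vectors {c ℓ} (E : CommutativeRing c ℓ) (I : Set) where
  open CommutativeRing E hiding (zero) renaming (refl to ≈-refl)
  open Subrings E

  V : Set c
  V = I → Carrier

  infix  4 _≈ᵛ_
  infixl 6 _+ᵛ_
  infixr 7 _•_

  _≈ᵛ_ : V → V → Set ℓ
  x ≈ᵛ y = ∀ i → x i ≈ y i

  0ᵛ : V
  0ᵛ _ = 0#

  _+ᵛ_ : V → V → V
  (x +ᵛ y) i = x i + y i

  _•_ : Carrier → V → V
  (f • x) i = f * x i

  record IsSubmodule {a n} (A : Pred Carrier a) (N : Pred V n) : Set (a ⊔ n ⊔ c ⊔ ℓ) where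
    field
      resp : ∀ {x y} → x ≈ᵛ y → x ∈ N → y ∈ N
      0∈   : 0ᵛ ∈ N
      +∈   : ∀ {x y} → x ∈ N → y ∈ N → x +ᵛ y ∈ N
      •∈   : ∀ {f x} → f ∈ A → x ∈ N → f • x ∈ N

  ∩-isSubmodule : ∀ {a m n} {A : Pred Carrier a} {M : Pred V m} {N : Pred V n} →
                  IsSubmodule A M → IsSubmodule A N → IsSubmodule A (M ∩ N)
  ∩-isSubmodule M N = record
    { resp = λ x≈y (p , q) → M.resp x≈y p , N.resp x≈y q
    ; 0∈   = M.0∈ , N.0∈
    ; +∈   = λ (p , q) (p′ , q′) → M.+∈ p p′ , N.+∈ q q′
    ; •∈   = λ f∈ (p , q) → M.•∈ f∈ p , N.•∈ f∈ q }
    where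
    module M = IsSubmodule M
    module N = IsSubmodule N

  restrict-scalars : ∀ {a b n} {A : Pred Carrier a} {B : Pred Carrier b} {N : Pred V n} →
                     B ⊆ A → IsSubmodule A N → IsSubmodule B N
  restrict-scalars B⊆A N = record
    { resp = N.resp ; 0∈ = N.0∈ ; +∈ = N.+∈ ; •∈ = λ f∈B → N.•∈ (B⊆A f∈B) }
    where module N = IsSubmodule N

  -- An inductive form of the span, so that statements about linear combinations are proved term by
  -- term.
  data Span {a m} (A : Pred Carrier a) (M : Pred V m) : Pred V (a ⊔ m ⊔ c ⊔ ℓ) where
    none : ∀ {x} → x ≈ᵛ 0ᵛ → x ∈ Span A M
    more : ∀ {x f m y} → f ∈ A → m ∈ M → y ∈ Span A M → x ≈ᵛ f • m +ᵛ y → x ∈ Span A M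

  span-resp : ∀ {a m} {A : Pred Carrier a} {M : Pred V m} {x y} →
              x ≈ᵛ y → x ∈ Span A M → y ∈ Span A M
  span-resp x≈y (none x≈0)         = none λ i → trans (sym (x≈y i)) (x≈0 i)
  span-resp x≈y (more f∈ m∈ y∈ x≈) = more f∈ m∈ y∈ λ i → trans (sym (x≈y i)) (x≈ i)

  span-+ : ∀ {a m} {A : Pred Carrier a} {M : Pred V m} {x y} →
           x ∈ Span A M → y ∈ Span A M → x +ᵛ y ∈ Span A M
  span-+ (none x≈0) y∈ = span-resp (λ i → sym (trans (+-congʳ (x≈0 i)) (+-identityˡ _))) y∈
  span-+ (more f∈ m∈ x′∈ x≈) y∈ = more f∈ m∈ (span-+ x′∈ y∈) λ i →
    trans (+-congʳ (x≈ i)) (+-assoc _ _ _)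

  span-isSubmodule : ∀ {a m} {A : Pred Carrier a} (M : Pred V m) →
                     IsSubring A → IsSubmodule A (Span A M)
  span-isSubmodule {A = A} M isSubring = record
    { resp = span-resp ; 0∈ = none (λ _ → ≈-refl) ; +∈ = span-+ ; •∈ = span-• }
    where
    span-• : ∀ {f x} → f ∈ A → x ∈ Span A M → f • x ∈ Span A M
    span-• f∈ (none x≈0) = none λ i → trans (*-congˡ (x≈0 i)) (zeroʳ _)
    span-• f∈ (more g∈ m∈ y∈ x≈) = more (IsSubring.*∈ isSubring f∈ g∈) m∈ (span-• f∈ y∈) λ i →
      trans (*-congˡ (x≈ i)) (trans (distribˡ _ _ _) (+-congʳ (sym (*-assoc _ _ _))))

  ⊆span : ∀ {a m} {A : Pred Carrier a} {M : Pred V m} → IsSubring A → M ⊆ Span A M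
  ⊆span A m∈ = more (IsSubring.1∈ A) m∈ (none λ _ → ≈-refl) λ i →
    sym (trans (+-identityʳ _) (*-identityˡ _))

  -- Scalars are required on generators only; there an exponent or a decomposition can be read off
  -- from the scalar.
  span-elim : ∀ {a m n} {A : Pred Carrier a} {M : Pred V m} (N : Pred V n) →
    (∀ {x y} → x ≈ᵛ y → x ∈ N → y ∈ N) → 0ᵛ ∈ N → (∀ {x y} → x ∈ N → y ∈ N → x +ᵛ y ∈ N) →
    (∀ {f m} → f ∈ A → m ∈ M → f • m ∈ N) → Span A M ⊆ N
  span-elim N resp 0∈ +∈ gen (none x≈0) = resp (λ i → sym (x≈0 i)) 0∈
  span-elim N resp 0∈ +∈ gen (more f∈ m∈ y∈ x≈) =
    resp (λ i → sym (x≈ i)) (+∈ (gen f∈ m∈) (span-elim N resp 0∈ +∈ gen y∈))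

  span⊆ : ∀ {a m n} {A : Pred Carrier a} {M : Pred V m} {N : Pred V n} →
          IsSubmodule A N → M ⊆ N → Span A M ⊆ N
  span⊆ {N = N} N-sub M⊆N = span-elim N N.resp N.0∈ N.+∈ λ f∈ m∈ → N.•∈ f∈ (M⊆N m∈)
    where module N = IsSubmodule N-sub

  record IsLinear (φ : V → Carrier) : Set (c ⊔ ℓ) where
    field
      φ-cong : ∀ {x y} → x ≈ᵛ y → φ x ≈ φ y
      φ-+    : ∀ x y → φ (x +ᵛ y) ≈ φ x + φ y
      φ-•    : ∀ f x → φ (f • x) ≈ f * φ x

    φ-0 : φ 0ᵛ ≈ 0#
    φ-0 = trans (φ-cong λ _ → sym (zeroˡ 0#)) (trans (φ-• 0# 0ᵛ) (zeroˡ _))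

    kernel-isSubmodule : ∀ {a} {A : Pred Carrier a} → IsSubmodule A (λ x → φ x ≈ 0#)
    kernel-isSubmodule = record
      { resp = λ x≈y φx≈0 → trans (sym (φ-cong x≈y)) φx≈0
      ; 0∈   = φ-0
      ; +∈   = λ p q → trans (φ-+ _ _) (trans (+-cong p q) (+-identityʳ 0#))
      ; •∈   = λ _ p → trans (φ-• _ _) (trans (*-congˡ p) (zeroʳ _)) }

  coordinate-isLinear : ∀ i → IsLinear (λ x → x i)
  coordinate-isLinear i = record
    { φ-cong = λ x≈y → x≈y i ; φ-+ = λ _ _ → ≈-refl ; φ-• = λ _ _ → ≈-refl }

  combination : ∀ {n} → (Fin n → Carrier) → (Fin n → V) → V
  combination {zero}  f x = 0ᵛ
  combination {suc n} f x = f zero • x zero +ᵛ combination (f ∘ suc) (x ∘ suc)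

  combination-∈ : ∀ {a m n} {A : Pred Carrier a} {N : Pred V m} → IsSubmodule A N →
    (f : Fin n → Carrier) (x : Fin n → V) → (∀ k → f k ∈ A) → (∀ k → x k ∈ N) →
    combination f x ∈ N
  combination-∈ {n = zero}  N f x f∈ x∈ = IsSubmodule.0∈ N
  combination-∈ {n = suc n} N f x f∈ x∈ = IsSubmodule.+∈ N (IsSubmodule.•∈ N (f∈ zero) (x∈ zero))
    (combination-∈ N (f ∘ suc) (x ∘ suc) (f∈ ∘ suc) (x∈ ∘ suc))

  combination⇒span : ∀ {a m n} {A : Pred Carrier a} {M : Pred V m} (f : Fin n → Carrier) (x : Fin n → V) →
    (∀ k → f k ∈ A) → (∀ k → x k ∈ M) → combination f x ∈ Span A M
  combination⇒span {n = zero}  f x f∈ x∈ = none λ _ → ≈-refl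
  combination⇒span {n = suc n} f x f∈ x∈ = more (f∈ zero) (x∈ zero)
    (combination⇒span (f ∘ suc) (x ∘ suc) (f∈ ∘ suc) (x∈ ∘ suc)) λ _ → ≈-refl

  span⇒combination : ∀ {a m} {A : Pred Carrier a} {M : Pred V m} {x} → x ∈ Span A M →
    ∃[ n ] Σ[ f ∈ (Fin n → Carrier) ] Σ[ y ∈ (Fin n → V) ]
      (∀ k → f k ∈ A) × (∀ k → y k ∈ M) × x ≈ᵛ combination f y
  span⇒combination (none x≈0) = 0 , (λ ()) , (λ ()) , (λ ()) , (λ ()) , x≈0
  span⇒combination (more {f = f} {m} f∈ m∈ z∈ x≈) =
    let (n , g , y , g∈ , y∈ , z≈) = span⇒combination z∈ in
    suc n , (λ { zero → f ; (suc k) → g k }) , (λ { zero → m ; (suc k) → y k })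
    , (λ { zero → f∈ ; (suc k) → g∈ k }) , (λ { zero → m∈ ; (suc k) → y∈ k })
    , λ i → trans (x≈ i) (+-congˡ (z≈ i))

  combination-• : ∀ {n} g (f : Fin n → Carrier) (x : Fin n → V) →
    g • combination f x ≈ᵛ combination (λ k → g * f k) x
  combination-• {zero}  g f x i = zeroʳ g
  combination-• {suc n} g f x i = trans (distribˡ g _ _)
    (+-cong (sym (*-assoc g _ _)) (combination-• g (f ∘ suc) (x ∘ suc) i))

  combination-•ʳ : ∀ {n} g (f : Fin n → Carrier) (x : Fin n → V) →
    g • combination f x ≈ᵛ combination f (λ k → g • x k)
  combination-•ʳ {zero}  g f x i = zeroʳ g
  combination-•ʳ {suc n} g f x i = trans (distribˡ g _ _) (+-cong
    (trans (sym (*-assoc g _ _)) (trans (*-congʳ (*-comm g _)) (*-assoc _ g _)))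
    (combination-•ʳ g (f ∘ suc) (x ∘ suc) i))

  module _ {φ : V → Carrier} (linear : IsLinear φ) where
    open IsLinear linear

    φ-combination-0 : ∀ {n} (f : Fin n → Carrier) (x : Fin n → V) →
      (∀ k → φ (x k) ≈ 0#) → φ (combination f x) ≈ 0#
    φ-combination-0 {zero}  f x h = φ-0
    φ-combination-0 {suc n} f x h = trans (φ-+ _ _) (trans
      (+-cong (trans (φ-• _ _) (trans (*-congˡ (h zero)) (zeroʳ _))) (φ-combination-0 (f ∘ suc) (x ∘ suc) (h ∘ suc)))
      (+-identityʳ 0#))

    φ-combination : ∀ {n} (f : Fin n → Carrier) (x : Fin n → V) k →
      φ (x k) ≈ 1# → (∀ l → l ≢ k → φ (x l) ≈ 0#) → φ (combination f x) ≈ f k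
    φ-combination {suc n} f x zero h1 h0 = trans (φ-+ _ _) (trans
      (+-cong (trans (φ-• _ _) (trans (*-congˡ h1) (*-identityʳ _)))
        (φ-combination-0 (f ∘ suc) (x ∘ suc) λ k → h0 (suc k) λ ()))
      (+-identityʳ _))
    φ-combination {suc n} f x (suc k) h1 h0 = trans (φ-+ _ _) (trans
      (+-cong (trans (φ-• _ _) (trans (*-congˡ (h0 zero λ ())) (zeroʳ _)))
        (φ-combination (f ∘ suc) (x ∘ suc) k h1 λ l l≢k → h0 (suc l) λ { refl → l≢k refl }))
      (+-identityˡ _))

  -- The coordinates are E-linear forms on the whole space which are A-valued on N. Duality then
  -- makes the vectors independent over E as well as over A.
  record Basis {a n} (A : Pred Carrier a) (N : Pred V n) : Set (a ⊔ n ⊔ c ⊔ ℓ) where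
    field
      rank        : ℕ
      vector      : Fin rank → V
      dual        : Fin rank → V → Carrier
      dual-linear : ∀ k → IsLinear (dual k)
      vector∈     : ∀ k → vector k ∈ N
      dual∈       : ∀ k {x} → x ∈ N → dual k x ∈ A
      dual-≡      : ∀ k → dual k (vector k) ≈ 1#
      dual-≢      : ∀ {k l} → l ≢ k → dual k (vector l) ≈ 0#
      expand      : ∀ {x} → x ∈ N → x ≈ᵛ combination (λ k → dual k x) vector

-- Bases over principal subrings of a field, and flatness of kernels.

module FieldVectors (em : ∀ {a} → ExcludedMiddle a) {c ℓ} (E : CommutativeRing c ℓ)
  (invert : ∀ x → ¬ CommutativeRing._≈_ E x (CommutativeRing.0# E) →
            ∃[ y ] CommutativeRing._≈_ E (CommutativeRing._*_ E x y) (CommutativeRing.1# E))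
  (I : Set) where

  open CommutativeRing E hiding (zero) renaming (refl to ≈-refl)
  open Subrings E
  open RingIdentities E
  open Vectors E I
  open RingProperties ring using (-‿distribˡ-*; -‿distribʳ-*; -0#≈0#)
  open import Relation.Binary.Reasoning.Setoid setoid

  subtract∈ : ∀ {a n} {A : Pred Carrier a} {N : Pred V n} → IsSubring A → IsSubmodule A N →
              ∀ {f x y} → f ∈ A → x ∈ N → y ∈ N → (λ i → y i - f * x i) ∈ N
  subtract∈ A N {f} f∈ x∈ y∈ = IsSubmodule.resp N
    (λ i → +-congˡ (sym (-‿distribˡ-* f _)))
    (IsSubmodule.+∈ N y∈ (IsSubmodule.•∈ N (IsSubring.neg∈ A f∈) x∈))

  subtract-linear : ∀ {φ} → IsLinear φ → ∀ f x y → φ (λ i → y i - f * x i) ≈ φ y - f * φ x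
  subtract-linear {φ} linear f x y = begin
    φ (λ i → y i - f * x i)     ≈⟨ φ-cong (λ i → +-congˡ (-‿distribˡ-* f (x i))) ⟩
    φ (y +ᵛ (- f) • x)          ≈⟨ φ-+ y _ ⟩
    φ y + φ ((- f) • x)         ≈⟨ +-congˡ (φ-• (- f) x) ⟩
    φ y + (- f) * φ x           ≈⟨ +-congˡ (-‿distribˡ-* f (φ x)) ⟨
    φ y - f * φ x               ∎
    where open IsLinear linear

  scale-linear : ∀ {φ} g → IsLinear φ → IsLinear (λ x → g * φ x)
  scale-linear g linear = record
    { φ-cong = λ x≈y → *-congˡ (L.φ-cong x≈y)
    ; φ-+ = λ x y → trans (*-congˡ (L.φ-+ x y)) (distribˡ _ _ _)
    ; φ-• = λ f x → trans (*-congˡ (L.φ-• f x)) (trans (sym (*-assoc g f _))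
        (trans (*-congʳ (*-comm g f)) (*-assoc f g _))) }
    where module L = IsLinear linear

  module Projection {φ : V → Carrier} (φ-linear : IsLinear φ) (b : V) where
    open IsLinear φ-linear

    project : V → V
    project x i = x i - φ x * b i

    project-cong : ∀ {x y} → x ≈ᵛ y → project x ≈ᵛ project y
    project-cong x≈y i = +-cong (x≈y i) (-‿cong (*-congʳ (φ-cong x≈y)))

    project-+ : ∀ x y → project (x +ᵛ y) ≈ᵛ project x +ᵛ project y
    project-+ x y i = begin
      (x i + y i) - φ (x +ᵛ y) * b i                ≈⟨ +-congˡ (-‿cong (trans (*-congʳ (φ-+ x y)) (distribʳ _ _ _))) ⟩
      (x i + y i) - (φ x * b i + φ y * b i)         ≈⟨ difference-+ _ _ _ _ ⟨
      project x i + project y i                     ∎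

    project-• : ∀ f x → project (f • x) ≈ᵛ f • project x
    project-• f x i = begin
      f * x i - φ (f • x) * b i       ≈⟨ +-congˡ (-‿cong (trans (*-congʳ (φ-• f x)) (*-assoc f _ _))) ⟩
      f * x i - f * (φ x * b i)       ≈⟨ +-congˡ (-‿distribʳ-* f _) ⟩
      f * x i + f * - (φ x * b i)     ≈⟨ distribˡ f _ _ ⟨
      f * project x i                 ∎

    project-kernel : ∀ {x} → φ x ≈ 0# → project x ≈ᵛ x
    project-kernel φx≈0 i =
      trans (+-congˡ (trans (-‿cong (trans (*-congʳ φx≈0) (zeroˡ _))) -0#≈0#)) (+-identityʳ _)

    project-linear : ∀ {ψ} → IsLinear ψ → IsLinear (ψ ∘ project)
    project-linear linear = record
      { φ-cong = λ x≈y → L.φ-cong (project-cong x≈y)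
      ; φ-+ = λ x y → trans (L.φ-cong (project-+ x y)) (L.φ-+ (project x) (project y))
      ; φ-• = λ f x → trans (L.φ-cong (project-• f x)) (L.φ-• f (project x)) }
      where module L = IsLinear linear

  module _ {a} {A : Pred Carrier a} (isSubring : IsSubring A) (isPrincipal : IsPrincipal A) where

    -- Induction on the number of forms that separate N. A first form vanishing on N is dropped.
    -- Otherwise its values on N have a generator g, taken at some b; g⁻¹ times the form is A-valued
    -- on N and splits off A b, and its kernel in N is separated by the remaining forms.
    basis : ∀ {r} (t : Fin r → V → Carrier) → (∀ k → IsLinear (t k)) →
      (N : Pred V (c ⊔ ℓ)) → IsSubmodule A N → (∀ k {x} → x ∈ N → t k x ∈ A) →
      (∀ {x} → x ∈ N → (∀ k → t k x ≈ 0#) → x ≈ᵛ 0ᵛ) → Basis A N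
    basis {zero} t t-linear N N-sub t∈ separates = record
      { rank = 0 ; vector = λ () ; dual = λ () ; dual-linear = λ () ; vector∈ = λ () ; dual∈ = λ ()
      ; dual-≡ = λ () ; dual-≢ = λ { {()} } ; expand = λ x∈ → separates x∈ λ () }
    basis {suc r} t t-linear N N-sub t∈ separates with em {P = ∃[ x ] x ∈ N × ¬ t zero x ≈ 0#}
    ... | no t₀-vanishes = basis (t ∘ suc) (t-linear ∘ suc) N N-sub (t∈ ∘ suc)
      λ x∈ h → separates x∈ λ { zero → t₀≈0 x∈ ; (suc k) → h k }
      where
      t₀≈0 : ∀ {x} → x ∈ N → t zero x ≈ 0#
      t₀≈0 {x} x∈ with em {P = t zero x ≈ 0#}
      ... | yes t₀x≈0 = t₀x≈0
      ... | no t₀x≉0  = contradiction (x , x∈ , t₀x≉0) t₀-vanishes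
    ... | yes (x₀ , x₀∈ , t₀x₀≉0) = record
      { rank        = suc R.rank
      ; vector      = vector
      ; dual        = dual
      ; dual-linear = λ { zero → φ₀-linear ; (suc k) → project-linear (R.dual-linear k) }
      ; vector∈     = λ { zero → b∈ ; (suc k) → proj₁ (R.vector∈ k) }
      ; dual∈       = λ { zero x∈ → φ₀∈ x∈ ; (suc k) x∈ → R.dual∈ k (project∈ x∈) }
      ; dual-≡      = λ { zero → φ₀b≈1 ; (suc k) →
          trans (IsLinear.φ-cong (R.dual-linear k) (project-kernel (φ₀-kernel (proj₂ (R.vector∈ k))))) (R.dual-≡ k) }
      ; dual-≢      = dual-≢
      ; expand      = λ {x} x∈ i → begin
          x i                                       ≈⟨ [x-y]+y≈x (x i) (φ₀ x * b i) ⟨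
          project x i + φ₀ x * b i                  ≈⟨ +-comm _ _ ⟩
          φ₀ x * b i + project x i                  ≈⟨ +-congˡ (R.expand (project∈ x∈) i) ⟩
          φ₀ x * b i + combination (λ k → R.dual k (project x)) R.vector i ∎ }
      where
      J : Pred Carrier (c ⊔ ℓ)
      J y = ∃[ x ] x ∈ N × y ≈ t zero x

      module t₀ = IsLinear (t-linear zero)

      principal : ∃[ g ] g ∈ J × ¬ g ≈ 0# × (∀ {y} → y ∈ J → ∃[ a ] a ∈ A × y ≈ a * g)
      principal = IsPrincipal.generator isPrincipal J
        (λ (x , x∈ , y≈) → IsSubring.resp isSubring (sym y≈) (t∈ zero x∈))
        (λ { {a} a∈ (x , x∈ , u≈) (y , y∈ , w≈) → (λ i → y i - a * x i)
           , subtract∈ isSubring N-sub a∈ x∈ y∈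
           , trans (+-cong w≈ (-‿cong (*-congˡ u≈))) (sym (subtract-linear (t-linear zero) a x y)) })
        (x₀ , x₀∈ , ≈-refl) t₀x₀≉0

      g : Carrier
      g = proj₁ principal
      b : V
      b = proj₁ (proj₁ (proj₂ principal))
      b∈ : b ∈ N
      b∈ = proj₁ (proj₂ (proj₁ (proj₂ principal)))
      g≈ : g ≈ t zero b
      g≈ = proj₂ (proj₂ (proj₁ (proj₂ principal)))
      g≉0 : ¬ g ≈ 0#
      g≉0 = proj₁ (proj₂ (proj₂ principal))
      g⁻¹ : Carrier
      g⁻¹ = proj₁ (invert g g≉0)
      gg⁻¹≈1 : g * g⁻¹ ≈ 1#
      gg⁻¹≈1 = proj₂ (invert g g≉0)

      φ₀ : V → Carrier
      φ₀ x = g⁻¹ * t zero x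

      φ₀-linear : IsLinear φ₀
      φ₀-linear = scale-linear g⁻¹ (t-linear zero)

      φ₀b≈1 : φ₀ b ≈ 1#
      φ₀b≈1 = trans (*-congˡ (sym g≈)) (trans (*-comm g⁻¹ g) gg⁻¹≈1)

      φ₀∈ : ∀ {x} → x ∈ N → φ₀ x ∈ A
      φ₀∈ {x} x∈ with proj₂ (proj₂ (proj₂ principal)) (x , x∈ , ≈-refl)
      ... | a , a∈ , tx≈ag = IsSubring.resp isSubring (sym (begin
        g⁻¹ * t zero x    ≈⟨ *-congˡ tx≈ag ⟩
        g⁻¹ * (a * g)     ≈⟨ *-comm g⁻¹ _ ⟩
        (a * g) * g⁻¹     ≈⟨ *-assoc a g g⁻¹ ⟩
        a * (g * g⁻¹)     ≈⟨ *-congˡ gg⁻¹≈1 ⟩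
        a * 1#            ≈⟨ *-identityʳ a ⟩
        a                 ∎)) a∈

      open Projection φ₀-linear b

      φ₀-kernel : ∀ {x} → t zero x ≈ 0# → φ₀ x ≈ 0#
      φ₀-kernel tx≈0 = trans (*-congˡ tx≈0) (zeroʳ _)

      N₁ : Pred V (c ⊔ ℓ)
      N₁ x = x ∈ N × t zero x ≈ 0#

      project∈ : ∀ {x} → x ∈ N → project x ∈ N₁
      project∈ {x} x∈ = subtract∈ isSubring N-sub (φ₀∈ x∈) b∈ x∈ , (begin
        t zero (project x)              ≈⟨ subtract-linear (t-linear zero) (φ₀ x) b x ⟩
        t zero x - φ₀ x * t zero b      ≈⟨ +-congˡ (-‿cong (trans (*-congʳ (*-comm g⁻¹ _)) (*-assoc _ g⁻¹ _))) ⟩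
        t zero x - t zero x * φ₀ b      ≈⟨ +-congˡ (-‿cong (trans (*-congˡ φ₀b≈1) (*-identityʳ _))) ⟩
        t zero x - t zero x             ≈⟨ -‿inverseʳ _ ⟩
        0#                              ∎)

      N₁-sub : IsSubmodule A N₁
      N₁-sub = ∩-isSubmodule N-sub t₀.kernel-isSubmodule

      remaining : Basis A N₁
      remaining = basis (t ∘ suc) (t-linear ∘ suc) N₁ N₁-sub (λ k (x∈ , _) → t∈ (suc k) x∈)
        λ (x∈ , t₀x≈0) h → separates x∈ λ { zero → t₀x≈0 ; (suc k) → h k }

      module R = Basis remaining

      project-b : project b ≈ᵛ 0ᵛ
      project-b i = trans (+-congˡ (-‿cong (trans (*-congʳ φ₀b≈1) (*-identityˡ _)))) (-‿inverseʳ _)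

      vector : Fin (suc R.rank) → V
      vector zero    = b
      vector (suc k) = R.vector k

      dual : Fin (suc R.rank) → V → Carrier
      dual zero    x = φ₀ x
      dual (suc k) x = R.dual k (project x)

      dual-≢ : ∀ {k l} → l ≢ k → dual k (vector l) ≈ 0#
      dual-≢ {zero}  {zero}  l≢k = contradiction refl l≢k
      dual-≢ {zero}  {suc l} l≢k = φ₀-kernel (proj₂ (R.vector∈ l))
      dual-≢ {suc k} {zero}  l≢k = trans (IsLinear.φ-cong (R.dual-linear k) project-b) (IsLinear.φ-0 (R.dual-linear k))
      dual-≢ {suc k} {suc l} l≢k =
        trans (IsLinear.φ-cong (R.dual-linear k) (project-kernel (φ₀-kernel (proj₂ (R.vector∈ l)))))
          (R.dual-≢ λ { refl → l≢k refl })

  span-mono : ∀ {a m n} {A : Pred Carrier a} {M : Pred V m} {N : Pred V n} → M ⊆ N → Span A M ⊆ Span A N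
  span-mono M⊆N (none x≈0)         = none x≈0
  span-mono M⊆N (more f∈ m∈ y∈ x≈) = more f∈ (M⊆N m∈) (span-mono M⊆N y∈) x≈

  module _ {p} {P : Pred Carrier p} (isSubring : IsSubring P) where

    -- Eliminate with a w ∈ N such that t w ≠ 0: for y ∈ N, the vector y - (t y / t w) w
    -- is a multiple of t w · y - t y · w, which lies in N and in the kernel of t.
    kernel-flat : ∀ {t n} {N : Pred V n} → IsLinear t → IsSubmodule P N → (∀ {x} → x ∈ N → t x ∈ P) →
      ∀ {x} → x ∈ Span U N → t x ≈ 0# → x ∈ Span U (λ x → x ∈ N × t x ≈ 0#)
    kernel-flat {t} {n} {N} t-linear N-sub t∈ x∈ tx≈0 with em {P = ∃[ w ] w ∈ N × ¬ t w ≈ 0#}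
    ... | no t-vanishes = span-mono (λ w∈ → w∈ , vanish w∈) x∈
      where
      vanish : ∀ {w} → w ∈ N → t w ≈ 0#
      vanish {w} w∈ with em {P = t w ≈ 0#}
      ... | yes tw≈0 = tw≈0
      ... | no tw≉0  = contradiction (w , w∈ , tw≉0) t-vanishes
    ... | yes (w , w∈ , tw≉0) = span-resp (project-kernel (trans (*-congˡ tx≈0) (zeroʳ τ))) (project∈ x∈)
      where
      open IsLinear t-linear
      τ : Carrier
      τ = proj₁ (invert (t w) tw≉0)
      twτ≈1 : t w * τ ≈ 1#
      twτ≈1 = proj₂ (invert (t w) tw≉0)
      open Projection (scale-linear τ t-linear) w

      eliminate : V → V
      eliminate y i = t w * y i - t y * w i

      eliminate∈ : ∀ {y} → y ∈ N → eliminate y ∈ N × t (eliminate y) ≈ 0#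
      eliminate∈ {y} y∈ = subtract∈ isSubring N-sub (t∈ y∈) w∈ (IsSubmodule.•∈ N-sub (t∈ w∈) y∈) , (begin
        t (eliminate y)              ≈⟨ subtract-linear t-linear (t y) w (t w • y) ⟩
        t (t w • y) - t y * t w      ≈⟨ +-cong (φ-• _ _) (-‿cong (*-comm _ _)) ⟩
        t w * t y - t w * t y        ≈⟨ -‿inverseʳ _ ⟩
        0#                           ∎)

      project≈ : ∀ y → project y ≈ᵛ τ • eliminate y
      project≈ y i = begin
        y i - (τ * t y) * w i                    ≈⟨ +-congʳ (trans (sym (*-identityˡ _)) (*-congʳ (sym (trans (*-comm τ _) twτ≈1)))) ⟩
        (τ * t w) * y i - (τ * t y) * w i        ≈⟨ +-cong (*-assoc τ _ _) (-‿cong (*-assoc τ _ _)) ⟩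
        τ * (t w * y i) - τ * (t y * w i)        ≈⟨ +-congˡ (-‿distribʳ-* τ _) ⟩
        τ * (t w * y i) + τ * - (t y * w i)      ≈⟨ distribˡ τ _ _ ⟨
        τ * eliminate y i                        ∎

      project∈ : ∀ {y} → y ∈ Span U N → project y ∈ Span U (λ x → x ∈ N × t x ≈ 0#)
      project∈ = span-elim (λ y → project y ∈ Span U (λ x → x ∈ N × t x ≈ 0#))
        (λ x≈y → span-resp (project-cong x≈y))
        (none λ i → trans (project-kernel (trans (*-congˡ φ-0) (zeroʳ τ)) i) ≈-refl)
        (λ x∈ y∈ → span-resp (λ i → sym (project-+ _ _ i)) (span-+ x∈ y∈))
        (λ {f} {y} _ y∈ → span-resp (λ i → sym (trans (project-• f y i)
            (trans (*-congˡ (project≈ y i)) (sym (*-assoc f τ _)))))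
          (IsSubmodule.•∈ (span-isSubmodule _ U-isSubring) _ (⊆span U-isSubring (eliminate∈ y∈))))

    -- One form at a time: the kernel of the first in N is the module on which the others are
    -- considered.
    kernels-flat : ∀ {r n} (t : Fin r → V → Carrier) → (∀ k → IsLinear (t k)) →
      (N : Pred V n) → IsSubmodule P N → (∀ k {x} → x ∈ N → t k x ∈ P) →
      ∀ {x} → x ∈ Span U N → (∀ k → t k x ≈ 0#) → x ∈ Span U (λ x → x ∈ N × (∀ k → t k x ≈ 0#))
    kernels-flat {zero}  t t-linear N N-sub t∈ x∈ tx≈0 = span-mono (λ x∈ → x∈ , λ ()) x∈
    kernels-flat {suc r} t t-linear N N-sub t∈ x∈ tx≈0 = span-mono
      (λ ((x∈ , t₀x≈0) , h) → x∈ , λ { zero → t₀x≈0 ; (suc k) → h k })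
      (kernels-flat (t ∘ suc) (t-linear ∘ suc) (λ x → x ∈ N × t zero x ≈ 0#)
        (∩-isSubmodule N-sub (IsLinear.kernel-isSubmodule (t-linear zero))) (λ k (x∈ , _) → t∈ (suc k) x∈)
        (kernel-flat (t-linear zero) N-sub (t∈ zero) x∈ (tx≈0 zero)) (tx≈0 ∘ suc))

-- Gluing modules over two subrings of a field.

module Gluing (em : ∀ {a} → ExcludedMiddle a) {c ℓ} (E : CommutativeRing c ℓ)
  (invert : ∀ x → ¬ CommutativeRing._≈_ E x (CommutativeRing.0# E) →
            ∃[ y ] CommutativeRing._≈_ E (CommutativeRing._*_ E x y) (CommutativeRing.1# E))
  where

  open CommutativeRing E hiding (zero) renaming (refl to ≈-refl)
  open Subrings E
  open RingIdentities E
  open RingProperties ring using (-‿distribʳ-*; -1*x≈-x)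
  open import Relation.Binary.Reasoning.Setoid setoid

  -- π^ n and ω^ n are the powers of π and of u^α / π^β, which become
  -- invertible in S_{ν,π} and in S_{ν,u} respectively.
  record GluingDatum {p q} (P : Pred Carrier p) (Q : Pred Carrier q) : Set (c ⊔ ℓ ⊔ p ⊔ q) where
    field
      P-isSubring : IsSubring P
      Q-isSubring : IsSubring Q
      π^ π⁻ ω^ ω⁻ : ℕ → Carrier
      π^-+  : ∀ m n → π^ (m ℕ.+ n) ≈ π^ m * π^ n
      ω^-+  : ∀ m n → ω^ (m ℕ.+ n) ≈ ω^ m * ω^ n
      π⁻*π^ : ∀ n → π⁻ n * π^ n ≈ 1#
      ω⁻*ω^ : ∀ n → ω⁻ n * ω^ n ≈ 1#
      π^∈P  : ∀ n → π^ n ∈ P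
      π^∈Q  : ∀ n → π^ n ∈ Q
      π⁻∈P  : ∀ n → π⁻ n ∈ P
      ω^∈P  : ∀ n → ω^ n ∈ P
      ω^∈Q  : ∀ n → ω^ n ∈ Q
      ω⁻∈Q  : ∀ n → ω⁻ n ∈ Q
      clear : ∀ f → ∃[ n ] π^ n * f ∈ Q
      split : ∀ f → ∃[ n ] ∃[ g ] ∃[ h ] f ≈ g + h × ω^ n * g ∈ P × h ∈ Q

  module Glued {p q} {P : Pred Carrier p} {Q : Pred Carrier q} (datum : GluingDatum P Q) where
    open GluingDatum datum
    private
      module P = IsSubring P-isSubring
      module Q = IsSubring Q-isSubring

    S : Pred Carrier (p ⊔ q)
    S = P ∩ Q

    S-isSubring : IsSubring S
    S-isSubring = ∩-isSubring P-isSubring Q-isSubring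

    π^∈S : ∀ n → π^ n ∈ S
    π^∈S n = π^∈P n , π^∈Q n

    ω^∈S : ∀ n → ω^ n ∈ S
    ω^∈S n = ω^∈P n , ω^∈Q n

    module Modules (I : Set) where
      open Vectors E I

      ω^-+-• : ∀ {a} {A : Pred V a} → IsSubmodule S A → ∀ m n {x} → ω^ n • x ∈ A → ω^ (m ℕ.+ n) • x ∈ A
      ω^-+-• A m n x∈ = IsSubmodule.resp A
        (λ i → trans (sym (*-assoc _ _ _)) (*-congʳ (sym (ω^-+ m n)))) (IsSubmodule.•∈ A (ω^∈S m) x∈)

      ω^-+-•ʳ : ∀ {a} {A : Pred V a} → IsSubmodule S A → ∀ m n {x} → ω^ m • x ∈ A → ω^ (m ℕ.+ n) • x ∈ A
      ω^-+-•ʳ {A = A} A-sub m n {x} x∈ =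
        ≡.subst (λ k → ω^ k • x ∈ A) (ℕ.+-comm n m) (ω^-+-• A-sub n m x∈)

      π^-+-• : ∀ {a} {A : Pred V a} → IsSubmodule S A → ∀ m n {x} → π^ n • x ∈ A → π^ (m ℕ.+ n) • x ∈ A
      π^-+-• A m n x∈ = IsSubmodule.resp A
        (λ i → trans (sym (*-assoc _ _ _)) (*-congʳ (sym (π^-+ m n)))) (IsSubmodule.•∈ A (π^∈S m) x∈)

      π^-+-•ʳ : ∀ {a} {A : Pred V a} → IsSubmodule S A → ∀ m n {x} → π^ m • x ∈ A → π^ (m ℕ.+ n) • x ∈ A
      π^-+-•ʳ {A = A} A-sub m n {x} x∈ =
        ≡.subst (λ k → π^ k • x ∈ A) (ℕ.+-comm n m) (π^-+-• A-sub n m x∈)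

      π^-cancel : ∀ {a} {A : Pred V a} → IsSubmodule P A → ∀ n {x} → π^ n • x ∈ A → x ∈ A
      π^-cancel A n x∈ = IsSubmodule.resp A
        (λ i → trans (sym (*-assoc _ _ _)) (trans (*-congʳ (π⁻*π^ n)) (*-identityˡ _)))
        (IsSubmodule.•∈ A (π⁻∈P n) x∈)

      ω^-cancel : ∀ {a} {A : Pred V a} → IsSubmodule Q A → ∀ n {x} → ω^ n • x ∈ A → x ∈ A
      ω^-cancel A n x∈ = IsSubmodule.resp A
        (λ i → trans (sym (*-assoc _ _ _)) (trans (*-congʳ (ω⁻*ω^ n)) (*-identityˡ _)))
        (IsSubmodule.•∈ A (ω⁻∈Q n) x∈)

      module _ {a b} {A : Pred V a} {B : Pred V b} {b′} {T : Pred Carrier b′}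
               (T⊆ : ∀ {f} → f ∈ T → ∃[ n ] (∀ {m} → m ∈ A → π^ n • f • m ∈ B)) (B-sub : IsSubmodule S B) where

        -- Each term has an exponent of its own; as B is stable under π, their sum clears the whole
        -- combination.
        clear-span : ∀ {x} → x ∈ Span T A → ∃[ n ] π^ n • x ∈ B
        clear-span = span-elim (λ x → ∃[ n ] π^ n • x ∈ B)
          (λ { x≈y (n , x∈) → n , B.resp (λ i → *-congˡ (x≈y i)) x∈ })
          (0 , B.resp (λ i → sym (zeroʳ _)) B.0∈)
          (λ { (m , x∈) (n , y∈) → m ℕ.+ n , B.resp (λ i → sym (distribˡ _ _ _))
             (B.+∈ (π^-+-•ʳ B-sub m n x∈) (π^-+-• B-sub m n y∈)) })
          (λ f∈ m∈ → let (n , h) = T⊆ f∈ in n , h m∈)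
          where module B = IsSubmodule B-sub

      clear-P : ∀ {m} {M : Pred V m} → IsSubmodule S M → ∀ {x} → x ∈ Span P M → ∃[ n ] π^ n • x ∈ M
      clear-P M-sub = clear-span
        (λ {f} f∈P → let (n , πf∈Q) = clear f in n , λ m∈ → IsSubmodule.resp M-sub (λ i → *-assoc _ _ _)
          (IsSubmodule.•∈ M-sub (P.*∈ (π^∈P n) f∈P , πf∈Q) m∈)) M-sub

      clear-E : ∀ {b} {B : Pred V b} → IsSubmodule Q B → ∀ {x} → x ∈ Span U B → ∃[ n ] π^ n • x ∈ B
      clear-E B-sub = clear-span
        (λ {f} _ → let (n , πf∈Q) = clear f in n , λ m∈ → IsSubmodule.resp B-sub (λ i → *-assoc _ _ _)
          (IsSubmodule.•∈ B-sub πf∈Q m∈)) (restrict-scalars proj₂ B-sub)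

      module _ {a m} {A : Pred V a} {M : Pred V m} (A-sub : IsSubmodule P A) (M⊆A : M ⊆ A) where
        private
          module A = IsSubmodule A-sub
          A-S : IsSubmodule S A
          A-S = restrict-scalars proj₁ A-sub

        Split : Pred V _
        Split x = ∃[ n ] ∃[ y ] ∃[ z ] x ≈ᵛ y +ᵛ z × ω^ n • y ∈ A × z ∈ Span Q M

        -- `split` cuts every coefficient in two: finitely many parts g share a power of ω that
        -- moves them into P, and the parts h are scalars of Q already.
        split-E : ∀ {x} → x ∈ Span U M → Split x
        split-E = span-elim Split
          (λ { x≈x′ (n , y , z , x≈ , r) → n , y , z , (λ i → trans (sym (x≈x′ i)) (x≈ i)) , r })
          (0 , 0ᵛ , 0ᵛ , (λ i → sym (+-identityʳ 0#)) , A.resp (λ i → sym (zeroʳ _)) A.0∈ , none λ _ → ≈-refl)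
          (λ { (m , y , z , x≈ , y∈ , z∈) (n , y′ , z′ , x′≈ , y′∈ , z′∈) →
            m ℕ.+ n , y +ᵛ y′ , z +ᵛ z′
            , (λ i → trans (+-cong (x≈ i) (x′≈ i)) (interchange _ _ _ _))
            , A.resp (λ i → sym (distribˡ _ _ _))
                (A.+∈ (ω^-+-•ʳ A-S m n y∈) (ω^-+-• A-S m n y′∈))
            , span-+ z∈ z′∈ })
          (λ {f} {m} _ m∈ → let (n , g , h , f≈g+h , ωg∈P , h∈Q) = split f in
            n , g • m , h • m , (λ i → trans (*-congʳ f≈g+h) (distribʳ _ _ _))
            , A.resp (λ i → *-assoc _ _ _) (A.•∈ ωg∈P (M⊆A m∈))
            , IsSubmodule.•∈ (span-isSubmodule _ Q-isSubring) h∈Q (⊆span Q-isSubring m∈))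

      module _ {a b} {A : Pred V a} {B : Pred V b} (A-sub : IsSubmodule P A) (B-sub : IsSubmodule Q B) where

        private
          module A = IsSubmodule A-sub
          module B = IsSubmodule B-sub
          P-span = span-isSubmodule {A = P} (A ∩ B) P-isSubring
          Q-span = span-isSubmodule {A = Q} (A ∩ B) Q-isSubring

        glue-isSubmodule : IsSubmodule S (A ∩ B)
        glue-isSubmodule = ∩-isSubmodule (restrict-scalars proj₁ A-sub) (restrict-scalars proj₂ B-sub)

        -- Some π^n x lies in B, hence in A ∩ B, and π is invertible in P.
        glue-P : A ⊆ Span U B → A ⊆ Span P (A ∩ B)
        glue-P A⊆ x∈A = let (n , πx∈B) = clear-E B-sub (A⊆ x∈A) in
          π^-cancel P-span n (⊆span P-isSubring (A.•∈ (π^∈P n) x∈A , πx∈B))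

        -- In x = y + z the part z lies in B, hence so does y = x - z. A power of ω moves y into A ∩
        -- B, and ω is invertible in Q.
        glue-Q : A ⊆ Span U B → B ⊆ Span U A → B ⊆ Span Q (A ∩ B)
        glue-Q A⊆ B⊆ {x} x∈B =
          let (n , y , z , x≈y+z , ωy∈A , z∈) = split-E A-sub proj₁ x∈U
              y∈B = B.resp (λ i → trans (+-congʳ (x≈y+z i)) (trans (+-assoc _ _ _) (trans (+-congˡ
                      (trans (+-congˡ (-1*x≈-x _)) (-‿inverseʳ _))) (+-identityʳ _))))
                      (B.+∈ x∈B (B.•∈ (Q.neg∈ Q.1∈) (span⊆ B-sub proj₂ z∈)))
          in span-resp (λ i → sym (x≈y+z i)) (span-+
               (ω^-cancel Q-span n (⊆span Q-isSubring (ωy∈A , B.•∈ (ω^∈Q n) y∈B))) z∈)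
          where
          P⊆U : Span P (A ∩ B) ⊆ Span U (A ∩ B)
          P⊆U = span⊆ (restrict-scalars (λ _ → _) (span-isSubmodule _ U-isSubring)) (⊆span U-isSubring)
          x∈U : x ∈ Span U (A ∩ B)
          x∈U = span⊆ (span-isSubmodule _ U-isSubring) (λ y∈A → P⊆U (glue-P A⊆ y∈A)) (B⊆ x∈B)

      -- The properties persist when the exponent is enlarged, so the sum of the individual
      -- exponents is a common one.
      uniform : ∀ {r t} {T : Fin r → ℕ → Set t} → (∀ k m n → T k n → T k (m ℕ.+ n)) →
                (∀ k → ∃[ n ] T k n) → ∃[ n ] ∀ k → T k n
      uniform {zero}  mono h = 0 , λ ()
      uniform {suc r} {T = T} mono h =
        let (m , p) = h zero ; (n , p′) = uniform {T = T ∘ suc} (mono ∘ suc) (h ∘ suc) in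
        m ℕ.+ n , λ { zero    → ≡.subst (T zero) (ℕ.+-comm n m) (mono zero n m p)
                    ; (suc k) → mono (suc k) m n (p′ k) }

      module Saturation {a} {M : Pred V a} (M-sub : IsSubmodule S M)
                        (bᴾ : Basis P (Span P M)) (bᵠ : Basis Q (Span Q M)) where
        private
          module M = IsSubmodule M-sub
          module bᴾ = Basis bᴾ
          module bᵠ = Basis bᵠ
          A = Span P M
          B = Span Q M
          A-sub = span-isSubmodule M P-isSubring
          B-sub = span-isSubmodule M Q-isSubring

        vectors-cleared : ∃[ n ] ∀ k → π^ n • bᴾ.vector k ∈ M
        vectors-cleared = uniform (λ k m n → π^-+-• M-sub m n) λ k → clear-P M-sub (bᴾ.vector∈ k)

        matrix-cleared : ∃[ n ] ∀ k l → π^ n * bᴾ.dual k (bᵠ.vector l) ∈ Q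
        matrix-cleared = uniform (λ k m n h l → grow k l m n (h l)) λ k →
          uniform (λ l → grow k l) λ l → clear (bᴾ.dual k (bᵠ.vector l))
          where
          grow : ∀ k l m n → π^ n * bᴾ.dual k (bᵠ.vector l) ∈ Q → π^ (m ℕ.+ n) * bᴾ.dual k (bᵠ.vector l) ∈ Q
          grow k l m n h = Q.resp (trans (sym (*-assoc _ _ _)) (*-congʳ (sym (π^-+ m n)))) (Q.*∈ (π^∈Q m) h)

        -- x is a Q-combination of the basis of B, so a bound on the denominators of the finitely
        -- many matrix entries bounds those of its coordinates with respect to the basis of A.
        dual-cleared : ∀ k {x} → x ∈ B → π^ (proj₁ matrix-cleared) * bᴾ.dual k x ∈ Q
        dual-cleared k {x} x∈B = Q.resp (*-congˡ (sym (φ-cong (bᵠ.expand x∈B))))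
          (combination-∈ integral (λ l → bᵠ.dual l x) bᵠ.vector (λ l → bᵠ.dual∈ l x∈B) (λ l → proj₂ matrix-cleared k l))
          where
          open IsLinear (bᴾ.dual-linear k)
          π^n = π^ (proj₁ matrix-cleared)
          integral : IsSubmodule Q (λ x → π^n * bᴾ.dual k x ∈ Q)
          integral = record
            { resp = λ x≈y → Q.resp (*-congˡ (φ-cong x≈y))
            ; 0∈   = Q.resp (sym (trans (*-congˡ φ-0) (zeroʳ _))) Q.0∈
            ; +∈   = λ p r → Q.resp (sym (trans (*-congˡ (φ-+ _ _)) (distribˡ _ _ _))) (Q.+∈ p r)
            ; •∈   = λ {f} f∈ p → Q.resp (sym (trans (*-congˡ (φ-• _ _)) (trans (sym (*-assoc _ f _))
                (trans (*-congʳ (*-comm _ f)) (*-assoc f _ _))))) (Q.*∈ f∈ p) }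

        -- The denominators of A ∩ B over M are bounded by those of the matrix of a basis
        -- of B in terms of one of A, times those of the latter basis.
        uniformly-cleared : ∃[ n ] ∀ {x} → x ∈ A → x ∈ B → π^ n • x ∈ M
        uniformly-cleared = m ℕ.+ n , λ {x} x∈A x∈B →
          let f = λ k → bᴾ.dual k x in
          M.resp (λ i → begin
            combination (λ k → π^ n * f k) (λ k → π^ m • bᴾ.vector k) i   ≈⟨ combination-•ʳ (π^ m) _ bᴾ.vector i ⟨
            π^ m * combination (λ k → π^ n * f k) bᴾ.vector i             ≈⟨ *-congˡ (combination-• (π^ n) f bᴾ.vector i) ⟨
            π^ m * (π^ n * combination f bᴾ.vector i)                     ≈⟨ *-assoc _ _ _ ⟨
            (π^ m * π^ n) * combination f bᴾ.vector i                     ≈⟨ *-cong (π^-+ m n) (bᴾ.expand x∈A i) ⟨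
            π^ (m ℕ.+ n) * x i                                            ∎)
          (combination-∈ M-sub _ _ (λ k → P.*∈ (π^∈P n) (bᴾ.dual∈ k x∈A) , dual-cleared k x∈B)
            (proj₂ vectors-cleared))
          where
          m n : ℕ
          m = proj₁ vectors-cleared
          n = proj₁ matrix-cleared

        private
          N : ℕ
          N = proj₁ uniformly-cleared

        -- N is the uniform exponent: once ω^n z is known to lie in A as well as in B, the factor
        -- π^N brings it into M.
        Approximable : Pred V _
        Approximable x = ∃[ n ] ∃[ y ] ∃[ z ] x ≈ᵛ y +ᵛ π^ N • z × ω^ n • y ∈ M × z ∈ B

        module _ {f m} (f∈Q : f ∈ Q) (m∈M : m ∈ M) where
          private
            -- Cutting π^(-N) f instead of f makes the part left in Q divisible by π^N.
            part = split (π⁻ N * f)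
            n = proj₁ part
            g = proj₁ (proj₂ part)
            h = proj₁ (proj₂ (proj₂ part))
            ωg∈P : ω^ n * g ∈ P
            ωg∈P = proj₁ (proj₂ (proj₂ (proj₂ (proj₂ part))))
            h∈Q : h ∈ Q
            h∈Q = proj₂ (proj₂ (proj₂ (proj₂ (proj₂ part))))

            f≈ : f ≈ π^ N * g + π^ N * h
            f≈ = begin
              f                            ≈⟨ *-identityˡ f ⟨
              1# * f                       ≈⟨ *-congʳ (trans (*-comm _ _) (π⁻*π^ N)) ⟨
              (π^ N * π⁻ N) * f            ≈⟨ *-assoc _ _ _ ⟩
              π^ N * (π⁻ N * f)            ≈⟨ *-congˡ (proj₁ (proj₂ (proj₂ (proj₂ part)))) ⟩
              π^ N * (g + h)               ≈⟨ distribˡ _ _ _ ⟩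
              π^ N * g + π^ N * h          ∎

            πg≈ : f - π^ N * h ≈ π^ N * g
            πg≈ = begin
              f - π^ N * h                              ≈⟨ +-congʳ f≈ ⟩
              (π^ N * g + π^ N * h) - π^ N * h          ≈⟨ +-assoc _ _ _ ⟩
              π^ N * g + (π^ N * h - π^ N * h)          ≈⟨ +-congˡ (-‿inverseʳ _) ⟩
              π^ N * g + 0#                             ≈⟨ +-identityʳ _ ⟩
              π^ N * g                                  ∎

            -- Membership in P comes from the choice of n, membership in Q from π^N g = f - π^N h.
            ωπg∈S : ω^ n * (π^ N * g) ∈ S
            ωπg∈S = P.resp (x*yz≈y*xz (π^ N) (ω^ n) g) (P.*∈ (π^∈P N) ωg∈P)
                  , Q.*∈ (ω^∈Q n) (Q.resp πg≈ (Q.+∈ f∈Q (Q.neg∈ (Q.*∈ (π^∈Q N) h∈Q))))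

          generators-approximable : Approximable (f • m)
          generators-approximable = n , (π^ N * g) • m , h • m
            , (λ i → trans (*-congʳ f≈) (trans (distribʳ _ _ _) (+-congˡ (*-assoc _ _ _))))
            , M.resp (λ i → *-assoc _ _ _) (M.•∈ ωπg∈S m∈M)
            , IsSubmodule.•∈ B-sub h∈Q (⊆span Q-isSubring m∈M)

        approximate : ∀ {x} → x ∈ B → Approximable x
        approximate = span-elim Approximable
          (λ { x≈x′ (n , y , z , x≈ , r) → n , y , z , (λ i → trans (sym (x≈x′ i)) (x≈ i)) , r })
          (0 , 0ᵛ , 0ᵛ , (λ i → sym (trans (+-identityˡ _) (zeroʳ _))) , M.resp (λ i → sym (zeroʳ _)) M.0∈ , none λ _ → ≈-refl)
          (λ { (m , y , z , x≈ , y∈ , z∈) (n , y′ , z′ , x′≈ , y′∈ , z′∈) →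
            m ℕ.+ n , y +ᵛ y′ , z +ᵛ z′
            , (λ i → trans (+-cong (x≈ i) (x′≈ i)) (trans (interchange _ _ _ _) (+-congˡ (sym (distribˡ _ _ _)))))
            , M.resp (λ i → sym (distribˡ _ _ _))
                (M.+∈ (ω^-+-•ʳ M-sub m n y∈) (ω^-+-• M-sub m n y′∈))
            , span-+ z∈ z′∈ })
          generators-approximable

        -- With x = y + π^N z, the module A contains ω^m x and ω^m y, hence π^N ω^m z, hence ω^m z
        -- because π is invertible in P. As z lies in B, the uniform exponent gives π^N ω^m z ∈ M,
        -- and so ω^m x ∈ M.
        saturate : ∀ {x} → x ∈ A → x ∈ B → ∃[ n ] π^ n • x ∈ M × ω^ n • x ∈ M
        saturate {x} x∈A x∈B =
          let (m , y , z , x≈ , ωy∈M , z∈B) = approximate x∈B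
              ωπz∈A = IsSubmodule.resp A-sub (λ i → begin
                ω^ m * x i + (- 1#) * (ω^ m * y i)            ≈⟨ +-cong (*-congˡ (x≈ i)) (-1*x≈-x _) ⟩
                ω^ m * (y i + π^ N * z i) - ω^ m * y i        ≈⟨ +-congʳ (trans (distribˡ _ _ _) (+-comm _ _)) ⟩
                (ω^ m * (π^ N * z i) + ω^ m * y i) - ω^ m * y i ≈⟨ +-assoc _ _ _ ⟩
                ω^ m * (π^ N * z i) + (ω^ m * y i - ω^ m * y i) ≈⟨ +-congˡ (-‿inverseʳ _) ⟩
                ω^ m * (π^ N * z i) + 0#                      ≈⟨ +-identityʳ _ ⟩
                ω^ m * (π^ N * z i)                           ≈⟨ x*yz≈y*xz _ _ _ ⟩
                π^ N * (ω^ m * z i)                           ∎)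
                (IsSubmodule.+∈ A-sub (IsSubmodule.•∈ A-sub (ω^∈P m) x∈A)
                  (IsSubmodule.•∈ A-sub (P.neg∈ P.1∈) (⊆span P-isSubring ωy∈M)))
              πωz∈M = proj₂ uniformly-cleared (π^-cancel A-sub N ωπz∈A) (IsSubmodule.•∈ B-sub (ω^∈Q m) z∈B)
              ωx∈M = M.resp (λ i → sym (trans (*-congˡ (x≈ i)) (trans (distribˡ _ _ _) (+-congˡ (x*yz≈y*xz _ _ _)))))
                (M.+∈ ωy∈M πωz∈M)
              (n , πx∈M) = clear-P M-sub x∈A
          in m ℕ.+ n , π^-+-• M-sub m n πx∈M
             , ω^-+-•ʳ M-sub m n ωx∈M

    -- The pairs (x , y) ∈ A × A′ with x = y form the kernel of d linear forms on E^(d+d).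
    module Intersection (d : ℕ) where
      open Vectors E (Fin d)
      open Modules (Fin d)
      private
        module Pair = Vectors E (Fin d ⊎ Fin d)
        open FieldVectors em E invert (Fin d ⊎ Fin d) using (kernels-flat)

      module _ {a a′} {A : Pred V a} {A′ : Pred V a′} (A-sub : IsSubmodule P A) (A′-sub : IsSubmodule P A′)
               (A⊆P : ∀ {x} → x ∈ A → ∀ i → x i ∈ P) (A′⊆P : ∀ {x} → x ∈ A′ → ∀ i → x i ∈ P) where
        private
          module A = IsSubmodule A-sub
          module A′ = IsSubmodule A′-sub

          Pairs : Pred Pair.V (a ⊔ a′)
          Pairs w = w ∘ inj₁ ∈ A × w ∘ inj₂ ∈ A′

          pairs-sub : Pair.IsSubmodule P Pairs
          pairs-sub = record
            { resp = λ x≈y (p , r) → A.resp (x≈y ∘ inj₁) p , A′.resp (x≈y ∘ inj₂) r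
            ; 0∈   = A.0∈ , A′.0∈
            ; +∈   = λ (p , r) (p′ , r′) → A.+∈ p p′ , A′.+∈ r r′
            ; •∈   = λ f∈ (p , r) → A.•∈ f∈ p , A′.•∈ f∈ r }

          E-span = Pair.span-isSubmodule {A = U} Pairs U-isSubring
          module E-span = Pair.IsSubmodule E-span

          left : ∀ {x} → x ∈ Span U A → Sum.[ x , 0ᵛ ] ∈ Pair.Span U Pairs
          left = span-elim (λ x → Sum.[ x , 0ᵛ ] ∈ Pair.Span U Pairs)
            (λ x≈y → Pair.span-resp λ { (inj₁ i) → x≈y i ; (inj₂ i) → ≈-refl })
            (Pair.none λ { (inj₁ i) → ≈-refl ; (inj₂ i) → ≈-refl })
            (λ p r → Pair.span-resp (λ { (inj₁ i) → ≈-refl ; (inj₂ i) → +-identityʳ 0# }) (Pair.span-+ p r))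
            (λ {f} {m} _ m∈ → Pair.span-resp {x = f Pair.• Sum.[ m , 0ᵛ ]} (λ { (inj₁ i) → ≈-refl ; (inj₂ i) → zeroʳ f })
              (E-span.•∈ _ (Pair.⊆span U-isSubring (m∈ , A′.0∈))))

          right : ∀ {x} → x ∈ Span U A′ → Sum.[ 0ᵛ , x ] ∈ Pair.Span U Pairs
          right = span-elim (λ x → Sum.[ 0ᵛ , x ] ∈ Pair.Span U Pairs)
            (λ x≈y → Pair.span-resp λ { (inj₁ i) → ≈-refl ; (inj₂ i) → x≈y i })
            (Pair.none λ { (inj₁ i) → ≈-refl ; (inj₂ i) → ≈-refl })
            (λ p r → Pair.span-resp (λ { (inj₁ i) → +-identityʳ 0# ; (inj₂ i) → ≈-refl }) (Pair.span-+ p r))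
            (λ {f} {m} _ m∈ → Pair.span-resp {x = f Pair.• Sum.[ 0ᵛ , m ]} (λ { (inj₁ i) → zeroʳ f ; (inj₂ i) → ≈-refl })
              (E-span.•∈ _ (Pair.⊆span U-isSubring (A.0∈ , m∈))))

          difference : Fin d → Pair.V → Carrier
          difference i w = w (inj₁ i) - w (inj₂ i)

          difference-linear : ∀ i → Pair.IsLinear (difference i)
          difference-linear i = record
            { φ-cong = λ x≈y → +-cong (x≈y (inj₁ i)) (-‿cong (x≈y (inj₂ i)))
            ; φ-+    = λ x y → sym (difference-+ _ _ _ _)
            ; φ-•    = λ f x → trans (+-congˡ (-‿distribʳ-* f _)) (sym (distribˡ f _ _)) }

        -- The vector (x , x) lies in the E-span of A × A′ and is killed by all differences. By
        -- `kernels-flat` it is a combination of pairs in A × A′ killed by them, that is, of pairs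
        -- (w , w) with w in A ∩ A′; the first components give the claim.
        span-∩ : ∀ {x} → x ∈ Span U A → x ∈ Span U A′ → x ∈ Span U (A ∩ A′)
        span-∩ {x} x∈A x∈A′ = Pair.span-elim (λ w → w ∘ inj₁ ∈ Span U (A ∩ A′))
          (λ x≈y → span-resp (x≈y ∘ inj₁)) (none λ _ → ≈-refl) span-+
          (λ { {f} {w} _ ((w₁∈ , w₂∈) , w₁≈w₂) → IsSubmodule.•∈ (span-isSubmodule _ U-isSubring) _
             (⊆span U-isSubring (w₁∈ , A′.resp (λ i → sym (GroupProperties.x∙y⁻¹≈ε⇒x≈y +-group _ _ (w₁≈w₂ i))) w₂∈)) })
          (kernels-flat P-isSubring difference difference-linear Pairs pairs-sub
            (λ i (p , r) → P.+∈ (A⊆P p i) (P.neg∈ (A′⊆P r i)))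
            {λ { (inj₁ i) → x i ; (inj₂ i) → x i }}
            (Pair.span-resp (λ { (inj₁ i) → +-identityʳ _ ; (inj₂ i) → +-identityˡ _ }) (Pair.span-+ (left x∈A) (right x∈A′)))
            (λ i → -‿inverseʳ _))

-- Weierstrass division; S_{ν,π} and S_{ν,u} are principal.

module PrincipalIdeals (em : ∀ {a} → ExcludedMiddle a) {c ℓ} (D : CompleteDVR c ℓ) (ν : ℚ) where
  open CompleteDVR D
  open Convergence D
  open Limits D
  open Series D ν
  open LaurentSeries D ν
  open SeriesSum D ν
  open Weights ν
  open Minimum em
  open LeadingTerms em D ν
  open Factorisation em D ν
  open K using (Carrier; _≈_; 0#; 1#)
  open FactorIdentities ℰ-commutativeRing
  open Subrings ℰ-commutativeRing
  open import Relation.Binary.Reasoning.Setoid K.setoid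
  private module E = CommutativeRing ℰ-commutativeRing

  -- Weierstrass division: the quotient is r h, where h solves the contracting
  -- equation h = [m g]_{≥0} - [h t]_{≥0}.
  module Division {f : ℰ} (f-holomorphic : Holomorphic f) (L : Leading f)
                  {g : ℰ} (g-holomorphic : Holomorphic g) where
    open Leading L
    open Normalised f L hiding (g)

    nonnegative : ℰ → ℰ
    nonnegative = restrict (0ℤ ℤ.≤?_)

    T : ℰ → ℰ
    T h = nonnegative (h · (-ᴱ t))

    T-continuous : IsContinuous T
    T-continuous = ∘-continuous {nonnegative} {_· (-ᴱ t)}
      (restrict-continuous (0ℤ ℤ.≤?_)) (·-continuousʳ (-ᴱ t))

    seed : ℰ
    seed = nonnegative (m · g)

    bound : ∃[ z ] z ≤ᴱ seed
    bound = ≤ᴱ-bound seed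

    -- Every step multiplies by `t`, of weight at least 1, and truncation does not lower weights.
    iterate-growth : ∀ k → proj₁ bound ℤ.+ + k ≤ᴱ iterate T seed k
    iterate-growth zero = ≡.subst (_≤ᴱ seed) (≡.sym (ℤ.+-identityʳ (proj₁ bound))) (proj₂ bound)
    iterate-growth (suc k) i = ≤w-restrict (0ℤ ℤ.≤?_) (iterate T seed k · (-ᴱ t))
      (≡.subst (_≤ᴱ iterate T seed k · (-ᴱ t)) (assoc (proj₁ bound) (+ k))
        (≤ᴱ-· (iterate T seed k) (-ᴱ t) (iterate-growth k) (≤ᴱ-neg t 1≤t)) i)
      where
      assoc : ∀ z k → z ℤ.+ k ℤ.+ 1ℤ ≡ z ℤ.+ (1ℤ ℤ.+ k)
      assoc = solve-∀

    open FixedPoint {T} T-continuous {seed} (growth⇒null (iterate T seed) (proj₁ bound) iterate-growth)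
      renaming (solution to h)

    nonnegative-holomorphic : ∀ f → Holomorphic (nonnegative f)
    nonnegative-holomorphic f i i<0 = restrict-outside (0ℤ ℤ.≤?_) f (ℤ.<⇒≱ i<0)

    iterate-holomorphic : ∀ k → Holomorphic (iterate T seed k)
    iterate-holomorphic zero    = nonnegative-holomorphic (m · g)
    iterate-holomorphic (suc k) = nonnegative-holomorphic (iterate T seed k · (-ᴱ t))

    quotient : ℰ
    quotient = r · h

    quotient-holomorphic : Holomorphic quotient
    quotient-holomorphic = holomorphic-· {r} {h} r-holomorphic λ i i<0 → ≤w-all⇒≈0 i λ C →
      ≤w-solution i λ k → ≤w-cong (K.sym (iterate-holomorphic k i i<0)) (≤w-0 i)

    ρ : ℰ
    ρ = g +ᴱ (-ᴱ (quotient · f))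

    -- In degrees ≥ 0 truncation is invisible, so h = m g - h t there, which cancels the right-hand
    -- side of `factor-remainder`.
    m·ρ-vanishes : ∀ k → 0ℤ ℤ.≤ k → coeff (m · ρ) k ≈ 0#
    m·ρ-vanishes k 0≤k = begin
      coeff (m · ρ) k                                               ≈⟨ factor-remainder {f} {m} {p} {s} {r} g≈1+p+s r-inverse g h k ⟩
      (coeff (m · g) k K.- coeff h k) K.- coeff (h · t) k           ≈⟨ K.+-congʳ (K.+-congˡ (K.-‿cong h≈)) ⟩
      (a K.- (a K.- b)) K.- b                                       ≈⟨ K.+-congʳ (K.+-congˡ (neg-diff a b)) ⟩
      (a K.+ (b K.- a)) K.- b                                       ≈⟨ K.+-congʳ (K.trans (K.+-congˡ (K.+-comm b _)) (K.sym (K.+-assoc a _ b))) ⟩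
      ((a K.- a) K.+ b) K.- b                                       ≈⟨ K.+-congʳ (K.trans (K.+-congʳ (K.-‿inverseʳ a)) (K.+-identityˡ b)) ⟩
      b K.- b                                                       ≈⟨ K.-‿inverseʳ b ⟩
      0#                                                            ∎
      where
      a b : Carrier
      a = coeff (m · g) k
      b = coeff (h · t) k
      h≈ : coeff h k ≈ a K.- b
      h≈ = K.trans (solves k) (K.+-cong (restrict-inside (0ℤ ℤ.≤?_) (m · g) 0≤k)
        (K.trans (restrict-inside (0ℤ ℤ.≤?_) (h · (-ᴱ t)) 0≤k)
          (K.sym (RingProperties.-‿distribʳ-* E.ring h t k))))

    -- `m` is an invertible constant times u^(-index), so degrees ≥ 0 of m ρ are degrees ≥ index of
    -- ρ.
    ρ-vanishes : ∀ j → index ℤ.≤ j → coeff ρ j ≈ 0#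
    ρ-vanishes j index≤j = begin
      coeff ρ j                                 ≈⟨ K.*-identityˡ _ ⟨
      1# K.* coeff ρ j                          ≈⟨ K.*-congʳ xy≈1 ⟨
      (x K.* y) K.* coeff ρ j                   ≈⟨ K.*-assoc x y _ ⟩
      x K.* (y K.* coeff ρ j)                   ≡⟨ ≡.cong (λ i → x K.* (y K.* coeff ρ i)) (shift j index) ⟨
      x K.* (y K.* coeff ρ ((j ℤ.- index) ℤ.- ℤ.- index)) ≈⟨ K.*-congˡ (coeff-m· ρ (j ℤ.- index)) ⟨
      x K.* coeff (m · ρ) (j ℤ.- index)         ≈⟨ K.*-congˡ (m·ρ-vanishes (j ℤ.- index) (ℤ.i≤j⇒0≤j-i index≤j)) ⟩
      x K.* 0#                                  ≈⟨ K.zeroʳ x ⟩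
      0#                                        ∎
      where
      shift : ∀ j i → (j ℤ.- i) ℤ.- ℤ.- i ≡ j
      shift = solve-∀

  Sπ-isSubring : IsSubring Sπ
  Sπ-isSubring = record
    { resp = λ f≈g p i i<0 → K.trans (K.sym (f≈g i)) (p i i<0)
    ; 0∈   = λ _ _ → K.refl
    ; 1∈   = 1-holomorphic
    ; +∈   = λ {f} {g} → holomorphic-+ {f} {g}
    ; neg∈ = λ {f} → holomorphic-neg {f}
    ; *∈   = λ {f} {g} → holomorphic-· {f} {g} }

  Sᵤ-isSubring : IsSubring Sᵤ
  Sᵤ-isSubring = record
    { resp = λ f≈g p i → ≤w-cong (f≈g i) (p i)
    ; 0∈   = ≤w-0
    ; 1∈   = 0≤ᴱ⇒Sᵤ {1ᴱ} 0≤ᴱ1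
    ; +∈   = λ p r i → ≤w-+ (p i) (r i)
    ; neg∈ = λ p i → ≤w-neg (p i)
    ; *∈   = λ {f} {g} p r → 0≤ᴱ⇒Sᵤ {f · g} (≤ᴱ-· f g (Sᵤ⇒0≤ᴱ {f} p) (Sᵤ⇒0≤ᴱ {g} r)) }

  -- The generator has least leading exponent, its Weierstrass degree. A remainder of division by it
  -- stays in J and has no term from that exponent on, so if nonzero it would have a smaller leading
  -- exponent.
  Sπ-isPrincipal : IsPrincipal Sπ
  Sπ-isPrincipal = record { generator = generator }
    where
    module _ (J : Pred ℰ (c ⊔ ℓ)) (J⊆ : J ⊆ Sπ)
             (closed : ∀ {a x y} → a ∈ Sπ → x ∈ J → y ∈ J → y +ᴱ (-ᴱ (a · x)) ∈ J) where
      Nonzero : Set _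
      Nonzero = Σ[ f ∈ ℰ ] f ∈ J × Leading f

      generator : ∀ {x} → x ∈ J → ¬ x ≈ᴱ 0ᴱ →
        ∃[ g ] g ∈ J × ¬ g ≈ᴱ 0ᴱ × (∀ {y} → y ∈ J → ∃[ a ] a ∈ Sπ × y ≈ᴱ a · g)
      generator {x} x∈ x≉0 = f , f∈ , (λ f≈0 → Leading.leading≉0 L (f≈0 (Leading.index L))) , divide
        where
        index : Nonzero → ℤ
        index (_ , _ , L) = Leading.index L

        least : ∃[ x ] ∀ y → index x ℤ.≤ index y
        least = minimumℤ index 0ℤ
          (λ (f , f∈ , L) → ℤ.≮⇒≥ λ i<0 → Leading.leading≉0 L (J⊆ f∈ (Leading.index L) i<0))
          (x , x∈ , leading x x≉0)

        f : ℰ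
        f = proj₁ (proj₁ least)
        f∈ : f ∈ J
        f∈ = proj₁ (proj₂ (proj₁ least))
        L : Leading f
        L = proj₂ (proj₂ (proj₁ least))

        divide : ∀ {y} → y ∈ J → ∃[ a ] a ∈ Sπ × y ≈ᴱ a · f
        divide {y} y∈ = quotient , quotient-holomorphic , y≈
          where
          open Division {f} (J⊆ f∈) L {y} (J⊆ y∈)
          y≈ : y ≈ᴱ quotient · f
          y≈ i = x-y≈0⇒x≈y (ρ≈0 (em {P = ρ ≈ᴱ 0ᴱ}) i)
            where
            ρ≈0 : Dec (ρ ≈ᴱ 0ᴱ) → ρ ≈ᴱ 0ᴱ
            ρ≈0 (yes ρ≈0) = ρ≈0
            ρ≈0 (no ρ≉0)  = contradiction
              (ρ-vanishes (Leading.index Lρ) (proj₂ least (ρ , closed quotient-holomorphic f∈ y∈ , Lρ)))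
              (Leading.leading≉0 Lρ)
              where
              Lρ : Leading ρ
              Lρ = leading ρ ρ≉0

  -- As in any discrete valuation ring, an element of least order divides all others.
  Sᵤ-isPrincipal : IsPrincipal Sᵤ
  Sᵤ-isPrincipal = record { generator = generator }
    where
    module _ (J : Pred ℰ (c ⊔ ℓ)) (J⊆ : J ⊆ Sᵤ)
             (closed : ∀ {a x y} → a ∈ Sᵤ → x ∈ J → y ∈ J → y +ᴱ (-ᴱ (a · x)) ∈ J) where
      Nonzero : Set _
      Nonzero = Σ[ f ∈ ℰ ] f ∈ J × Leading f

      generator : ∀ {x} → x ∈ J → ¬ x ≈ᴱ 0ᴱ →
        ∃[ g ] g ∈ J × ¬ g ≈ᴱ 0ᴱ × (∀ {y} → y ∈ J → ∃[ a ] a ∈ Sᵤ × y ≈ᴱ a · g)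
      generator {x} x∈ x≉0 = f , f∈ , (λ f≈0 → Leading.leading≉0 L (f≈0 (Leading.index L))) , divide
        where
        order : Nonzero → ℤ
        order (_ , _ , L) = Leading.order L

        least : ∃[ x ] ∀ y → order x ℤ.≤ order y
        least = minimumℤ order 0ℤ
          (λ (f , f∈ , L) → ≡.subst (0ℤ ℤ.≤_) (≡.sym (Leading.order≡ L))
            (≤w⇒≤weight (Leading.index L) (coeff f (Leading.index L)) (Leading.v-leading L)
              (Sᵤ⇒0≤ᴱ {f} (J⊆ f∈) (Leading.index L))))
          (x , x∈ , leading x x≉0)

        f : ℰ
        f = proj₁ (proj₁ least)
        f∈ : f ∈ J
        f∈ = proj₁ (proj₂ (proj₁ least))
        L : Leading f
        L = proj₂ (proj₂ (proj₁ least))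
        open Normalised f L using (inverseᴱ)
        f⁻¹ : ℰ
        f⁻¹ = proj₁ inverseᴱ

        divide : ∀ {y} → y ∈ J → ∃[ a ] a ∈ Sᵤ × y ≈ᴱ a · f
        divide {y} y∈ = y · f⁻¹ , 0≤ᴱ⇒Sᵤ {y · f⁻¹} bound , y≈
          where
          bound : 0ℤ ≤ᴱ y · f⁻¹
          bound = pick (em {P = y ≈ᴱ 0ᴱ})
            where
            pick : Dec (y ≈ᴱ 0ᴱ) → 0ℤ ≤ᴱ y · f⁻¹
            pick (yes y≈0) i = ≤w-cong (K.sym (K.trans (E.*-congʳ {f⁻¹} {y} {0ᴱ} y≈0 i) (E.zeroˡ f⁻¹ i))) (≤w-0 i)
            pick (no y≉0)    = ≤ᴱ-weaken (y · f⁻¹)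
              (ℤ.i≤j⇒0≤j-i (proj₂ least (y , y∈ , Ly)))
              (≤ᴱ-· y f⁻¹ (Leading.order≤ Ly) (proj₂ (proj₂ inverseᴱ)))
              where
              Ly : Leading y
              Ly = leading y y≉0
          y≈ : y ≈ᴱ (y · f⁻¹) · f
          y≈ i = K.sym (K.trans (E.*-assoc y f⁻¹ f i) (K.trans
            (E.*-congˡ {y} {f⁻¹ · f} {1ᴱ} (λ j → K.trans (E.*-comm f⁻¹ f j) (proj₁ (proj₂ inverseᴱ) j)) i)
            (E.*-identityʳ y i)))

  invertᴱ : ∀ f → ¬ f ≈ᴱ 0ᴱ → ∃[ g ] f · g ≈ᴱ 1ᴱ
  invertᴱ f f≉0 = let (g , fg≈1 , _) = Normalised.inverseᴱ f (leading f f≉0) in g , fg≈1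

-- Proved for an abstract semiring, since on ℰ conversion would unfold the product.
^-suc≡ : ∀ {a ℓ} (R : RawSemiring a ℓ) x n →
  RawSemiringDefinitions._^_ R x (suc n) ≡ RawSemiring._*_ R x (RawSemiringDefinitions._^_ R x n)
^-suc≡ R x n = refl

-- The analytic input for the gluing.

module Datum (em : ∀ {a} → ExcludedMiddle a) {c ℓ} (D : CompleteDVR c ℓ) (ν : ℚ) where
  open CompleteDVR D
  open Series D ν hiding (_^ᴱ_; πᴱ; u^α/π^β)
  open LaurentSeries D ν
  open SeriesSum D ν
  open Weights ν
  open LeadingTerms em D ν
  open Factorisation em D ν
  open PrincipalIdeals em D ν
  open K using (Carrier; _≈_; 0#; 1#)
  open Subrings ℰ-commutativeRing
  open Gluing em ℰ-commutativeRing invertᴱ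
  open import Relation.Binary.Reasoning.Setoid K.setoid
  private module E = CommutativeRing ℰ-commutativeRing

  private
    R₀ : RawSemiring c ℓ
    R₀ = RawRing.rawSemiring (Series.ℰ-rawRing D ν)

  *≈· : ∀ f g → RawSemiring._*_ R₀ f g ≈ᴱ f · g
  *≈· f g i = K.sym (·≈*ᴱ f g i)

  pow-suc : ∀ b n → RawSemiringDefinitions._^_ R₀ b (suc n) ≈ᴱ b · RawSemiringDefinitions._^_ R₀ b n
  pow-suc b n = ≡.subst (λ f → f ≈ᴱ b · RawSemiringDefinitions._^_ R₀ b n) (≡.sym (^-suc≡ R₀ b n))
    (*≈· b (RawSemiringDefinitions._^_ R₀ b n))

  infixr 8 _^_
  opaque
    _^_ : ℰ → ℕ → ℰ
    b ^ n = RawSemiringDefinitions._^_ R₀ b n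

    ^-0 : ∀ b → b ^ 0 ≡ 1ᴱ
    ^-0 b = refl

    ^-unfold : ∀ b n → b ^ n ≡
      RawSemiringDefinitions._^_ (RawRing.rawSemiring (Series.ℰ-rawRing D ν)) b n
    ^-unfold b n = refl

    ^-suc : ∀ b n → b ^ suc n ≈ᴱ b · b ^ n
    ^-suc b n = pow-suc b n

  πᴱ ωᴱ : ℰ
  πᴱ = Series.πᴱ D ν
  ωᴱ = Series.u^α/π^β D ν

  ^-+ : ∀ b m n → b ^ (m ℕ.+ n) ≈ᴱ b ^ m · b ^ n
  ^-+ b zero    n = ≡.subst (λ f → b ^ n ≈ᴱ f · b ^ n) (≡.sym (^-0 b)) (λ i → K.sym (E.*-identityˡ (b ^ n) i))
  ^-+ b (suc m) n i = K.trans (^-suc b (m ℕ.+ n) i) (K.trans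
    (E.*-congˡ {b} {b ^ (m ℕ.+ n)} {b ^ m · b ^ n} (^-+ b m n) i) (K.trans
    (K.sym (E.*-assoc b (b ^ m) (b ^ n) i))
    (E.*-congʳ {b ^ n} {b · b ^ m} {b ^ suc m} (λ j → K.sym (^-suc b m j)) i)))

  ^-∈ : ∀ {a} {A : Pred ℰ a} → IsSubring A → ∀ {b} → b ∈ A → ∀ n → b ^ n ∈ A
  ^-∈ {A = A′} A {b} b∈ zero = ≡.subst (_∈ A′) (≡.sym (^-0 b)) (IsSubring.1∈ A)
  ^-∈ A {b} b∈ (suc n) = IsSubring.resp A (λ i → K.sym (^-suc b n i)) (IsSubring.*∈ A b∈ (^-∈ A b∈ n))

  ^-inverse : ∀ b b′ → b′ · b ≈ᴱ 1ᴱ → ∀ n → b′ ^ n · b ^ n ≈ᴱ 1ᴱ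
  ^-inverse b b′ b′b≈1 zero = ≡.subst₂ (λ f g → f · g ≈ᴱ 1ᴱ) (≡.sym (^-0 b′)) (≡.sym (^-0 b)) (E.*-identityˡ 1ᴱ)
  ^-inverse b b′ b′b≈1 (suc n) i = begin
    coeff (b′ ^ suc n · b ^ suc n) i               ≈⟨ E.*-cong {b′ ^ suc n} {b′ · b′ ^ n} {b ^ suc n} {b · b ^ n} (^-suc b′ n) (^-suc b n) i ⟩
    coeff ((b′ · b′ ^ n) · (b · b ^ n)) i          ≈⟨ RingIdentities.*-interchange ℰ-commutativeRing b′ (b′ ^ n) b (b ^ n) i ⟩
    coeff ((b′ · b) · (b′ ^ n · b ^ n)) i          ≈⟨ E.*-cong {b′ · b} {1ᴱ} {b′ ^ n · b ^ n} {1ᴱ} b′b≈1 (^-inverse b b′ b′b≈1 n) i ⟩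
    coeff (1ᴱ · 1ᴱ) i                              ≈⟨ E.*-identityˡ 1ᴱ i ⟩
    coeff 1ᴱ i                                     ∎

  invert-v : ∀ {x n} → v x ≡ [ n ] → ∃[ y ] x K.* y ≈ 1# × v y ≡ [ ℤ.- n ]
  invert-v {x} vx≡n = let (y , xy≈1) = inverse x (v≡[]⇒≉0 vx≡n) in y , xy≈1 , v-inverse vx≡n xy≈1

  ≤ᴱ-monomial-v : ∀ {x n i z} → v x ≡ [ n ] → z ℤ.≤ weight n i → z ≤ᴱ monomial x i
  ≤ᴱ-monomial-v {x} {n} {i} {z} vx≡n z≤ = ≤ᴱ-monomial x i (≤weight⇒≤w i x λ m vx≡m →
    ≡.subst (λ n → z ℤ.≤ weight n i) ([]-injective (≡.trans (≡.sym vx≡n) vx≡m)) z≤)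

  monomial-inverse : ∀ {x y} i → x K.* y ≈ 1# → monomial y (ℤ.- i) · monomial x i ≈ᴱ 1ᴱ
  monomial-inverse {x} {y} i xy≈1 k = K.trans (monomial-·-monomial y (ℤ.- i) x i k)
    (monomial-≡-cong (K.trans (K.*-comm y x) xy≈1) (ℤ.+-inverseˡ i) k)

  monomial-holomorphic : ∀ x {i} → 0ℤ ℤ.≤ i → Holomorphic (monomial x i)
  monomial-holomorphic x {i} 0≤i j j<0 = coeff-monomial-≢ x i λ j≡i → ℤ.<⇒≱ j<0 (≡.subst (0ℤ ℤ.≤_) (≡.sym j≡i) 0≤i)

  weight-0 : ∀ n → weight n 0ℤ ≡ ↧ ν ℤ.* n
  weight-0 n = ≡.trans (≡.cong (λ t → ↧ ν ℤ.* n ℤ.+ t) (ℤ.*-zeroʳ (↥ ν))) (ℤ.+-identityʳ _)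

  1≤π : 1ℤ ≤ᴱ πᴱ
  1≤π = ≤ᴱ-monomial-v v-π (≡.subst (1ℤ ℤ.≤_) (≡.sym (≡.trans (weight-0 1ℤ) (ℤ.*-identityʳ (↧ ν)))) (ℤ.+≤+ (ℕ.s≤s ℕ.z≤n)))

  0≤π : 0ℤ ≤ᴱ πᴱ
  0≤π = ≤ᴱ-weaken πᴱ (ℤ.+≤+ ℕ.z≤n) 1≤π

  πᴱ⁻¹ : ℰ
  πᴱ⁻¹ = monomial (proj₁ (invert-v v-π)) 0ℤ

  v-π^ : ∀ z → v (π^ z) ≡ [ z ]
  v-π^ (+ zero)      = v-1
  v-π^ (+ suc n)     = ≡.trans (v-* _ _) (≡.cong₂ (zipWith ℤ._+_) v-π (v-π^ (+ n)))
  v-π^ -[1+ zero ]   = ≡.trans (v-cong (K.*-identityʳ π⁻¹)) (v-inverse v-π (proj₂ (inverse (ι π) π≉0)))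
  v-π^ -[1+ suc n ]  = ≡.trans (v-* _ _)
    (≡.cong₂ (zipWith ℤ._+_) (v-inverse v-π (proj₂ (inverse (ι π) π≉0))) (v-π^ -[1+ n ]))

  ωᴱ⁻¹ : ℰ
  ωᴱ⁻¹ = monomial (proj₁ (invert-v (v-π^ (ℤ.- ↥ ν)))) (ℤ.- ↧ ν)

  -- The weight of u^α/π^β is α(-β) + βα = 0, and that of its inverse is 0 too, which makes it a
  -- unit of S_{ν,u}.
  0≤ω : 0ℤ ≤ᴱ ωᴱ
  0≤ω = ≤ᴱ-monomial-v (v-π^ (ℤ.- ↥ ν)) (ℤ.≤-reflexive (cancel (↧ ν) (↥ ν)))
    where
    cancel : ∀ a b → 0ℤ ≡ a ℤ.* (ℤ.- b) ℤ.+ b ℤ.* a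
    cancel = solve-∀

  0≤ω⁻¹ : 0ℤ ≤ᴱ ωᴱ⁻¹
  0≤ω⁻¹ = ≤ᴱ-monomial-v (proj₂ (proj₂ (invert-v (v-π^ (ℤ.- ↥ ν))))) (ℤ.≤-reflexive (cancel (↧ ν) (↥ ν)))
    where
    cancel : ∀ a b → 0ℤ ≡ a ℤ.* (ℤ.- (ℤ.- b)) ℤ.+ b ℤ.* (ℤ.- a)
    cancel = solve-∀

  π^-growth : ∀ f {z} → z ≤ᴱ f → ∀ n → z ℤ.+ + n ≤ᴱ πᴱ ^ n · f
  π^-growth f {z} z≤f zero i = ≡.subst (λ y → q y ≤w[ i ] coeff (πᴱ ^ 0 · f) i) (≡.sym (ℤ.+-identityʳ z))
    (≡.subst (λ g → q z ≤w[ i ] coeff (g · f) i) (≡.sym (^-0 πᴱ)) (≤w-cong (K.sym (E.*-identityˡ f i)) (z≤f i)))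
  π^-growth f {z} z≤f (suc n) i = ≤w-cong
    (K.sym (K.trans (E.*-congʳ {f} {πᴱ ^ suc n} {πᴱ · πᴱ ^ n} (^-suc πᴱ n) i) (E.*-assoc πᴱ (πᴱ ^ n) f i)))
    (≡.subst (_≤ᴱ πᴱ · (πᴱ ^ n · f)) (move z (+ n)) (≤ᴱ-· πᴱ (πᴱ ^ n · f) 1≤π (π^-growth f z≤f n)) i)
    where
    move : ∀ z k → 1ℤ ℤ.+ (z ℤ.+ k) ≡ z ℤ.+ (1ℤ ℤ.+ k)
    move = solve-∀

  0≤i+∣i∣ : ∀ i → 0ℤ ℤ.≤ i ℤ.+ + ℤ.∣ i ∣
  0≤i+∣i∣ i = ≡.subst (ℤ._≤ i ℤ.+ + ℤ.∣ i ∣) (ℤ.+-inverseʳ i) (ℤ.+-monoʳ-≤ i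
    (≡.subst (λ n → ℤ.- i ℤ.≤ + n) (ℤ.∣-i∣≡∣i∣ i) (i≤∣i∣ (ℤ.- i))))

  -- Every factor π adds at least one unit of weight, so |z| of them lift a lower bound z to 0.
  clear : ∀ f → ∃[ n ] πᴱ ^ n · f ∈ Sᵤ
  clear f = let (z , z≤f) = ≤ᴱ-bound f in
    ℤ.∣ z ∣ , 0≤ᴱ⇒Sᵤ {πᴱ ^ ℤ.∣ z ∣ · f}
      (≤ᴱ-weaken (πᴱ ^ ℤ.∣ z ∣ · f) (0≤i+∣i∣ z) (π^-growth f z≤f ℤ.∣ z ∣))

  SupportedFrom : ℤ → ℰ → Set ℓ
  SupportedFrom z f = ∀ i → i ℤ.< z → coeff f i ≈ 0#

  ω^-support : ∀ f {z} → SupportedFrom z f → ∀ n → SupportedFrom (z ℤ.+ + n) (ωᴱ ^ n · f)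
  ω^-support f {z} z≤f zero i i<z = K.trans (≡.subst (λ g → coeff (g · f) i ≈ coeff f i) (≡.sym (^-0 ωᴱ)) (E.*-identityˡ f i)) (z≤f i (≡.subst (i ℤ.<_) (ℤ.+-identityʳ z) i<z))
  ω^-support f {z} z≤f (suc n) i i<z = begin
    coeff (ωᴱ ^ suc n · f) i                    ≈⟨ E.*-congʳ {f} {ωᴱ ^ suc n} {ωᴱ · ωᴱ ^ n} (^-suc ωᴱ n) i ⟩
    coeff ((ωᴱ · ωᴱ ^ n) · f) i                 ≈⟨ E.*-assoc ωᴱ (ωᴱ ^ n) f i ⟩
    coeff (ωᴱ · (ωᴱ ^ n · f)) i                 ≈⟨ coeff-monomial-· (π^ (ℤ.- ↥ ν)) (↧ ν) (ωᴱ ^ n · f) i ⟩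
    (π^ (ℤ.- ↥ ν)) K.* coeff (ωᴱ ^ n · f) (i ℤ.- ↧ ν)  ≈⟨ K.*-congˡ (ω^-support f z≤f n (i ℤ.- ↧ ν) below) ⟩
    (π^ (ℤ.- ↥ ν)) K.* 0#                       ≈⟨ K.zeroʳ _ ⟩
    0#                                          ∎
    where
    move : ∀ z k → z ℤ.+ (1ℤ ℤ.+ k) ℤ.+ ℤ.- 1ℤ ≡ z ℤ.+ k
    move = solve-∀
    -- The actual shift is by α; counting 1 for each factor is enough.
    below : i ℤ.- ↧ ν ℤ.< z ℤ.+ + n
    below = ≡.subst (i ℤ.- ↧ ν ℤ.<_) (move z (+ n))
      (ℤ.+-mono-<-≤ i<z (ℤ.neg-mono-≤ {1ℤ} {↧ ν} (ℤ.+≤+ (ℕ.s≤s ℕ.z≤n))))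

  -- The cut is at an exponent N up to which all Gauss valuations are nonnegative, so the low part
  -- lies in S_{ν,u}. The high part starts after N, and |N| factors u^α/π^β move it to nonnegative
  -- exponents.
  split : ∀ f → ∃[ n ] ∃[ g ] ∃[ h ] f ≈ᴱ g +ᴱ h × ωᴱ ^ n · g ∈ Sπ × h ∈ Sᵤ
  split f = ℤ.∣ N ∣ , high , low , f≈high+low
    , (λ i i<0 → ω^-support high high-support ℤ.∣ N ∣ i (ℤ.<-≤-trans i<0 (0≤i+∣i∣ N)))
    , low-integral
    where
    N : ℤ
    N = proj₁ (lim-∞ f ℚ.0ℚ)
    high low : ℰ
    high = restrict (N ℤ.<?_) f
    low  = restrict (ℤ._≤? N) f
    high-support : SupportedFrom N high
    high-support i i<N = restrict-outside (N ℤ.<?_) f (ℤ.<-asym i<N)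
    f≈high+low : f ≈ᴱ high +ᴱ low
    f≈high+low i = pick (<-≤-connex N i)
      where
      pick : N ℤ.< i ⊎ i ℤ.≤ N → coeff f i ≈ coeff high i K.+ coeff low i
      pick (inj₁ N<i) = K.sym (K.trans (K.+-cong (restrict-inside (N ℤ.<?_) f N<i)
        (restrict-outside (ℤ._≤? N) f (ℤ.<⇒≱ N<i))) (K.+-identityʳ _))
      pick (inj₂ i≤N) = K.sym (K.trans (K.+-cong (restrict-outside (N ℤ.<?_) f (ℤ.≤⇒≯ i≤N))
        (restrict-inside (ℤ._≤? N) f i≤N)) (K.+-identityˡ _))
    low-integral : low ∈ Sᵤ
    low-integral i = pick (<-≤-connex N i)
      where
      pick : N ℤ.< i ⊎ i ℤ.≤ N → ℚ.0ℚ ≤w[ i ] coeff low i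
      pick (inj₁ N<i) = ≤w-cong (K.sym (restrict-outside (ℤ._≤? N) f (ℤ.<⇒≱ N<i))) (≤w-0 i)
      pick (inj₂ i≤N) = ≤w-restrict (ℤ._≤? N) f (proj₂ (lim-∞ f ℚ.0ℚ) i i≤N)

  datum : GluingDatum Sπ Sᵤ
  datum = record
    { P-isSubring = Sπ-isSubring
    ; Q-isSubring = Sᵤ-isSubring
    ; π^ = πᴱ ^_ ; π⁻ = πᴱ⁻¹ ^_ ; ω^ = ωᴱ ^_ ; ω⁻ = ωᴱ⁻¹ ^_
    ; π^-+ = ^-+ πᴱ
    ; ω^-+ = ^-+ ωᴱ
    ; π⁻*π^ = ^-inverse πᴱ πᴱ⁻¹ (monomial-inverse 0ℤ (proj₁ (proj₂ (invert-v v-π))))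
    ; ω⁻*ω^ = ^-inverse ωᴱ ωᴱ⁻¹ (monomial-inverse (↧ ν) (proj₁ (proj₂ (invert-v (v-π^ (ℤ.- ↥ ν))))))
    ; π^∈P = ^-∈ Sπ-isSubring {πᴱ} (monomial-holomorphic (ι π) ℤ.≤-refl)
    ; π^∈Q = ^-∈ Sᵤ-isSubring {πᴱ} (0≤ᴱ⇒Sᵤ {πᴱ} 0≤π)
    ; π⁻∈P = ^-∈ Sπ-isSubring {πᴱ⁻¹} (monomial-holomorphic _ ℤ.≤-refl)
    ; ω^∈P = ^-∈ Sπ-isSubring {ωᴱ} (monomial-holomorphic _ (ℤ.+≤+ ℕ.z≤n))
    ; ω^∈Q = ^-∈ Sᵤ-isSubring {ωᴱ} (0≤ᴱ⇒Sᵤ {ωᴱ} 0≤ω)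
    ; ω⁻∈Q = ^-∈ Sᵤ-isSubring {ωᴱ⁻¹} (0≤ᴱ⇒Sᵤ {ωᴱ⁻¹} 0≤ω⁻¹)
    ; clear = clear
    ; split = split }

-- Maximal modules and the map Ψ.

module Lattices (em : ∀ {a} → ExcludedMiddle a) {c ℓ} (D : CompleteDVR c ℓ) (ν : ℚ) (d : ℕ) where
  open CompleteDVR D using (module K)
  open Series D ν
  open Modules d
  open LaurentSeries D ν using (ℰ-commutativeRing; _·_; ·≈*ᴱ)
  open RingIdentities (CompleteDVR.K D) using (interchange)
  open RingIdentities ℰ-commutativeRing using (x*yz≈y*xz)
  open PrincipalIdeals em D ν
  open Subrings ℰ-commutativeRing
  private
    module V = Vectors ℰ-commutativeRing (Fin d)
    module FV = FieldVectors em ℰ-commutativeRing invertᴱ (Fin d)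
    module Dat = Datum em D ν
    module E = CommutativeRing ℰ-commutativeRing
  open Gluing em ℰ-commutativeRing invertᴱ using (module Glued)
  open Glued Dat.datum using (S-isSubring; π^∈S; ω^∈S) renaming (module Modules to GluedModules; module Intersection to GluedIntersection)
  open GluedModules (Fin d) using (clear-E; glue-P; glue-Q; glue-isSubmodule; π^-cancel; ω^-cancel; π^-+-•; π^-+-•ʳ; ω^-+-•; ω^-+-•ʳ; module Saturation)
  open GluedIntersection d using (span-∩)

  private
    variable
      a : Level
      A : Pred ℰ a
      M N : Subset

  combination≈ : ∀ {n} (f : Fin n → ℰ) (m : Fin n → Carrierᴹ) → combination f m ≈ᴹ V.combination f m
  combination≈ {zero}  f m j i = K.refl
  combination≈ {suc n} f m j i = K.+-cong (K.sym (·≈*ᴱ (f zero) (m zero j) i))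
    (combination≈ (λ k → f (suc k)) (λ k → m (suc k)) j i)

  span⇒ : Span A M ⊆ V.Span A M
  span⇒ {A = A} {M} {x} (n , f , m , f∈ , m∈ , x≈) = V.span-resp {A = A} {M} {V.combination f m} {x}
    (λ j i → K.sym (K.trans (x≈ j i) (combination≈ f m j i))) (V.combination⇒span f m f∈ m∈)

  span⇐ : V.Span A M ⊆ Span A M
  span⇐ {A = A} {M} {x} x∈ = let (n , f , m , f∈ , m∈ , x≈) = V.span⇒combination x∈ in
    n , f , m , f∈ , m∈ , λ j i → K.trans (x≈ j i) (K.sym (combination≈ f m j i))

  submodule⇒ : IsSubmodule A M → V.IsSubmodule A M
  submodule⇒ sub = record
    { resp = resp ; 0∈ = 0-closed ; +∈ = +-closed
    ; •∈ = λ {f} {x} f∈ x∈ → resp {f *ₗ x} {f V.• x} (λ j i → K.sym (·≈*ᴱ f (x j) i)) (*ₗ-closed f∈ x∈) }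
    where open IsSubmodule sub

  submodule⇐ : V.IsSubmodule A M → IsSubmodule A M
  submodule⇐ sub = record
    { resp = resp ; 0-closed = 0∈ ; +-closed = +∈
    ; *ₗ-closed = λ {f} {x} f∈ x∈ → resp {f V.• x} {f *ₗ x} (λ j i → ·≈*ᴱ f (x j) i) (•∈ f∈ x∈) }
    where open V.IsSubmodule sub

  submodule-resp : ∀ {A : Pred ℰ a} → M ≐ N → V.IsSubmodule A M → V.IsSubmodule A N
  submodule-resp (M⊆N , N⊆M) sub = record
    { resp = λ {x} {y} x≈y x∈ → M⊆N (resp {x} {y} x≈y (N⊆M x∈))
    ; 0∈   = M⊆N 0∈
    ; +∈   = λ {x} {y} x∈ y∈ → M⊆N (+∈ {x} {y} (N⊆M x∈) (N⊆M y∈))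
    ; •∈   = λ {f} {x} f∈ x∈ → M⊆N (•∈ {f} {x} f∈ (N⊆M x∈)) }
    where open V.IsSubmodule sub

  span≐ : V.Span A M ≐ Span A M
  span≐ {A = A} {M} = span⇐ {A = A} {M} , span⇒ {A = A} {M}

  -- Powers occur below in the normal form they have in Max; any other form makes
  -- conversion checking unfold the product of ℰ.
  Act : Subset → Carrierᴹ → ℰ → Set (c ⊔ ℓ)
  Act M x f = f *ₗ x ∈ M

  act⇒ : V.IsSubmodule S M → ∀ x {f} → Act M x f → f V.• x ∈ M
  act⇒ sub x {f} = V.IsSubmodule.resp sub {f *ₗ x} {f V.• x} λ j i → K.sym (·≈*ᴱ f (x j) i)

  act⇐ : V.IsSubmodule S M → ∀ x {f} → f V.• x ∈ M → Act M x f
  act⇐ sub x {f} = V.IsSubmodule.resp sub {f V.• x} {f *ₗ x} λ j i → ·≈*ᴱ f (x j) i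

  scale⇒ : V.IsSubmodule S M → ∀ b n x →
    Act M x (RawSemiringDefinitions._^_ (RawRing.rawSemiring (Series.ℰ-rawRing D ν)) b n) → (b Dat.^ n) V.• x ∈ M
  scale⇒ {M = M} sub b n x bx∈ = act⇒ sub x {b Dat.^ n}
    (≡.subst (Act M x) (≡.sym (Dat.^-unfold b n)) bx∈)

  scale⇐ : V.IsSubmodule S M → ∀ b n x → (b Dat.^ n) V.• x ∈ M →
    Act M x (RawSemiringDefinitions._^_ (RawRing.rawSemiring (Series.ℰ-rawRing D ν)) b n)
  scale⇐ {M = M} sub b n x bx∈ = ≡.subst (Act M x) (Dat.^-unfold b n) (act⇐ sub x {b Dat.^ n} bx∈)

  Cleared : Subset → Carrierᴹ → ℕ → Set (c ⊔ ℓ)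
  Cleared M x n = (Dat.πᴱ Dat.^ n) V.• x ∈ M × (Dat.ωᴱ Dat.^ n) V.• x ∈ M

  Max⇒ : V.IsSubmodule S M → ∀ {x} → x ∈ Max M → (S ᵈ) x × ∃[ n ] Cleared M x n
  Max⇒ sub {x} (x∈S , n , πx∈ , ωx∈) =
    x∈S , n , scale⇒ sub (Series.πᴱ D ν) n x πx∈ , scale⇒ sub (Series.u^α/π^β D ν) n x ωx∈

  Max⇐ : V.IsSubmodule S M → ∀ {x} → (S ᵈ) x → ∀ n → Cleared M x n → x ∈ Max M
  Max⇐ sub {x} x∈S n (πx∈ , ωx∈) =
    x∈S , n , scale⇐ sub (Series.πᴱ D ν) n x πx∈ , scale⇐ sub (Series.u^α/π^β D ν) n x ωx∈

  module _ {A : Pred ℰ a} (isSubring : IsSubring A) where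

    module _ (isPrincipal : IsPrincipal A) {N : Subset} (sub : V.IsSubmodule A N) (N⊆A : N ⊆ A ᵈ) where

      basis : V.Basis A N
      basis = FV.basis isSubring isPrincipal (λ j x → x j) V.coordinate-isLinear N sub
        (λ j {x} x∈ → N⊆A {x} x∈ j) (λ _ x≈0 → x≈0)

      open V.Basis basis

      isFree : IsFree A N
      isFree = Level.Lift (c ⊔ ℓ) (Fin rank) , b , independent , N⊆span , span⊆N
        where
        b : Level.Lift (c ⊔ ℓ) (Fin rank) → Carrierᴹ
        b k = vector (Level.lower k)

        Generators : Subset
        Generators x = ∃[ k ] x ≈ᴹ b k

        -- The dual form of the k-th chosen vector, applied to a vanishing combination, isolates its
        -- k-th coefficient.
        independent : LinearlyIndependent A b
        independent i i-injective f f∈ fb≈0 k j = K.trans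
          (K.sym (V.φ-combination linear f (λ l → b (i l)) k (dual-≡ (Level.lower (i k)))
            (λ l l≢k → dual-≢ {Level.lower (i k)} {Level.lower (i l)} λ eq → l≢k (i-injective (≡.cong Level.lift eq))) j))
          (K.trans (φ-cong {V.combination f (λ l → b (i l))} {V.0ᵛ}
              (λ j i′ → K.trans (K.sym (combination≈ f (λ l → b (i l)) j i′)) (fb≈0 j i′)) j)
            (φ-0 j))
          where
          linear : V.IsLinear (dual (Level.lower (i k)))
          linear = dual-linear (Level.lower (i k))
          open V.IsLinear linear

        N⊆span : N ⊆ Span A Generators
        N⊆span {x} x∈ = span⇐ {A = A} {Generators} (V.span-resp {A = A} {Generators} {V.combination f vector} {x}
          (λ j i → K.sym (expand x∈ j i))
          (V.combination⇒span {A = A} {Generators} f vector (λ k → dual∈ k x∈) (λ k → Level.lift k , λ j i → K.refl)))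
          where
          f : Fin rank → ℰ
          f k = dual k x

        span⊆N : Span A Generators ⊆ N
        span⊆N {x} x∈ = V.span⊆ {A = A} {Generators} {N} sub
          (λ (k , y≈) → V.IsSubmodule.resp sub (λ j i → K.sym (y≈ j i)) (vector∈ (Level.lower k)))
          (span⇒ {A = A} {Generators} {x} x∈)

      free : Freeᵈ A N
      free = submodule⇐ sub , N⊆A , isFree

  S⊆Sπ : S ⊆ Sπ
  S⊆Sπ = proj₁

  S⊆Sᵤ : S ⊆ Sᵤ
  S⊆Sᵤ = proj₂

  span⊆ᵈ : ∀ {A : Pred ℰ a} → IsSubring A → S ⊆ A → M ⊆ S ᵈ → V.Span A M ⊆ A ᵈ
  span⊆ᵈ {M = M} {A} isSubring S⊆A M⊆S {x} x∈ j = V.span-elim (λ x → x j ∈ A)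
    (λ x≈y → A.resp (x≈y j)) A.0∈ A.+∈ (λ f∈ m∈ → A.*∈ f∈ (S⊆A (M⊆S m∈ j))) x∈
    where module A = IsSubring isSubring

  module _ {M : Subset} (sub : V.IsSubmodule S M) (M⊆S : M ⊆ S ᵈ) where

    basisπ : V.Basis Sπ (V.Span Sπ M)
    basisπ = basis Sπ-isSubring Sπ-isPrincipal (V.span-isSubmodule M Sπ-isSubring)
      (span⊆ᵈ Sπ-isSubring (λ {f} → S⊆Sπ {f}) M⊆S)

    basisᵤ : V.Basis Sᵤ (V.Span Sᵤ M)
    basisᵤ = basis Sᵤ-isSubring Sᵤ-isPrincipal (V.span-isSubmodule M Sᵤ-isSubring)
      (span⊆ᵈ Sᵤ-isSubring (λ {f} → S⊆Sᵤ {f}) M⊆S)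

    ⊆Max : M ⊆ Max M
    ⊆Max {x} x∈ = Max⇐ sub {x} (M⊆S x∈) 0
      ( V.IsSubmodule.•∈ sub (π^∈S 0) x∈ , V.IsSubmodule.•∈ sub (ω^∈S 0) x∈ )

    span∩span⊆Max : ∀ {x} → x ∈ V.Span Sπ M → x ∈ V.Span Sᵤ M → x ∈ Max M
    span∩span⊆Max {x} x∈π x∈ᵤ =
      let (n , cleared) = Saturation.saturate sub basisπ basisᵤ x∈π x∈ᵤ in
      Max⇐ sub {x} (λ j → span⊆ᵈ Sπ-isSubring (λ {f} → S⊆Sπ {f}) M⊆S x∈π j , span⊆ᵈ Sᵤ-isSubring (λ {f} → S⊆Sᵤ {f}) M⊆S x∈ᵤ j) n cleared

  spanning : ∀ {A : Pred ℰ a} → IsSubring A → M ⊆ V.Span U N → V.Span A M ⊆ V.Span U N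
  spanning {M = M} {N} isSubring M⊆ {x} x∈ = V.span⊆ {N = V.Span U N}
    (V.restrict-scalars (λ {f} _ → _) (V.span-isSubmodule N U-isSubring)) M⊆ {x} x∈

  Sameℰ : Subset → Subset → Set _
  Sameℰ M N = M ⊆ V.Span U N × N ⊆ V.Span U M

  sameℰ⇒ : SameℰSpan M N → Sameℰ M N
  sameℰ⇒ {M} {N} (M⊆N , N⊆M) =
    (λ {x} x∈ → span⇒ {A = U} {N} {x} (M⊆N {x} (span⇐ {A = U} {M} {x} (V.⊆span {A = U} {M} U-isSubring {x} x∈)))) ,
    (λ {x} x∈ → span⇒ {A = U} {M} {x} (N⊆M {x} (span⇐ {A = U} {N} {x} (V.⊆span {A = U} {N} U-isSubring {x} x∈))))

  sameℰ⇐ : Sameℰ M N → SameℰSpan M N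
  sameℰ⇐ {M} {N} (M⊆N , N⊆M) =
    (λ {x} x∈ → span⇐ {A = U} {N} {x} (spanning {M = M} {N} {A = U} U-isSubring (λ {y} → M⊆N {y}) {x} (span⇒ {A = U} {M} {x} x∈))) ,
    (λ {x} x∈ → span⇐ {A = U} {M} {x} (spanning {M = N} {M} {A = U} U-isSubring (λ {y} → N⊆M {y}) {x} (span⇒ {A = U} {N} {x} x∈)))

  max⇒submodule : ∀ {M} → M ∈ Maxᵈ → V.IsSubmodule S M
  max⇒submodule (sub , _) = submodule⇒ sub

  ⊆⟨π⟩ : ∀ M → M ⊆ M ⟨π⟩
  ⊆⟨π⟩ M {x} x∈ = span⇐ {A = Sπ} {M} {x} (V.⊆span {A = Sπ} {M} Sπ-isSubring {x} x∈)

  ⊆⟨u⟩ : ∀ M → M ⊆ M ⟨u⟩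
  ⊆⟨u⟩ M {x} x∈ = span⇐ {A = Sᵤ} {M} {x} (V.⊆span {A = Sᵤ} {M} Sᵤ-isSubring {x} x∈)

  -- From right to left, saturation leads into `Max M`, which is M. Injectivity and the formula for
  -- intersections both rest on this.
  recover : ∀ {M} → M ∈ Maxᵈ → M ≐ M ⟨π⟩ ∩ M ⟨u⟩
  recover {M} M∈@(_ , M⊆S , Max⊆M , _) =
    (λ {x} x∈ → ⊆⟨π⟩ M {x} x∈ , ⊆⟨u⟩ M {x} x∈) ,
    (λ {x} (x∈π , x∈ᵤ) → Max⊆M {x} (span∩span⊆Max {M} (max⇒submodule {M} M∈) M⊆S {x}
      (span⇒ {A = Sπ} {M} {x} x∈π) (span⇒ {A = Sᵤ} {M} {x} x∈ᵤ)))

  -- Both modules are generated by M and contain it.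
  spans-sameℰ : ∀ M → Sameℰ (M ⟨π⟩) (M ⟨u⟩)
  spans-sameℰ M =
    (λ {x} x∈ → spanning {M = M} {M ⟨u⟩} {A = Sπ} Sπ-isSubring
      (λ {y} y∈ → V.⊆span {A = U} {M ⟨u⟩} U-isSubring {y} (⊆⟨u⟩ M {y} y∈)) {x} (span⇒ {A = Sπ} {M} {x} x∈)) ,
    (λ {x} x∈ → spanning {M = M} {M ⟨π⟩} {A = Sᵤ} Sᵤ-isSubring
      (λ {y} y∈ → V.⊆span {A = U} {M ⟨π⟩} U-isSubring {y} (⊆⟨π⟩ M {y} y∈)) {x} (span⇒ {A = Sᵤ} {M} {x} x∈))

  module _ {A B : Subset} (A-sub : V.IsSubmodule Sπ A) (A⊆ : A ⊆ Sπ ᵈ)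
           (B-sub : V.IsSubmodule Sᵤ B) (B⊆ : B ⊆ Sᵤ ᵈ) (same : Sameℰ A B) where

    glued-max : A ∩ B ∈ Maxᵈ
    glued-max = submodule⇐ {A = S} {A ∩ B} sub , (λ {x} → ∩⊆S {x}) , (λ {x} → Max⊆ {x})
      , (λ {x} → ⊆Max {A ∩ B} sub (λ {x} → ∩⊆S {x}) {x})
      where
      sub : V.IsSubmodule S (A ∩ B)
      sub = glue-isSubmodule A-sub B-sub
      ∩⊆S : A ∩ B ⊆ S ᵈ
      ∩⊆S {x} (x∈A , x∈B) j = A⊆ {x} x∈A j , B⊆ {x} x∈B j
      -- π is invertible over S_{ν,π}, so π^n x ∈ A gives x ∈ A; likewise u^α/π^β is invertible over
      -- S_{ν,u}, which gives x ∈ B.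
      Max⊆ : Max (A ∩ B) ⊆ A ∩ B
      Max⊆ {x} x∈ =
        let (_ , n , (πx∈A , _) , (_ , ωx∈B)) = Max⇒ {A ∩ B} sub {x} x∈ in
        π^-cancel {A = A} A-sub n {x} πx∈A , ω^-cancel {A = B} B-sub n {x} ωx∈B

    glued-Ψ : Ψ (A ∩ B) ≐² (A , B)
    glued-Ψ =
      ( (λ {x} x∈ → V.span⊆ {A = Sπ} {A ∩ B} {A} A-sub (λ {y} → proj₁) {x} (span⇒ {A = Sπ} {A ∩ B} {x} x∈))
      , (λ {x} x∈ → span⇐ {A = Sπ} {A ∩ B} {x}
          (glue-P {A = A} {B} A-sub B-sub (λ {y} → proj₁ same {y}) {x} x∈)) ) ,
      ( (λ {x} x∈ → V.span⊆ {A = Sᵤ} {A ∩ B} {B} B-sub (λ {y} → proj₂) {x} (span⇒ {A = Sᵤ} {A ∩ B} {x} x∈))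
      , (λ {x} x∈ → span⇐ {A = Sᵤ} {A ∩ B} {x}
          (glue-Q {A = A} {B} A-sub B-sub (λ {y} → proj₁ same {y}) (λ {y} → proj₂ same {y}) {x} x∈)) )

  spanπ-sub : ∀ M → V.IsSubmodule Sπ (M ⟨π⟩)
  spanπ-sub M = submodule-resp {M = V.Span Sπ M} {M ⟨π⟩} {A = Sπ} (span≐ {A = Sπ} {M})
    (V.span-isSubmodule M Sπ-isSubring)

  spanᵤ-sub : ∀ M → V.IsSubmodule Sᵤ (M ⟨u⟩)
  spanᵤ-sub M = submodule-resp {M = V.Span Sᵤ M} {M ⟨u⟩} {A = Sᵤ} (span≐ {A = Sᵤ} {M})
    (V.span-isSubmodule M Sᵤ-isSubring)

  spanπ⊆ : ∀ M → M ⊆ S ᵈ → M ⟨π⟩ ⊆ Sπ ᵈ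
  spanπ⊆ M M⊆S {x} x∈ =
    span⊆ᵈ {M = M} {A = Sπ} Sπ-isSubring (λ {f} → S⊆Sπ {f}) (λ {y} → M⊆S {y}) {x} (span⇒ {A = Sπ} {M} {x} x∈)

  spanᵤ⊆ : ∀ M → M ⊆ S ᵈ → M ⟨u⟩ ⊆ Sᵤ ᵈ
  spanᵤ⊆ M M⊆S {x} x∈ =
    span⊆ᵈ {M = M} {A = Sᵤ} Sᵤ-isSubring (λ {f} → S⊆Sᵤ {f}) (λ {y} → M⊆S {y}) {x} (span⇒ {A = Sᵤ} {M} {x} x∈)

  span-mono : ∀ {A : Pred ℰ a} → M ⊆ N → Span A M ⊆ Span A N
  span-mono M⊆N (n , f , m , f∈ , m∈ , x≈) = n , f , m , f∈ , (λ k → M⊆N {m k} (m∈ k)) , x≈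

  Ψ-free : ∀ {M} → M ⊆ S ᵈ → Ψ M ∈ (Freeᵈ Sπ ⟨×⟩ Freeᵈ Sᵤ)
  Ψ-free {M} M⊆S =
    free Sπ-isSubring Sπ-isPrincipal {M ⟨π⟩} (spanπ-sub M) (λ {x} → spanπ⊆ M (λ {y} → M⊆S {y}) {x}) ,
    free Sᵤ-isSubring Sᵤ-isPrincipal {M ⟨u⟩} (spanᵤ-sub M) (λ {x} → spanᵤ⊆ M (λ {y} → M⊆S {y}) {x})

  Ψ-injective : ∀ {M M′} → M ∈ Maxᵈ → M′ ∈ Maxᵈ → Ψ M ≐² Ψ M′ → M ≐ M′
  Ψ-injective {M} {M′} M∈ M′∈ ((π⊆ , π⊇) , (u⊆ , u⊇)) =
    (λ {x} x∈ → let (x∈π , x∈ᵤ) = proj₁ (recover {M} M∈) {x} x∈ in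
      proj₂ (recover {M′} M′∈) {x} (π⊆ {x} x∈π , u⊆ {x} x∈ᵤ)) ,
    (λ {x} x∈ → let (x∈π , x∈ᵤ) = proj₁ (recover {M′} M′∈) {x} x∈ in
      proj₂ (recover {M} M∈) {x} (π⊇ {x} x∈π , u⊇ {x} x∈ᵤ))

  preimage⇒sameℰ : ∀ {A B M} → Ψ M ≐² (A , B) → SameℰSpan A B
  preimage⇒sameℰ {A} {B} {M} ((π⊆ , π⊇) , (u⊆ , u⊇)) = sameℰ⇐ {A} {B}
    ( (λ {x} x∈ → spanning {M = M ⟨u⟩} {B} {A = U} U-isSubring
        (λ {y} y∈ → V.⊆span {A = U} {B} U-isSubring {y} (u⊆ {y} y∈)) {x} (proj₁ (spans-sameℰ M) {x} (π⊇ {x} x∈)))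
    , (λ {x} x∈ → spanning {M = M ⟨π⟩} {A} {A = U} U-isSubring
        (λ {y} y∈ → V.⊆span {A = U} {A} U-isSubring {y} (π⊆ {y} y∈)) {x} (proj₂ (spans-sameℰ M) {x} (u⊇ {x} x∈))) )

  Max-mono : V.IsSubmodule S M → V.IsSubmodule S N → M ⊆ N → Max M ⊆ Max N
  Max-mono {M} {N} M-sub N-sub M⊆N {x} x∈ =
    let (x∈S , n , πx∈ , ωx∈) = Max⇒ {M} M-sub {x} x∈ in
    Max⇐ {N} N-sub {x} x∈S n (M⊆N {_} πx∈ , M⊆N {_} ωx∈)

  Maxᵈ-resp : M ≐ N → M ∈ Maxᵈ → N ∈ Maxᵈ
  Maxᵈ-resp {M} {N} (M⊆N , N⊆M) M∈@(_ , M⊆S , Max⊆M , _) =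
    submodule⇐ {A = S} {N} N-sub , N⊆S
    , (λ {x} x∈ → M⊆N {x} (Max⊆M {x} (Max-mono {N} {M} N-sub (max⇒submodule {M} M∈) (λ {y} → N⊆M {y}) {x} x∈)))
    , (λ {x} → ⊆Max {N} N-sub (λ {y} → N⊆S {y}) {x})
    where
    N-sub : V.IsSubmodule S N
    N-sub = submodule-resp {M = M} {N} {A = S} ((λ {x} → M⊆N {x}) , (λ {x} → N⊆M {x})) (max⇒submodule {M} M∈)
    N⊆S : N ⊆ S ᵈ
    N⊆S {x} x∈ = M⊆S {x} (N⊆M {x} x∈)

  module _ {M M′ : Subset} (M∈ : M ∈ Maxᵈ) (M′∈ : M′ ∈ Maxᵈ) where

    private
      P Q : Subset
      P = M ⟨π⟩ ∩ M′ ⟨π⟩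
      Q = M ⟨u⟩ ∩ M′ ⟨u⟩
      M⊆S : M ⊆ S ᵈ
      M⊆S = proj₁ (proj₂ M∈)
      M′⊆S : M′ ⊆ S ᵈ
      M′⊆S = proj₁ (proj₂ M′∈)

      P-sub : V.IsSubmodule Sπ P
      P-sub = V.∩-isSubmodule (spanπ-sub M) (spanπ-sub M′)
      Q-sub : V.IsSubmodule Sᵤ Q
      Q-sub = V.∩-isSubmodule (spanᵤ-sub M) (spanᵤ-sub M′)

      -- A common power of π carries x into both `M ⟨u⟩` and `M′ ⟨u⟩`.
      P⊆ℰQ : P ⊆ V.Span U Q
      P⊆ℰQ {x} (x∈ , x∈′) =
        let (m , πx∈)  = clear-E {B = M ⟨u⟩} (spanᵤ-sub M) {x} (proj₁ (spans-sameℰ M) {x} x∈)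
            (n , πx∈′) = clear-E {B = M′ ⟨u⟩} (spanᵤ-sub M′) {x} (proj₁ (spans-sameℰ M′) {x} x∈′)
        in π^-cancel {A = V.Span U Q} (V.restrict-scalars (λ {f} _ → _) (V.span-isSubmodule Q U-isSubring)) (m ℕ.+ n) {x}
             (V.⊆span {A = U} {Q} U-isSubring
               ( π^-+-•ʳ {A = M ⟨u⟩} (V.restrict-scalars (λ {f} → S⊆Sᵤ {f}) (spanᵤ-sub M)) m n {x} πx∈
               , π^-+-• {A = M′ ⟨u⟩} (V.restrict-scalars (λ {f} → S⊆Sᵤ {f}) (spanᵤ-sub M′)) m n {x} πx∈′ ))

      -- Elements of `M ⟨u⟩` may have infinitely many terms of negative degree, which no power of
      -- u^α/π^β removes; hence the detour through kernels in `span-∩`.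
      Q⊆ℰP : Q ⊆ V.Span U P
      Q⊆ℰP {x} (x∈ , x∈′) = span-∩ {A = M ⟨π⟩} {M′ ⟨π⟩} (spanπ-sub M) (spanπ-sub M′)
        (λ {y} → spanπ⊆ M (λ {z} → M⊆S {z}) {y}) (λ {y} → spanπ⊆ M′ (λ {z} → M′⊆S {z}) {y}) {x}
        (proj₂ (spans-sameℰ M) {x} x∈) (proj₂ (spans-sameℰ M′) {x} x∈′)

      P⊆ : P ⊆ Sπ ᵈ
      P⊆ {x} (x∈ , _) = spanπ⊆ M (λ {z} → M⊆S {z}) {x} x∈
      Q⊆ : Q ⊆ Sᵤ ᵈ
      Q⊆ {x} (x∈ , _) = spanᵤ⊆ M (λ {z} → M⊆S {z}) {x} x∈

      P∩Q≐M∩M′ : P ∩ Q ≐ M ∩ M′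
      P∩Q≐M∩M′ =
        (λ {x} ((x∈π , x∈π′) , (x∈ᵤ , x∈ᵤ′)) →
          proj₂ (recover {M} M∈) {x} (x∈π , x∈ᵤ) , proj₂ (recover {M′} M′∈) {x} (x∈π′ , x∈ᵤ′)) ,
        (λ {x} (x∈ , x∈′) →
          let (x∈π , x∈ᵤ) = proj₁ (recover {M} M∈) {x} x∈ ; (x∈π′ , x∈ᵤ′) = proj₁ (recover {M′} M′∈) {x} x∈′ in
          (x∈π , x∈π′) , (x∈ᵤ , x∈ᵤ′))

      same : Sameℰ P Q
      same = (λ {x} → P⊆ℰQ {x}) , (λ {x} → Q⊆ℰP {x})

    ∩-max : M ∩ M′ ∈ Maxᵈ
    ∩-max = Maxᵈ-resp {P ∩ Q} {M ∩ M′} P∩Q≐M∩M′ (glued-max {P} {Q} P-sub (λ {x} → P⊆ {x}) Q-sub (λ {x} → Q⊆ {x}) same)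

    ∩-Ψ : Ψ (M ∩ M′) ≐² (P , Q)
    ∩-Ψ =
      let ((π⊆ , π⊇) , (u⊆ , u⊇)) = glued-Ψ {P} {Q} P-sub (λ {x} → P⊆ {x}) Q-sub (λ {x} → Q⊆ {x}) same
          (⊆M∩M′ , M∩M′⊆) = P∩Q≐M∩M′ in
      ( (λ {x} x∈ → π⊆ {x} (span-mono {M = M ∩ M′} {P ∩ Q} {A = Sπ} (λ {y} → M∩M′⊆ {y}) {x} x∈))
      , (λ {x} x∈ → span-mono {M = P ∩ Q} {M ∩ M′} {A = Sπ} (λ {y} → ⊆M∩M′ {y}) {x} (π⊇ {x} x∈)) ) ,
      ( (λ {x} x∈ → u⊆ {x} (span-mono {M = M ∩ M′} {P ∩ Q} {A = Sᵤ} (λ {y} → M∩M′⊆ {y}) {x} x∈))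
      , (λ {x} x∈ → span-mono {M = P ∩ Q} {M ∩ M′} {A = Sᵤ} (λ {y} → ⊆M∩M′ {y}) {x} (u⊇ {x} x∈)) )

  ⊞-isSubmodule : ∀ {A : Pred ℰ a} → V.IsSubmodule A M → V.IsSubmodule A N → V.IsSubmodule A (M ⊞ N)
  ⊞-isSubmodule {M = M} {N} M-sub N-sub = record
    { resp = λ x≈y (m , n , m∈ , n∈ , x≈) → m , n , m∈ , n∈ , λ j i → K.trans (K.sym (x≈y j i)) (x≈ j i)
    ; 0∈   = V.0ᵛ , V.0ᵛ , M.0∈ , N.0∈ , λ j i → K.sym (K.+-identityʳ K.0#)
    ; +∈   = λ (m , n , m∈ , n∈ , x≈) (m′ , n′ , m′∈ , n′∈ , y≈) →
        m V.+ᵛ m′ , n V.+ᵛ n′ , M.+∈ m∈ m′∈ , N.+∈ n∈ n′∈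
        , λ j i → K.trans (K.+-cong (x≈ j i) (y≈ j i)) (interchange _ _ _ _)
    ; •∈   = λ {f} {x} f∈ (m , n , m∈ , n∈ , x≈) → f V.• m , f V.• n , M.•∈ f∈ m∈ , N.•∈ f∈ n∈
        , λ j i → K.trans (E.*-congˡ {f} {x j} {m j +ᴱ n j} (x≈ j) i) (E.distribˡ f (m j) (n j) i) }
    where
    module M = V.IsSubmodule M-sub
    module N = V.IsSubmodule N-sub

  module MaximalClosure {N : Subset} (sub : V.IsSubmodule S N) (N⊆S : N ⊆ S ᵈ) where

    private
      module N = V.IsSubmodule sub
      module S′ = IsSubring S-isSubring

    max-closure : V.IsSubmodule S (Max N)
    max-closure = record
      { resp = λ {x} {y} x≈y x∈ → let (x∈S , n , πx∈ , ωx∈) = Max⇒ {N} sub {x} x∈ in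
          Max⇐ {N} sub {y} (λ j → S′.resp {x j} {y j} (x≈y j) (x∈S j)) n
            ( N.resp (λ j → E.*-congˡ {_} {x j} {y j} (x≈y j)) πx∈
            , N.resp (λ j → E.*-congˡ {_} {x j} {y j} (x≈y j)) ωx∈ )
      ; 0∈ = ⊆Max {N} sub (λ {x} → N⊆S {x}) {V.0ᵛ} N.0∈
      ; +∈ = λ {x} {y} x∈ y∈ →
          let (x∈S , m , πx∈ , ωx∈) = Max⇒ {N} sub {x} x∈
              (y∈S , n , πy∈ , ωy∈) = Max⇒ {N} sub {y} y∈ in
          Max⇐ {N} sub {x V.+ᵛ y} (λ j → S′.+∈ {x j} {y j} (x∈S j) (y∈S j)) (m ℕ.+ n)
            ( N.resp (λ j i → K.sym (E.distribˡ (Dat.πᴱ Dat.^ (m ℕ.+ n)) (x j) (y j) i))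
                (N.+∈ (π^-+-•ʳ {A = N} sub m n {x} πx∈) (π^-+-• {A = N} sub m n {y} πy∈))
            , N.resp (λ j i → K.sym (E.distribˡ (Dat.ωᴱ Dat.^ (m ℕ.+ n)) (x j) (y j) i))
                (N.+∈ (ω^-+-•ʳ {A = N} sub m n {x} ωx∈) (ω^-+-• {A = N} sub m n {y} ωy∈)) )
      ; •∈ = λ {f} {x} f∈ x∈ → let (x∈S , n , πx∈ , ωx∈) = Max⇒ {N} sub {x} x∈ in
          Max⇐ {N} sub {f V.• x} (λ j → S′.*∈ {f} {x j} f∈ (x∈S j)) n
            ( N.resp (λ j → x*yz≈y*xz f (Dat.πᴱ Dat.^ n) (x j)) (N.•∈ f∈ πx∈)
            , N.resp (λ j → x*yz≈y*xz f (Dat.ωᴱ Dat.^ n) (x j)) (N.•∈ f∈ ωx∈) ) }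

    merge : ∀ b m n {x} → (b Dat.^ m) V.• (b Dat.^ n) V.• x ∈ N → (b Dat.^ (m ℕ.+ n)) V.• x ∈ N
    merge b m n {x} = N.resp λ j i → K.trans (K.sym (E.*-assoc (b Dat.^ m) (b Dat.^ n) (x j) i))
      (E.*-congʳ {x j} {b Dat.^ m · b Dat.^ n} {b Dat.^ (m ℕ.+ n)} (λ k → K.sym (Dat.^-+ b m n k)) i)

    max-idempotent : Max (Max N) ⊆ Max N
    max-idempotent {x} x∈ =
      let (x∈S , n , πx∈ , ωx∈) = Max⇒ {Max N} max-closure {x} x∈
          (_ , k , ππx∈ , _) = Max⇒ {N} sub {(Dat.πᴱ Dat.^ n) V.• x} πx∈
          (_ , l , _ , ωωx∈) = Max⇒ {N} sub {(Dat.ωᴱ Dat.^ n) V.• x} ωx∈ in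
      -- `Max` asks for one exponent for both parameters: k + n suffices for π, l + n for u^α/π^β,
      -- and their sum for both.
      Max⇐ {N} sub {x} x∈S ((k ℕ.+ n) ℕ.+ (l ℕ.+ n))
        ( π^-+-•ʳ {A = N} sub (k ℕ.+ n) (l ℕ.+ n) {x} (merge Dat.πᴱ k n {x} ππx∈)
        , ω^-+-• {A = N} sub (k ℕ.+ n) (l ℕ.+ n) {x} (merge Dat.ωᴱ l n {x} ωωx∈) )

    max-maximal : Max N ∈ Maxᵈ
    max-maximal = submodule⇐ {A = S} {Max N} max-closure , (λ {x} → proj₁)
      , (λ {x} → max-idempotent {x}) , (λ {x} → ⊆Max {Max N} max-closure (λ {x} → proj₁) {x})

    -- Passing from N to `Max N` adds nothing over either ring, because one of the two parameters
    -- becomes invertible there; `cancel` stands for that division, by π over S_{ν,π} and by u^α/π^β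
    -- over S_{ν,u}.
    max-span : ∀ {T : Pred ℰ a} {X : Subset} → V.IsSubmodule T X → N ⊆ X →
      (∀ n {x} → (Dat.πᴱ Dat.^ n) V.• x ∈ X → (Dat.ωᴱ Dat.^ n) V.• x ∈ X → x ∈ X) → V.Span T (Max N) ⊆ X
    max-span {T = T} {X} X-sub N⊆X cancel {x} = V.span⊆ {A = T} {Max N} {X} X-sub
      (λ {y} y∈ → let (_ , n , πy∈ , ωy∈) = Max⇒ {N} sub {y} y∈ in
        cancel n {y} (N⊆X {_} πy∈) (N⊆X {_} ωy∈)) {x}

  module _ {M M′ : Subset} (M∈ : M ∈ Maxᵈ) (M′∈ : M′ ∈ Maxᵈ) where

    private
      L : Subset
      L = M ⊞ M′

      M-sub = max⇒submodule {M} M∈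
      M′-sub = max⇒submodule {M′} M′∈

      L-sub : V.IsSubmodule S L
      L-sub = ⊞-isSubmodule {A = S} M-sub M′-sub

      L⊆S : L ⊆ S ᵈ
      L⊆S {x} (m , n , m∈ , n∈ , x≈) j = IsSubring.resp S-isSubring {m j +ᴱ n j} {x j}
        (λ i → K.sym (x≈ j i))
        (IsSubring.+∈ S-isSubring {m j} {n j} (proj₁ (proj₂ M∈) {m} m∈ j) (proj₁ (proj₂ M′∈) {n} n∈ j))

      M⊆Max : M ⊆ Max L
      M⊆Max {x} x∈ = ⊆Max {L} L-sub (λ {y} → L⊆S {y}) {x}
        (x , V.0ᵛ , x∈ , V.IsSubmodule.0∈ M′-sub , λ j i → K.sym (K.+-identityʳ _))

      M′⊆Max : M′ ⊆ Max L
      M′⊆Max {x} x∈ = ⊆Max {L} L-sub (λ {y} → L⊆S {y}) {x}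
        (V.0ᵛ , x , V.IsSubmodule.0∈ M-sub , x∈ , λ j i → K.sym (K.+-identityˡ _))

      open MaximalClosure {L} L-sub (λ {x} → L⊆S {x})

    +max-max : M +max M′ ∈ Maxᵈ
    +max-max = max-maximal

    +max-Ψ : Ψ (M +max M′) ≐² (M ⟨π⟩ ⊞ M′ ⟨π⟩ , M ⟨u⟩ ⊞ M′ ⟨u⟩)
    +max-Ψ =
      ( (λ {x} x∈ → max-span {T = Sπ} {M ⟨π⟩ ⊞ M′ ⟨π⟩} π-sub
          (λ { {y} (m , n , m∈ , n∈ , y≈) → m , n , ⊆⟨π⟩ M {m} m∈ , ⊆⟨π⟩ M′ {n} n∈ , y≈ })
          (λ n {y} πy∈ _ → π^-cancel {A = M ⟨π⟩ ⊞ M′ ⟨π⟩} π-sub n {y} πy∈)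
          {x} (span⇒ {A = Sπ} {Max L} {x} x∈))
      , (λ { {x} (m , n , m∈ , n∈ , x≈) → V.IsSubmodule.resp (spanπ-sub (Max L)) {m V.+ᵛ n} {x}
          (λ j i → K.sym (x≈ j i)) (V.IsSubmodule.+∈ (spanπ-sub (Max L)) {m} {n}
            (span-mono {M = M} {Max L} {A = Sπ} (λ {y} → M⊆Max {y}) {m} m∈)
            (span-mono {M = M′} {Max L} {A = Sπ} (λ {y} → M′⊆Max {y}) {n} n∈)) }) ) ,
      ( (λ {x} x∈ → max-span {T = Sᵤ} {M ⟨u⟩ ⊞ M′ ⟨u⟩} u-sub
          (λ { {y} (m , n , m∈ , n∈ , y≈) → m , n , ⊆⟨u⟩ M {m} m∈ , ⊆⟨u⟩ M′ {n} n∈ , y≈ })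
          (λ n {y} _ ωy∈ → ω^-cancel {A = M ⟨u⟩ ⊞ M′ ⟨u⟩} u-sub n {y} ωy∈)
          {x} (span⇒ {A = Sᵤ} {Max L} {x} x∈))
      , (λ { {x} (m , n , m∈ , n∈ , x≈) → V.IsSubmodule.resp (spanᵤ-sub (Max L)) {m V.+ᵛ n} {x}
          (λ j i → K.sym (x≈ j i)) (V.IsSubmodule.+∈ (spanᵤ-sub (Max L)) {m} {n}
            (span-mono {M = M} {Max L} {A = Sᵤ} (λ {y} → M⊆Max {y}) {m} m∈)
            (span-mono {M = M′} {Max L} {A = Sᵤ} (λ {y} → M′⊆Max {y}) {n} n∈)) }) )
      where
      π-sub : V.IsSubmodule Sπ (M ⟨π⟩ ⊞ M′ ⟨π⟩)
      π-sub = ⊞-isSubmodule {A = Sπ} (spanπ-sub M) (spanπ-sub M′)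
      u-sub : V.IsSubmodule Sᵤ (M ⟨u⟩ ⊞ M′ ⟨u⟩)
      u-sub = ⊞-isSubmodule {A = Sᵤ} (spanᵤ-sub M) (spanᵤ-sub M′)

  preimage : ∀ {A B} → A ∈ Freeᵈ Sπ → B ∈ Freeᵈ Sᵤ → SameℰSpan A B →
             A ∩ B ∈ Maxᵈ × Ψ (A ∩ B) ≐² (A , B)
  preimage {A} {B} (A-sub , A⊆ , _) (B-sub , B⊆ , _) same =
    glued-max {A} {B} (submodule⇒ A-sub) (λ {x} → A⊆ {x}) (submodule⇒ B-sub) (λ {x} → B⊆ {x}) (sameℰ⇒ {A} {B} same) ,
    glued-Ψ {A} {B} (submodule⇒ A-sub) (λ {x} → A⊆ {x}) (submodule⇒ B-sub) (λ {x} → B⊆ {x}) (sameℰ⇒ {A} {B} same)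

theorem3p12 :
  (∀ {a} → ExcludedMiddle a) →
  ∀ {c ℓ} (D : CompleteDVR c ℓ) (ν : ℚ) (d : ℕ) .{{_ : NonZero d}} →
  let open Series D ν
      open Modules d
  in
  -- Ψ maps Max^d into Free^d × Free^d
    (∀ {M} → M ∈ Maxᵈ → Ψ M ∈ (Freeᵈ Sπ ⟨×⟩ Freeᵈ Sᵤ))
  -- injectivity
  × (∀ {M M′} → M ∈ Maxᵈ → M′ ∈ Maxᵈ → Ψ M ≐² Ψ M′ → M ≐ M′)
  -- image
  × (∀ {A B} → A ∈ Freeᵈ Sπ → B ∈ Freeᵈ Sᵤ →
       (∃[ M ] M ∈ Maxᵈ × Ψ M ≐² (A , B)) ⇔ SameℰSpan A B)
  -- preimage
  × (∀ {A B} → A ∈ Freeᵈ Sπ → B ∈ Freeᵈ Sᵤ → SameℰSpan A B →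
       A ∩ B ∈ Maxᵈ × Ψ (A ∩ B) ≐² (A , B))
  -- intersections and sums
  × (∀ {M M′} → M ∈ Maxᵈ → M′ ∈ Maxᵈ →
       M ∩ M′ ∈ Maxᵈ × Ψ (M ∩ M′) ≐² (M ⟨π⟩ ∩ M′ ⟨π⟩ , M ⟨u⟩ ∩ M′ ⟨u⟩))
  × (∀ {M M′} → M ∈ Maxᵈ → M′ ∈ Maxᵈ →
       M +max M′ ∈ Maxᵈ × Ψ (M +max M′) ≐² (M ⟨π⟩ ⊞ M′ ⟨π⟩ , M ⟨u⟩ ⊞ M′ ⟨u⟩))
theorem3p12 em D ν d =
    (λ {M} M∈ → Ψ-free {M} (λ {x} → proj₁ (proj₂ M∈) {x}))
  , (λ {M} {M′} → Ψ-injective {M} {M′})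
  , (λ {A} {B} A∈ B∈ → mk⇔ (λ (M , _ , ΨM≐) → preimage⇒sameℰ {A} {B} {M} ΨM≐)
      (λ same → A ∩ B , preimage {A} {B} A∈ B∈ same))
  , (λ {A} {B} → preimage {A} {B})
  , (λ {M} {M′} M∈ M′∈ → ∩-max {M} {M′} M∈ M′∈ , ∩-Ψ {M} {M′} M∈ M′∈)
  , (λ {M} {M′} M∈ M′∈ → +max-max {M} {M′} M∈ M′∈ , +max-Ψ {M} {M′} M∈ M′∈)
  where open Lattices em D ν d
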